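{- Let $a,b,c,d$ be integers, and set $u=a+c$, $v=b+d$. Assume $a\neq 0$, $c\neq 0$ and $u\neq 0$. Then, as operators on $\Lambda$, $$\frac{1}{M}\big(D_{c,d}D_{a,b}-D_{a,b}D_{c,d}\big)\;=\;q^{1+bc}\,\frac{[a]_q[c]_q}{[u]_q}\,\frac{1-q^{da-bc}}{1-q}\,D_{u,v}.$$
   Context: Let $\Lambda$ be the ring of symmetric functions in the infinite alphabet $X=x_1+x_2+\cdots$ with coefficients in $\mathbb{Q}(q)$. Plethystic notation: for a formal expression $E$ (in the $x_i$, $q$, an auxiliary variable $z$, etc.), $p_k[E]$ is obtained from $E$ by replacing every variable (including $q$ and $z$) by its $k$-th power; for $F\in\Lambda$, $F[E]$ is obtained by writing $F$ as a polynomial in the power sums $p_k$ and substituting $p_k\mapsto p_k[E]$. Set $\Omega[E]=\exp\big(\sum_{k\ge1}p_k[E]/k\big)$, so that $\Omega[-zX]=\sum_{r\ge0}(-z)^re_r[X]$. For an integer $u$ put $[u]_q=(1-q^u)/(1-q)$ (so $[u]_q=1+q+\cdots+q^{u-1}$ for $u\ge0$). Throughout set $t=1/q$, $[u]_t=(1-q^{ -u})/(1-q^{ -1})$ and $M=(1-t)(1-q)=(1-q^{ -1})(1-q)$. For integers $u,v$, $D_{u,v}$ is the linear operator on $\Lambda$ defined by $$D_{u,v}F[X]=F\big[X+M[u]_q/z\big]\;\Omega\big[-z[u]_tX\big]\Big|_{z^v},$$ where the product is expanded as a series in $z$ (with finitely many negative powers of $z$ in each homogeneous component) and $|_{z^v}$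 denotes the coefficient of $z^v$. -}

module Defs where

open import Data.Nat as ℕ using (ℕ; zero; suc)
open import Data.Integer as ℤ using (ℤ; +_)
import Data.Integer.Properties as ℤP
open import Data.Rational as ℚ using (ℚ; 0ℚ; 1ℚ)
open import Data.List using (List; []; _∷_; _++_; map; concatMap; foldr; upTo)
import Data.List.Properties as LP
open import Data.Product using (Σ; _×_; _,_; proj₁; proj₂)
open import Data.Empty using (⊥)
open import Relation.Binary.PropositionalEquality
open import Relation.Nullary using (¬_; yes; no; contradiction)

-- Laurent polynomials ℚ[q,q⁻¹]: finite formal sums Σ c·q^e

Laurent : Set
Laurent = List (ℚ × ℤ)

coeffL : Laurent → ℤ → ℚ
coeffL [] n = 0ℚ
coeffL ((c , e) ∷ p) n with e ℤ.≟ n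
... | yes _ = c ℚ.+ coeffL p n
... | no  _ = coeffL p n

infix 4 _≈L_
_≈L_ : Laurent → Laurent → Set
p ≈L r = ∀ n → coeffL p n ≡ coeffL r n

NonZeroL : Laurent → Set
NonZeroL p = ¬ (∀ n → coeffL p n ≡ 0ℚ)

1L : Laurent
1L = (1ℚ , + 0) ∷ []

qL : ℤ → Laurent
qL e = (1ℚ , e) ∷ []

infixl 6 _+L_ _-L_
infixl 7 _*L_

_+L_ : Laurent → Laurent → Laurent
_+L_ = _++_

-L_ : Laurent → Laurent
-L p = map (λ t → (ℚ.- proj₁ t , proj₂ t)) p

_-L_ : Laurent → Laurent → Laurent
p -L r = p +L (-L r)

_*L_ : Laurent → Laurent → Laurent
p *L r = concatMap (λ t → map (λ s → (proj₁ t ℚ.* proj₁ s , proj₂ t ℤ.+ proj₂ s)) r) p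

-- p_k acting on a Laurent polynomial: q ↦ q^k
σL : ℕ → Laurent → Laurent
σL k p = map (λ t → (proj₁ t , + k ℤ.* proj₂ t)) p

oneMinusQ : ℤ → Laurent
oneMinusQ m = 1L -L qL m

oneMinusQ-nz : ∀ m → ¬ (m ≡ + 0) → NonZeroL (oneMinusQ m)
oneMinusQ-nz m m≢0 allz with allz (+ 0)
... | h with m ℤ.≟ + 0
...   | yes m≡0 = m≢0 m≡0
...   | no  _   with h
...     | ()

σL-coeff : ∀ k p n → coeffL (σL (suc k) p) (+ suc k ℤ.* n) ≡ coeffL p n
σL-coeff k [] n = refl
σL-coeff k ((c , e) ∷ p) n with (+ suc k ℤ.* e) ℤ.≟ (+ suc k ℤ.* n) | e ℤ.≟ n
... | yes _ | yes _ = cong (c ℚ.+_) (σL-coeff k p n)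
... | no  _ | no  _ = σL-coeff k p n
... | yes x | no  y = contradiction (ℤP.*-cancelˡ-≡ (+ suc k) e n x) y
... | no  x | yes y = contradiction (cong (+ suc k ℤ.*_) y) x

σL-nz : ∀ k p → NonZeroL p → NonZeroL (σL (suc k) p)
σL-nz k p nz allz = nz (λ n → trans (sym (σL-coeff k p n)) (allz (+ suc k ℤ.* n)))

-- The field ℚ(q) of rational functions: numerator over a (formal)
-- product of nonzero Laurent polynomials; equality is cross-multiplication.

Den : Set
Den = List (Σ Laurent NonZeroL)

prodDen : Den → Laurent
prodDen = foldr (λ d acc → proj₁ d *L acc) 1L

record K : Set where
  constructor _⁄_
  field
    num : Laurent
    den : Den
open K public

infix 4 _≈K_
_≈K_ : K → K → Set
x ≈K y = num x *L prodDen (den y) ≈L num y *L prodDen (den x)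

ι : Laurent → K
ι p = p ⁄ []

ιℚ : ℚ → K
ιℚ c = ι ((c , + 0) ∷ [])

0K 1K : K
0K = ι []
1K = ι 1L

infixl 6 _+K_ _-K_
infixl 7 _*K_

_+K_ : K → K → K
(a ⁄ A) +K (b ⁄ B) = (a *L prodDen B +L b *L prodDen A) ⁄ (A ++ B)

-K_ : K → K
-K (a ⁄ A) = (-L a) ⁄ A

_-K_ : K → K → K
x -K y = x +K (-K y)

_*K_ : K → K → K
(a ⁄ A) *K (b ⁄ B) = (a *L b) ⁄ (A ++ B)

invK : (x : K) → NonZeroL (num x) → K
invK (a ⁄ A) nz = prodDen A ⁄ ((a , nz) ∷ [])

-- p_k on scalars (q ↦ q^k), k ≥ 1 (written suc k)
σK : ℕ → K → K
σK k (a ⁄ A) = σL (suc k) a ⁄ map (λ d → (σL (suc k) (proj₁ d) , σL-nz k (proj₁ d) (proj₂ d))) A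

qK : ℤ → K
qK e = ι (qL e)

bracketQ : ℤ → K
bracketQ u = oneMinusQ u ⁄ ((oneMinusQ (+ 1) , oneMinusQ-nz (+ 1) (λ ())) ∷ [])

-- [u]_t with t = 1/q :  (1 - q^{-u})/(1 - q^{-1})
bracketT : ℤ → K
bracketT u = oneMinusQ (ℤ.- u) ⁄ ((oneMinusQ (ℤ.- + 1) , oneMinusQ-nz (ℤ.- + 1) (λ ())) ∷ [])

bracketQ-nz : ∀ u → ¬ (u ≡ + 0) → NonZeroL (num (bracketQ u))
bracketQ-nz u = oneMinusQ-nz u

-- M = (1 - t)(1 - q) = (1 - q⁻¹)(1 - q)
Mk : K
Mk = ι (oneMinusQ (ℤ.- + 1)) *K ι (oneMinusQ (+ 1))

-- Λ = ℚ(q)[p₁, p₂, …]: finite formal sums Σ c · p_λ.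
-- ENCODING: a monomial is a List ℕ; an entry k stands for p_(k+1),
-- so [k₁, …, kₗ] is p_(k₁+1) ⋯ p_(kₗ+1).

Λ : Set
Λ = List (K × List ℕ)

insert : ℕ → List ℕ → List ℕ
insert x [] = x ∷ []
insert x (y ∷ ys) with x ℕ.≤? y
... | yes _ = x ∷ y ∷ ys
... | no  _ = y ∷ insert x ys

sort : List ℕ → List ℕ
sort = foldr insert []

coeffΛ : Λ → List ℕ → K
coeffΛ [] lam = 0K
coeffΛ ((c , mu) ∷ F) lam with LP.≡-dec ℕ._≟_ (sort mu) lam
... | yes _ = c +K coeffΛ F lam
... | no  _ = coeffΛ F lam

infix 4 _≈Λ_
_≈Λ_ : Λ → Λ → Set
F ≈Λ G = ∀ lam → coeffΛ F lam ≈K coeffΛ G lam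

infixl 6 _+Λ_ _-Λ_
infixl 7 _*Λ_ _·Λ_

_+Λ_ : Λ → Λ → Λ
_+Λ_ = _++_

_·Λ_ : K → Λ → Λ
c ·Λ F = map (λ t → (c *K proj₁ t , proj₂ t)) F

_-Λ_ : Λ → Λ → Λ
F -Λ G = F +Λ ((-K 1K) ·Λ G)

_*Λ_ : Λ → Λ → Λ
F *Λ G = concatMap (λ t → map (λ s → (proj₁ t *K proj₁ s , proj₂ t ++ proj₂ s)) G) F

1Λ : Λ
1Λ = (1K , []) ∷ []

pΛ : ℕ → Λ
pΛ k = (1K , k ∷ []) ∷ []

Series : Set
Series = ℕ → Λ

sumTo : ℕ → (ℕ → Λ) → Λ
sumTo r f = foldr (λ i acc → f i +Λ acc) [] (upTo (suc r))

mulS : Series → Series → Series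
mulS A B r = sumTo r (λ i → A i *Λ B (r ℕ.∸ i))

oneS : Series
oneS zero = 1Λ
oneS (suc _) = []

powS : Series → ℕ → Series
powS A zero = oneS
powS A (suc j) = mulS A (powS A j)

invFact : ℕ → ℚ
invFact zero = 1ℚ
invFact (suc j) = invFact j ℚ.* (+ 1 ℚ./ suc j)

-- exp of a series with zero constant term: Σ_j A^j / j!
expS : Series → Series
expS A r = sumTo r (λ j → ιℚ (invFact j) ·Λ powS A j r)

-- Σ_{k≥1} p_k[-z C X]/k, where p_k[-z C X] = - z^k σ_k(C) p_k[X]
logΩnegzCX : K → Series
logΩnegzCX C zero = []
logΩnegzCX C (suc k) = ((-K σK k C) *K ιℚ (+ 1 ℚ./ suc k)) ·Λ pΛ k

ΩnegzCX : K → Series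
ΩnegzCX C = expS (logΩnegzCX C)

coeffZ : Series → ℤ → Λ
coeffZ A (+ n) = A n
coeffZ A ℤ.-[1+ n ] = []

-- Polynomials in z⁻¹ with coefficients in Λ: list of (j , G) meaning G z^(-j)

ZInv : Set
ZInv = List (ℕ × Λ)

mulZ : ZInv → ZInv → ZInv
mulZ P Q = concatMap (λ t → map (λ s → (proj₁ t ℕ.+ proj₁ s , proj₂ t *Λ proj₂ s)) Q) P

-- p_(k+1)[X + C/z] = p_(k+1) + σ_(k+1)(C) z^(-(k+1))
pShift : K → ℕ → ZInv
pShift C k = (0 , pΛ k) ∷ (suc k , (σK k C) ·Λ 1Λ) ∷ []

plethShift : K → Λ → ZInv
plethShift C F =
  concatMap (λ t → map (λ s → (proj₁ s , proj₁ t ·Λ proj₂ s))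
                       (foldr (λ k acc → mulZ (pShift C k) acc) ((0 , 1Λ) ∷ []) (proj₂ t)))
            F

-- D_{u,v} F = F[X + M[u]_q/z] Ω[-z[u]_t X] |_{z^v}
D : ℤ → ℤ → Λ → Λ
D u v F = concatMap (λ t → proj₂ t *Λ coeffZ (ΩnegzCX (bracketT u)) (v ℤ.+ + proj₁ t))
                    (plethShift (Mk *K bracketQ u) F)

-- M ≠ 0 (its numerator (1-q⁻¹)(1-q) has constant coefficient 2)
Mk-nz : NonZeroL (num Mk)
Mk-nz allz with allz (+ 0)
... | ()

{-# OPTIONS --safe #-}
module Submission where

-- D_{u,v} is determined by D_{u,v} 1, the coefficient E^u_v of z^v in Ω[-z[u]_t X], and by
-- D_{u,v} (p_k F) = p_k D_{u,v} F + p_k[M[u]_q] D_{u,v+k} F.  The commutator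
-- C_{b,d} = D_{c,d} D_{a,b} - D_{a,b} D_{c,d} therefore satisfies
--   C_{b,d} (p_k F) = p_k C_{b,d} F + p_k[M[c]_q] C_{b,d+k} F + p_k[M[a]_q] C_{b+k,d} F,
-- and so does the right-hand side, which leaves the case F = 1.
--
-- With x = q^{-a} and y = q^c, a recursion on b from the logarithmic derivative of E^a gives
-- D_{c,d} E^a_b = Σ_i r_i E^c_{d+i} E^a_{b-i}, where Σ_i r_i w^i = (1-w)(1-xyw)/((1-xw)(1-yw)),
-- that is r_0 = 1 and r_i = A (x^i - y^i) with A = (1-q^a)(1-q^c)/(1-q^{a+c}).  Exchanging the
-- two operators extends the same formula to negative i, so C_{b,d} 1 is a sum over all integers
-- i, which splits into two convolutions of E^a and E^c with geometric weights.  Each is a power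
-- of q times E^{a+c}_{b+d}, because [a]_t + q^{-a}[c]_t = [a+c]_t.

-- The rational function comes from the substitution inside `D c d`: replacing X by X + M[c]_q/z in
-- Ω[-w[a]_t X] produces the factor Ω[-(w/z) M[a]_t[c]_q], and M[a]_t[c]_q = (1-x)(1-y) = 1 - x - y
-- + xy. The operators are used only through their linearity, their values on 1 and the rule for
-- p_k, so this substitution cannot be carried out directly. First-order equations θf = h ⋆ f
-- replace it; they determine f from its constant term because positive integers can be cancelled.
-- The second obstacle is the encoding: Laurent polynomials, scalars and symmetric functions are
-- unnormalised lists, compared by coefficients. The ring laws are proved for finer relations, and
-- coefficients return only at the end. The commutator argument itself lives in an arbitrary
-- `OperatorFamily`, free of lists.

open import Level using (0ℓ)
open import Algebra.Bundles using (CommutativeRing; CommutativeMonoid; RawRing)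
open import Algebra.Morphism.Structures using (IsRingMonomorphism)
open import Algebra.Structures using (IsCommutativeRing)
import Algebra.Morphism.RingMonomorphism as RingMonomorphism
import Algebra.Properties.AbelianGroup as AbelianGroupProperties
import Algebra.Properties.Group as GroupProperties
import Algebra.Properties.Ring as RingProperties
import Algebra.Properties.Semiring.Mult as Mult
import Algebra.Properties.Semiring.Mult.TCOptimised as Mult′
import Algebra.Solver.Ring as RingSolver
open import Algebra.Solver.Ring.AlmostCommutativeRing using (fromCommutativeRing; _-Raw-AlmostCommutative⟶_)
open import Data.Integer as ℤ using (ℤ; +_; -[1+_])
import Data.Integer.Properties as ℤP
import Data.Integer.Solver as ℤS
open import Data.List using (List; []; _∷_; _++_; map; concatMap; foldr; length; applyUpTo)
import Data.List.Properties as LP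
open import Data.List.Relation.Binary.Permutation.Propositional as Perm using (_↭_)
import Data.List.Relation.Binary.Permutation.Propositional.Properties as PermP
open import Data.List.Relation.Unary.All as All using (All; []; _∷_)
open import Data.Maybe using (Maybe; just; nothing)
open import Data.Nat as ℕ using (ℕ; zero; suc)
import Data.Nat.Properties as ℕP
open import Data.Product using (_×_; _,_; proj₁; proj₂)
open import Data.Rational as ℚ using (ℚ; 0ℚ; 1ℚ)
import Data.Rational.Properties as ℚP
import Data.Rational.Unnormalised as ℚᵘ
import Data.Rational.Unnormalised.Properties as ℚᵘP
open import Data.Sum using (inj₁; inj₂)
open import Relation.Binary.Definitions using (tri<; tri≈; tri>)
open import Relation.Binary.PropositionalEquality as ≡ using (_≡_; _≢_)
import Relation.Binary.Reasoning.Setoid as SetoidReasoning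
open import Relation.Nullary using (¬_; yes; no; contradiction)

-- Integers in a commutative ring, and a ring solver with integer coefficients.

module IntegerCoefficients (R : CommutativeRing 0ℓ 0ℓ) where
  open CommutativeRing R
  open RingProperties ring using (-‿distribˡ-*; -‿distribʳ-*)
  open AbelianGroupProperties +-abelianGroup using (⁻¹-∙-comm; ⁻¹-involutive; ε⁻¹≈ε)
  open Mult semiring using (×-homo-+; ×1-homo-*) renaming (_×_ to _×ᵘ_)
  open Mult′ semiring using (×ᵤ≈×) renaming (_×_ to _×′_)
  open SetoidReasoning setoid

  num : ℕ → Carrier
  num n = n ×ᵘ 1#

  num-+ : ∀ m n → num (m ℕ.+ n) ≈ num m + num n
  num-+ m n = ×-homo-+ 1# m n

  -- With the optimised multiple, `int (+ 0)` and `int (+ 1)` compute to `0#` and `1#`, so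
  -- `con (+ 0)` and `con (+ 1)` match these literals in solver equations. `num` keeps the plain
  -- recursion, since inductions unfold `num (suc n)` to `1# + num n`.
  int : ℤ → Carrier
  int (+ n) = n ×′ 1#
  int -[1+ n ] = - (suc n ×′ 1#)

  int-num : ∀ n → int (+ n) ≈ num n
  int-num n = sym (×ᵤ≈× n 1#)

  int-neg : ∀ n → int (ℤ.- (+ n)) ≈ - num n
  int-neg zero = sym ε⁻¹≈ε
  int-neg (suc n) = -‿cong (int-num (suc n))

  ⊖-homo : ∀ m n → int (m ℤ.⊖ n) ≈ num m - num n
  ⊖-homo zero zero = sym (-‿inverseʳ 0#)
  ⊖-homo zero (suc n) = trans (int-neg (suc n)) (sym (+-identityˡ _))
  ⊖-homo (suc m) zero = begin
    int (+ suc m)     ≈⟨ int-num (suc m) ⟩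
    num (suc m)       ≈⟨ +-identityʳ _ ⟨
    num (suc m) + 0#  ≈⟨ +-congˡ ε⁻¹≈ε ⟨
    num (suc m) - 0#  ∎
  ⊖-homo (suc m) (suc n) = begin
    int (suc m ℤ.⊖ suc n)                     ≡⟨ ≡.cong int (ℤP.[1+m]⊖[1+n]≡m⊖n m n) ⟩
    int (m ℤ.⊖ n)                             ≈⟨ ⊖-homo m n ⟩
    num m - num n                             ≈⟨ +-identityˡ _ ⟨
    0# + (num m - num n)                      ≈⟨ +-congʳ (-‿inverseʳ 1#) ⟨
    (1# - 1#) + (num m - num n)               ≈⟨ +-assoc _ _ _ ⟩
    1# + (- 1# + (num m - num n))             ≈⟨ +-congˡ (+-comm _ _) ⟩
    1# + (num m - num n - 1#)                 ≈⟨ +-congˡ (+-assoc _ _ _) ⟩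
    1# + (num m + (- num n - 1#))             ≈⟨ +-assoc _ _ _ ⟨
    1# + num m + (- num n - 1#)               ≈⟨ +-congˡ (+-comm _ _) ⟩
    1# + num m + (- 1# - num n)               ≈⟨ +-congˡ (⁻¹-∙-comm _ _) ⟩
    num (suc m) - num (suc n)                 ∎

  int-+ : ∀ x y → int (x ℤ.+ y) ≈ int x + int y
  int-+ (+ m) (+ n) = begin
    int (+ (m ℕ.+ n))       ≈⟨ int-num (m ℕ.+ n) ⟩
    num (m ℕ.+ n)           ≈⟨ num-+ m n ⟩
    num m + num n           ≈⟨ +-cong (int-num m) (int-num n) ⟨
    int (+ m) + int (+ n)   ∎
  int-+ (+ m) -[1+ n ] = trans (⊖-homo m (suc n)) (+-cong (sym (int-num m)) (sym (int-neg (suc n))))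
  int-+ -[1+ m ] (+ n) = begin
    int (n ℤ.⊖ suc m)            ≈⟨ ⊖-homo n (suc m) ⟩
    num n - num (suc m)          ≈⟨ +-cong (int-num n) (int-neg (suc m)) ⟨
    int (+ n) + int -[1+ m ]     ≈⟨ +-comm _ _ ⟩
    int -[1+ m ] + int (+ n)     ∎
  int-+ -[1+ m ] -[1+ n ] = begin
    int -[1+ suc (m ℕ.+ n) ]       ≈⟨ int-neg (suc (suc (m ℕ.+ n))) ⟩
    - num (suc (suc (m ℕ.+ n)))    ≡⟨ ≡.cong (λ k → - num (suc k)) (≡.sym (ℕP.+-suc m n)) ⟩
    - num (suc m ℕ.+ suc n)        ≈⟨ -‿cong (num-+ (suc m) (suc n)) ⟩
    - (num (suc m) + num (suc n))  ≈⟨ ⁻¹-∙-comm _ _ ⟨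
    - num (suc m) - num (suc n)    ≈⟨ +-cong (int-neg (suc m)) (int-neg (suc n)) ⟨
    int -[1+ m ] + int -[1+ n ]    ∎

  int--‿ : ∀ x → int (ℤ.- x) ≈ - int x
  int--‿ (+ n) = trans (int-neg n) (-‿cong (sym (int-num n)))
  int--‿ -[1+ n ] = sym (⁻¹-involutive _)

  int-*ℕ : ∀ m n → int (+ m ℤ.* + n) ≈ int (+ m) * int (+ n)
  int-*ℕ m n = begin
    int (+ m ℤ.* + n)      ≡⟨ ≡.cong int (≡.sym (ℤP.pos-* m n)) ⟩
    int (+ (m ℕ.* n))      ≈⟨ int-num (m ℕ.* n) ⟩
    num (m ℕ.* n)          ≈⟨ ×1-homo-* m n ⟩
    num m * num n          ≈⟨ *-cong (int-num m) (int-num n) ⟨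
    int (+ m) * int (+ n)  ∎

  int-* : ∀ x y → int (x ℤ.* y) ≈ int x * int y
  int-* (+ m) (+ n) = int-*ℕ m n
  int-* (+ m) -[1+ n ] = begin
    int (+ m ℤ.* (ℤ.- (+ suc n)))   ≡⟨ ≡.cong int (≡.sym (ℤP.neg-distribʳ-* (+ m) (+ suc n))) ⟩
    int (ℤ.- (+ m ℤ.* + suc n))     ≈⟨ int--‿ (+ m ℤ.* + suc n) ⟩
    - int (+ m ℤ.* + suc n)         ≈⟨ -‿cong (int-*ℕ m (suc n)) ⟩
    - (int (+ m) * int (+ suc n))   ≈⟨ -‿distribʳ-* _ _ ⟩
    int (+ m) * int -[1+ n ]        ∎
  int-* -[1+ m ] y = begin
    int ((ℤ.- (+ suc m)) ℤ.* y)     ≡⟨ ≡.cong int (≡.sym (ℤP.neg-distribˡ-* (+ suc m) y)) ⟩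
    int (ℤ.- (+ suc m ℤ.* y))       ≈⟨ int--‿ (+ suc m ℤ.* y) ⟩
    - int (+ suc m ℤ.* y)           ≈⟨ -‿cong (nonneg y) ⟩
    - (int (+ suc m) * int y)       ≈⟨ -‿distribˡ-* _ _ ⟩
    int -[1+ m ] * int y            ∎
    where
    nonneg : ∀ y → int (+ suc m ℤ.* y) ≈ int (+ suc m) * int y
    nonneg (+ n) = int-*ℕ (suc m) n
    nonneg -[1+ n ] = int-* (+ suc m) -[1+ n ]

  private
    morphism : CommutativeRing.rawRing ℤP.+-*-commutativeRing -Raw-AlmostCommutative⟶ fromCommutativeRing R
    morphism = record
      { ⟦_⟧ = int ; +-homo = int-+ ; *-homo = int-* ; -‿homo = int--‿ ; 0-homo = refl ; 1-homo = refl }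

    int-≟ : ∀ x y → Maybe (int x ≈ int y)
    int-≟ x y with x ℤ.≟ y
    ... | yes ≡.refl = just refl
    ... | no _ = nothing

  open RingSolver (CommutativeRing.rawRing ℤP.+-*-commutativeRing) (fromCommutativeRing R) morphism int-≟ public
    using (solve; _:+_; _:*_; _:-_; :-_; _:=_; con)

-- Antidiagonal sums, convolution and the Euler derivation.

module Sums (R : CommutativeRing 0ℓ 0ℓ) where
  open CommutativeRing R
  open IntegerCoefficients R
  open SetoidReasoning setoid

  Seq : Set
  Seq = ℕ → Carrier

  infix 4 _≗_
  _≗_ : Seq → Seq → Set
  f ≗ g = ∀ n → f n ≈ g n

  one : Seq
  one zero = 1#
  one (suc _) = 0#

  coeff : Seq → ℤ → Carrier
  coeff f (+ n) = f n
  coeff f -[1+ n ] = 0#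

  delay : Seq → Seq
  delay f zero = 0#
  delay f (suc n) = f n

  sum : ℕ → Seq → Carrier
  sum zero f = 0#
  sum (suc n) f = f 0 + sum n (λ i → f (suc i))

  antidiagonal : ℕ → (ℕ → ℕ → Carrier) → Carrier
  antidiagonal zero F = F 0 0
  antidiagonal (suc n) F = F 0 (suc n) + antidiagonal n (λ i j → F (suc i) j)

  antidiagonal-cong : ∀ n {F G} → (∀ i j → i ℕ.+ j ≡ n → F i j ≈ G i j) → antidiagonal n F ≈ antidiagonal n G
  antidiagonal-cong zero F≈G = F≈G 0 0 ≡.refl
  antidiagonal-cong (suc n) F≈G =
    +-cong (F≈G 0 (suc n) ≡.refl) (antidiagonal-cong n (λ i j e → F≈G (suc i) j (≡.cong suc e)))

  antidiagonal-zero : ∀ n {F} → (∀ i j → i ℕ.+ j ≡ n → F i j ≈ 0#) → antidiagonal n F ≈ 0#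
  antidiagonal-zero zero F≈0 = F≈0 0 0 ≡.refl
  antidiagonal-zero (suc n) F≈0 = trans
    (+-cong (F≈0 0 (suc n) ≡.refl) (antidiagonal-zero n (λ i j e → F≈0 (suc i) j (≡.cong suc e))))
    (+-identityˡ 0#)

  +-interchange : ∀ w x y z → (w + x) + (y + z) ≈ (w + y) + (x + z)
  +-interchange = solve 4 (λ w x y z → (w :+ x) :+ (y :+ z) := (w :+ y) :+ (x :+ z)) refl

  antidiagonal-+ : ∀ n F G → antidiagonal n (λ i j → F i j + G i j) ≈ antidiagonal n F + antidiagonal n G
  antidiagonal-+ zero F G = refl
  antidiagonal-+ (suc n) F G =
    trans (+-congˡ (antidiagonal-+ n (λ i → F (suc i)) (λ i → G (suc i)))) (+-interchange _ _ _ _)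

  antidiagonal-*ˡ : ∀ n c F → antidiagonal n (λ i j → c * F i j) ≈ c * antidiagonal n F
  antidiagonal-*ˡ zero c F = refl
  antidiagonal-*ˡ (suc n) c F = trans (+-congˡ (antidiagonal-*ˡ n c (λ i → F (suc i)))) (sym (distribˡ _ _ _))

  antidiagonal-last : ∀ n F → antidiagonal (suc n) F ≈ F (suc n) 0 + antidiagonal n (λ i j → F i (suc j))
  antidiagonal-last zero F = +-comm _ _
  antidiagonal-last (suc n) F = begin
    F 0 (suc (suc n)) + antidiagonal (suc n) (λ i → F (suc i))
      ≈⟨ +-congˡ (antidiagonal-last n (λ i → F (suc i))) ⟩
    F 0 (suc (suc n)) + (F (suc (suc n)) 0 + antidiagonal n (λ i j → F (suc i) (suc j)))
      ≈⟨ solve 3 (λ x y z → x :+ (y :+ z) := y :+ (x :+ z)) refl _ _ _ ⟩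
    F (suc (suc n)) 0 + (F 0 (suc (suc n)) + antidiagonal n (λ i j → F (suc i) (suc j))) ∎

  antidiagonal-swap : ∀ n F → antidiagonal n F ≈ antidiagonal n (λ i j → F j i)
  antidiagonal-swap zero F = refl
  antidiagonal-swap (suc n) F =
    trans (antidiagonal-last n F) (+-congˡ (antidiagonal-swap n (λ i j → F i (suc j))))

  -- The antidiagonal i + j = m + n, cut at the point (n , m), which is counted twice on the left.
  antidiagonal-split : ∀ n m F →
    antidiagonal m (λ i j → F (n ℕ.+ i) j) + antidiagonal n (λ i j → F j (m ℕ.+ i))
      ≈ antidiagonal (m ℕ.+ n) F + F n m
  antidiagonal-split zero m F = begin
    antidiagonal m F + F 0 (m ℕ.+ 0)          ≡⟨ ≡.cong (λ k → antidiagonal m F + F 0 k) (ℕP.+-identityʳ m) ⟩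
    antidiagonal m F + F 0 m                  ≡⟨ ≡.cong (λ k → antidiagonal k F + F 0 m) (≡.sym (ℕP.+-identityʳ m)) ⟩
    antidiagonal (m ℕ.+ 0) F + F 0 m          ∎
  antidiagonal-split (suc n) m F = begin
    antidiagonal m (λ i j → F (suc (n ℕ.+ i)) j) + antidiagonal (suc n) (λ i j → F j (m ℕ.+ i))
      ≈⟨ +-congˡ (antidiagonal-last n (λ i j → F j (m ℕ.+ i))) ⟩
    antidiagonal m (λ i j → F (suc (n ℕ.+ i)) j) + (F 0 (m ℕ.+ suc n) + antidiagonal n (λ i j → F (suc j) (m ℕ.+ i)))
      ≈⟨ solve 3 (λ x y z → x :+ (y :+ z) := y :+ (x :+ z)) refl _ _ _ ⟩
    F 0 (m ℕ.+ suc n) + (antidiagonal m (λ i j → F (suc (n ℕ.+ i)) j) + antidiagonal n (λ i j → F (suc j) (m ℕ.+ i)))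
      ≈⟨ +-congˡ (antidiagonal-split n m (λ i → F (suc i))) ⟩
    F 0 (m ℕ.+ suc n) + (antidiagonal (m ℕ.+ n) (λ i → F (suc i)) + F (suc n) m)
      ≈⟨ +-assoc _ _ _ ⟨
    F 0 (m ℕ.+ suc n) + antidiagonal (m ℕ.+ n) (λ i → F (suc i)) + F (suc n) m
      ≡⟨ ≡.cong (λ k → F 0 k + antidiagonal (m ℕ.+ n) (λ i → F (suc i)) + F (suc n) m) (ℕP.+-suc m n) ⟩
    antidiagonal (suc (m ℕ.+ n)) F + F (suc n) m
      ≡⟨ ≡.cong (λ k → antidiagonal k F + F (suc n) m) (≡.sym (ℕP.+-suc m n)) ⟩
    antidiagonal (m ℕ.+ suc n) F + F (suc n) m ∎

  antidiagonal-one : ∀ n (F : ℕ → ℕ → Carrier) → antidiagonal n (λ i j → one i * F i j) ≈ F 0 n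
  antidiagonal-one zero F = *-identityˡ _
  antidiagonal-one (suc n) F =
    trans (+-cong (*-identityˡ _) (antidiagonal-zero n (λ _ _ _ → zeroˡ _))) (+-identityʳ _)

  -- Terms of negative first index vanish, so a sum that starts at -(n+1) is a full antidiagonal sum
  -- of degree m - (n+1), empty when this is negative. It serves the case of a negative d.
  antidiagonal-shift : ∀ (F : ℤ → ℕ → Carrier) → (∀ n j → F -[1+ n ] j ≈ 0#) → ∀ m n →
    antidiagonal m (λ i j → F (-[1+ n ] ℤ.+ + i) j) ≈ coeff (λ N → antidiagonal N (λ i j → F (+ i) j)) (m ℤ.⊖ suc n)
  antidiagonal-shift F F≈0 zero n = F≈0 n 0
  antidiagonal-shift F F≈0 (suc m) n = trans (+-cong (F≈0 n (suc m)) (shift n)) (+-identityˡ _)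
    where
    S : Seq
    S N = antidiagonal N (λ i j → F (+ i) j)

    shift : ∀ n → antidiagonal m (λ i j → F (suc i ℤ.⊖ suc n) j) ≈ coeff S (suc m ℤ.⊖ suc n)
    shift zero = refl
    shift (suc n) = begin
      antidiagonal m (λ i j → F (suc i ℤ.⊖ suc (suc n)) j)
        ≈⟨ antidiagonal-cong m (λ i j _ → reflexive (≡.cong (λ k → F k j) (ℤP.[1+m]⊖[1+n]≡m⊖n i (suc n)))) ⟩
      antidiagonal m (λ i j → F (i ℤ.⊖ suc n) j)
        ≈⟨ antidiagonal-shift F F≈0 m n ⟩
      coeff S (m ℤ.⊖ suc n)
        ≡⟨ ≡.cong (coeff S) (≡.sym (ℤP.[1+m]⊖[1+n]≡m⊖n m (suc n))) ⟩
      coeff S (suc m ℤ.⊖ suc (suc n)) ∎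

  sum-cong : ∀ n {f g} → (∀ i → i ℕ.< n → f i ≈ g i) → sum n f ≈ sum n g
  sum-cong zero f≈g = refl
  sum-cong (suc n) f≈g = +-cong (f≈g 0 (ℕ.s≤s ℕ.z≤n)) (sum-cong n (λ i i<n → f≈g (suc i) (ℕ.s≤s i<n)))

  sum-*ˡ : ∀ n c f → sum n (λ i → c * f i) ≈ c * sum n f
  sum-*ˡ zero c f = sym (zeroʳ c)
  sum-*ˡ (suc n) c f = trans (+-congˡ (sum-*ˡ n c (λ i → f (suc i)))) (sym (distribˡ _ _ _))

  sum-last : ∀ n f → sum (suc n) f ≈ sum n f + f n
  sum-last zero f = +-comm _ _
  sum-last (suc n) f = trans (+-congˡ (sum-last n (λ i → f (suc i)))) (sym (+-assoc _ _ _))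

  sum-∸ : ∀ n (F : ℕ → ℕ → Carrier) → sum (suc n) (λ i → F i (n ℕ.∸ i)) ≈ antidiagonal n F
  sum-∸ zero F = +-identityʳ _
  sum-∸ (suc n) F = +-congˡ (sum-∸ n (λ i → F (suc i)))

  sum-antidiagonal : ∀ N n (F : ℕ → ℕ → ℕ → Carrier) →
    sum N (λ k → antidiagonal n (F k)) ≈ antidiagonal n (λ i j → sum N (λ k → F k i j))
  sum-antidiagonal zero n F = sym (antidiagonal-zero n (λ _ _ _ → refl))
  sum-antidiagonal (suc N) n F =
    trans (+-congˡ (sum-antidiagonal N n (λ k → F (suc k)))) (sym (antidiagonal-+ n _ _))

  infixl 7 _⋆_
  _⋆_ : Seq → Seq → Seq
  (f ⋆ g) n = antidiagonal n (λ i j → f i * g j)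

  ⋆-cong : ∀ {f f′ g g′} → f ≗ f′ → g ≗ g′ → f ⋆ g ≗ f′ ⋆ g′
  ⋆-cong p q n = antidiagonal-cong n (λ i j _ → *-cong (p i) (q j))

  ⋆-comm : ∀ f g → f ⋆ g ≗ g ⋆ f
  ⋆-comm f g n = trans (antidiagonal-swap n _) (antidiagonal-cong n (λ i j _ → *-comm _ _))

  ⋆-distribʳ : ∀ h f g → (λ n → f n + g n) ⋆ h ≗ (λ n → (f ⋆ h) n + (g ⋆ h) n)
  ⋆-distribʳ h f g n = trans (antidiagonal-cong n (λ i j _ → distribʳ _ _ _)) (antidiagonal-+ n _ _)

  ⋆-*ˡ : ∀ c f g → (λ n → c * f n) ⋆ g ≗ (λ n → c * (f ⋆ g) n)
  ⋆-*ˡ c f g n = trans (antidiagonal-cong n (λ i j _ → *-assoc _ _ _)) (antidiagonal-*ˡ n c _)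

  -- Both sides run over triples i + k + j = n with the weight attached to i + k, so associativity
  -- survives. In `interaction` the weight is a coefficient of `E c` whose index is raised by both i
  -- and k.
  ⋆-assoc-weighted : ∀ n (f g H e : Seq) →
    antidiagonal n (λ i j → f i * ((λ k → g k * H (i ℕ.+ k)) ⋆ e) j) ≈ ((λ m → (f ⋆ g) m * H m) ⋆ e) n
  ⋆-assoc-weighted zero f g H e =
    solve 4 (λ f g H e → f :* (g :* H :* e) := f :* g :* H :* e) refl _ _ _ _
  ⋆-assoc-weighted (suc n) f g H e = begin
    f 0 * (g 0 * H 0 * e (suc n) + (g₁ ⋆ e) n) + antidiagonal n (λ i j → f (suc i) * ((λ k → g k * H (suc i ℕ.+ k)) ⋆ e) j)
      ≈⟨ +-congˡ (⋆-assoc-weighted n (λ i → f (suc i)) g (λ i → H (suc i)) e) ⟩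
    f 0 * (g 0 * H 0 * e (suc n) + (g₁ ⋆ e) n) + (h ⋆ e) n
      ≈⟨ solve 6 (λ f g H e A B → f :* (g :* H :* e :+ A) :+ B
          := f :* g :* H :* e :+ (f :* A :+ B)) refl _ _ _ _ _ _ ⟩
    f 0 * g 0 * H 0 * e (suc n) + (f 0 * (g₁ ⋆ e) n + (h ⋆ e) n)
      ≈⟨ +-congˡ (+-congʳ (⋆-*ˡ (f 0) g₁ e n)) ⟨
    f 0 * g 0 * H 0 * e (suc n) + (((λ k → f 0 * g₁ k) ⋆ e) n + (h ⋆ e) n)
      ≈⟨ +-congˡ (⋆-distribʳ e (λ k → f 0 * g₁ k) h n) ⟨
    f 0 * g 0 * H 0 * e (suc n) + ((λ k → f 0 * g₁ k + h k) ⋆ e) n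
      ≈⟨ +-congˡ (⋆-cong {g = e} (λ k → solve 4 (λ f g H c → f :* (g :* H) :+ c :* H
          := (f :* g :+ c) :* H) refl (f 0) (g (suc k)) (H (suc k)) _) (λ _ → refl) n) ⟩
    ((λ m → (f ⋆ g) m * H m) ⋆ e) (suc n) ∎
    where
    g₁ h : Seq
    g₁ k = g (suc k) * H (suc k)
    h m = ((λ i → f (suc i)) ⋆ g) m * H (suc m)

  ⋆-assoc : ∀ f g h → (f ⋆ g) ⋆ h ≗ f ⋆ (g ⋆ h)
  ⋆-assoc f g h n = begin
    ((f ⋆ g) ⋆ h) n
      ≈⟨ ⋆-cong {g = h} (λ m → *-identityʳ ((f ⋆ g) m)) (λ _ → refl) n ⟨
    ((λ m → (f ⋆ g) m * 1#) ⋆ h) n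
      ≈⟨ ⋆-assoc-weighted n f g (λ _ → 1#) h ⟨
    (f ⋆ ((λ k → g k * 1#) ⋆ h)) n
      ≈⟨ ⋆-cong {f = f} (λ _ → refl) (⋆-cong {g = h} (λ k → *-identityʳ (g k)) (λ _ → refl)) n ⟩
    (f ⋆ (g ⋆ h)) n ∎

  -- the Euler derivation z d/dz
  θ : Seq → Seq
  θ f n = num n * f n

  θ-⋆ : ∀ f g → θ (f ⋆ g) ≗ (λ n → (θ f ⋆ g) n + (f ⋆ θ g) n)
  θ-⋆ f g n = begin
    num n * (f ⋆ g) n
      ≈⟨ antidiagonal-*ˡ n (num n) _ ⟨
    antidiagonal n (λ i j → num n * (f i * g j))
      ≈⟨ antidiagonal-cong n leibniz ⟩
    antidiagonal n (λ i j → θ f i * g j + f i * θ g j)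
      ≈⟨ antidiagonal-+ n _ _ ⟩
    (θ f ⋆ g) n + (f ⋆ θ g) n ∎
    where
    leibniz : ∀ i j → i ℕ.+ j ≡ n → num n * (f i * g j) ≈ θ f i * g j + f i * θ g j
    leibniz i j ≡.refl = trans (*-congʳ (num-+ i j))
      (solve 4 (λ x y f g → (x :+ y) :* (f :* g) := x :* f :* g :+ f :* (y :* g)) refl _ _ _ _)

  θ-cong : ∀ {f g} → f ≗ g → θ f ≗ θ g
  θ-cong p n = *-congˡ (p n)

  infixr 8 _^^_
  _^^_ : Carrier → ℕ → Carrier
  x ^^ zero = 1#
  x ^^ suc n = x * x ^^ n

  ^^-+ : ∀ x m n → x ^^ (m ℕ.+ n) ≈ x ^^ m * x ^^ n
  ^^-+ x zero n = sym (*-identityˡ _)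
  ^^-+ x (suc m) n = trans (*-congˡ (^^-+ x m n)) (sym (*-assoc _ _ _))

  ^^-cong : ∀ {x y} n → x ≈ y → x ^^ n ≈ y ^^ n
  ^^-cong zero x≈y = refl
  ^^-cong (suc n) x≈y = *-cong x≈y (^^-cong n x≈y)

  -- f(z) ↦ f(xz)
  scale : Carrier → Seq → Seq
  scale x f n = x ^^ n * f n

  scale-⋆ : ∀ x f g → scale x (f ⋆ g) ≗ scale x f ⋆ scale x g
  scale-⋆ x f g n = trans (sym (antidiagonal-*ˡ n _ _)) (antidiagonal-cong n distribute)
    where
    distribute : ∀ i j → i ℕ.+ j ≡ n → x ^^ n * (f i * g j) ≈ scale x f i * scale x g j
    distribute i j ≡.refl = trans (*-congʳ (^^-+ x i j))
      (solve 4 (λ a b f g → (a :* b) :* (f :* g) := (a :* f) :* (b :* g)) refl _ _ _ _)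

  NumCancel : Set
  NumCancel = ∀ n x y → num (suc n) * x ≈ num (suc n) * y → x ≈ y

  -- Because h has no constant term, degree n + 1 of the equation expresses (n+1) f_{n+1} through
  -- the smaller coefficients, and `cancel` divides by n + 1.
  log-derivative-unique : NumCancel → ∀ h f g → h 0 ≈ 0# → θ f ≗ h ⋆ f → θ g ≗ h ⋆ g → f 0 ≈ g 0 → f ≗ g
  log-derivative-unique cancel h f g h0 θf θg f0 n = upTo n n ℕP.≤-refl
    where
    vanish : ∀ x → h 0 * x ≈ 0#
    vanish x = trans (*-congʳ h0) (zeroˡ x)

    -- The bound N makes strong induction structural: degree n + 1 of the equation involves all
    -- smaller degrees.
    upTo : ∀ N n → n ℕ.≤ N → f n ≈ g n
    upTo N zero _ = f0
    upTo (suc N) (suc n) (ℕ.s≤s n≤N) = cancel n _ _ (begin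
      num (suc n) * f (suc n)                                             ≈⟨ θf (suc n) ⟩
      h 0 * f (suc n) + antidiagonal n (λ i j → h (suc i) * f j)
        ≈⟨ +-cong (trans (vanish _) (sym (vanish _)))
             (antidiagonal-cong n (λ i j e → *-congˡ (upTo N j (ℕP.≤-trans (ℕP.m+n≤o⇒n≤o i (ℕP.≤-reflexive e)) n≤N)))) ⟩
      h 0 * g (suc n) + antidiagonal n (λ i j → h (suc i) * g j)          ≈⟨ θg (suc n) ⟨
      num (suc n) * g (suc n)                                             ∎)

-- Exponentials of sequences without constant term.

module Exponential (R : CommutativeRing 0ℓ 0ℓ) where
  open CommutativeRing R
  open IntegerCoefficients R
  open Sums R
  open SetoidReasoning setoid

  ⋆-*ʳ : ∀ c f g → f ⋆ (λ n → c * g n) ≗ (λ n → c * (f ⋆ g) n)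
  ⋆-*ʳ c f g n = trans (⋆-comm f _ n) (trans (⋆-*ˡ c g f n) (*-congˡ (⋆-comm g f n)))

  ⋆-leftComm : ∀ f g h → f ⋆ (g ⋆ h) ≗ g ⋆ (f ⋆ h)
  ⋆-leftComm f g h n = begin
    (f ⋆ (g ⋆ h)) n   ≈⟨ ⋆-assoc f g h n ⟨
    ((f ⋆ g) ⋆ h) n   ≈⟨ ⋆-cong {g = h} (⋆-comm f g) (λ _ → refl) n ⟩
    ((g ⋆ f) ⋆ h) n   ≈⟨ ⋆-assoc g f h n ⟩
    (g ⋆ (f ⋆ h)) n   ∎

  power : Seq → ℕ → Seq
  power A zero = one
  power A (suc j) = A ⋆ power A j

  θ-power : ∀ A j → θ (power A (suc j)) ≗ (λ n → num (suc j) * (θ A ⋆ power A j) n)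
  θ-power A zero n = begin
    θ (A ⋆ one) n                      ≈⟨ θ-⋆ A one n ⟩
    (θ A ⋆ one) n + (A ⋆ θ one) n
      ≈⟨ +-congˡ (antidiagonal-zero n (λ i j _ → trans (*-congˡ (θ-one j)) (zeroʳ _))) ⟩
    (θ A ⋆ one) n + 0#                 ≈⟨ solve 1 (λ x → x :+ con (+ 0) := (con (+ 1) :+ con (+ 0)) :* x) refl _ ⟩
    num 1 * (θ A ⋆ one) n              ∎
    where
    θ-one : ∀ j → θ one j ≈ 0#
    θ-one zero = zeroˡ _
    θ-one (suc j) = zeroʳ _
  θ-power A (suc j) n = begin
    θ (A ⋆ power A (suc j)) n
      ≈⟨ θ-⋆ A (power A (suc j)) n ⟩
    (θ A ⋆ power A (suc j)) n + (A ⋆ θ (power A (suc j))) n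
      ≈⟨ +-congˡ (⋆-cong {f = A} (λ _ → refl) (θ-power A j) n) ⟩
    (θ A ⋆ power A (suc j)) n + (A ⋆ (λ k → num (suc j) * (θ A ⋆ power A j) k)) n
      ≈⟨ +-congˡ (⋆-*ʳ (num (suc j)) A (θ A ⋆ power A j) n) ⟩
    (θ A ⋆ power A (suc j)) n + num (suc j) * (A ⋆ (θ A ⋆ power A j)) n
      ≈⟨ +-congˡ (*-congˡ (⋆-leftComm A (θ A) (power A j) n)) ⟩
    (θ A ⋆ power A (suc j)) n + num (suc j) * (θ A ⋆ power A (suc j)) n
      ≈⟨ solve 2 (λ m x → x :+ m :* x := (con (+ 1) :+ m) :* x) refl _ _ ⟩
    num (suc (suc j)) * (θ A ⋆ power A (suc j)) n ∎

  module _ (A : Seq) (A-0 : A 0 ≈ 0#) (inv! : Seq) (inv!-suc : ∀ j → num (suc j) * inv! (suc j) ≈ inv! j) where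

    power-vanishes : ∀ j n → n ℕ.< j → power A j n ≈ 0#
    power-vanishes (suc j) zero _ = trans (*-congʳ A-0) (zeroˡ _)
    power-vanishes (suc j) (suc n) (ℕ.s≤s n<j) = begin
      A 0 * power A j (suc n) + antidiagonal n (λ i k → A (suc i) * power A j k)
        ≈⟨ +-cong (trans (*-congʳ A-0) (zeroˡ _))
             (antidiagonal-zero n (λ i k e → trans
               (*-congˡ (power-vanishes j k (ℕP.≤-<-trans (ℕP.m+n≤o⇒n≤o i (ℕP.≤-reflexive e)) n<j)))
               (zeroʳ _))) ⟩
      0# + 0#  ≈⟨ +-identityˡ _ ⟩
      0#       ∎

    partialExp : ℕ → Seq
    partialExp N n = sum N (λ j → inv! j * power A j n)

    -- Since A has no constant term, A^j begins in degree j. The cut at j ≤ n therefore gives the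
    -- exact coefficient of degree n, and it is the cut made by `expS`.
    exponential : Seq
    exponential n = partialExp (suc n) n

    partialExp-stable : ∀ N n → n ℕ.< N → partialExp N n ≈ exponential n
    partialExp-stable (suc N) n (ℕ.s≤s n≤N) with n ℕ.≟ N
    ... | yes ≡.refl = refl
    ... | no n≢N = begin
      partialExp (suc N) n                     ≈⟨ sum-last N _ ⟩
      partialExp N n + inv! N * power A N n    ≈⟨ +-congˡ (trans (*-congˡ (power-vanishes N n n<N)) (zeroʳ _)) ⟩
      partialExp N n + 0#                      ≈⟨ +-identityʳ _ ⟩
      partialExp N n                           ≈⟨ partialExp-stable N n n<N ⟩
      exponential n                            ∎
      where n<N = ℕP.≤∧≢⇒< n≤N n≢N

    -- In each summand the power rule produces j + 1, which lowers 1/(j+1)! to 1/j!. After the sums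
    -- are exchanged, the factor of degree k is truncated at a bound beyond k, and
    -- `partialExp-stable` identifies it with the exponential.
    θ-exponential : θ exponential ≗ θ A ⋆ exponential
    θ-exponential zero = trans (zeroˡ _) (sym (trans (*-congʳ (zeroˡ _)) (zeroˡ _)))
    θ-exponential (suc n) = begin
      num (suc n) * (inv! 0 * 0# + sum (suc n) (λ j → inv! (suc j) * power A (suc j) (suc n)))
        ≈⟨ solve 3 (λ m x y → m :* (x :* con (+ 0) :+ y) := m :* y) refl _ _ _ ⟩
      num (suc n) * sum (suc n) (λ j → inv! (suc j) * power A (suc j) (suc n))
        ≈⟨ sum-*ˡ (suc n) _ (λ j → inv! (suc j) * power A (suc j) (suc n)) ⟨
      sum (suc n) (λ j → num (suc n) * (inv! (suc j) * power A (suc j) (suc n)))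
        ≈⟨ sum-cong (suc n) (λ j _ → term j) ⟩
      sum (suc n) (λ j → antidiagonal n (λ i k → θ A (suc i) * (inv! j * power A j k)))
        ≈⟨ sum-antidiagonal (suc n) n (λ j i k → θ A (suc i) * (inv! j * power A j k)) ⟩
      antidiagonal n (λ i k → sum (suc n) (λ j → θ A (suc i) * (inv! j * power A j k)))
        ≈⟨ antidiagonal-cong n (λ i k e → trans (sum-*ˡ (suc n) _ (λ j → inv! j * power A j k))
             (*-congˡ (partialExp-stable (suc n) k (ℕ.s≤s (ℕP.m+n≤o⇒n≤o i (ℕP.≤-reflexive e)))))) ⟩
      antidiagonal n (λ i k → θ A (suc i) * exponential k)
        ≈⟨ +-identityˡ _ ⟨
      0# + antidiagonal n (λ i k → θ A (suc i) * exponential k)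
        ≈⟨ +-congʳ (trans (*-congʳ (zeroˡ _)) (zeroˡ _)) ⟨
      (θ A ⋆ exponential) (suc n) ∎
      where
      term : ∀ j → num (suc n) * (inv! (suc j) * power A (suc j) (suc n))
                     ≈ antidiagonal n (λ i k → θ A (suc i) * (inv! j * power A j k))
      term j = begin
        num (suc n) * (inv! (suc j) * power A (suc j) (suc n))
          ≈⟨ solve 3 (λ x y z → x :* (y :* z) := y :* (x :* z)) refl _ _ _ ⟩
        inv! (suc j) * θ (power A (suc j)) (suc n)
          ≈⟨ *-congˡ (θ-power A j (suc n)) ⟩
        inv! (suc j) * (num (suc j) * (θ A ⋆ power A j) (suc n))
          ≈⟨ solve 3 (λ x y z → x :* (y :* z) := y :* x :* z) refl _ _ _ ⟩
        num (suc j) * inv! (suc j) * (θ A ⋆ power A j) (suc n)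
          ≈⟨ *-cong (inv!-suc j) (+-congʳ (trans (*-congʳ (zeroˡ _)) (zeroˡ _))) ⟩
        inv! j * (0# + antidiagonal n (λ i k → θ A (suc i) * power A j k))
          ≈⟨ *-congˡ (+-identityˡ _) ⟩
        inv! j * antidiagonal n (λ i k → θ A (suc i) * power A j k)
          ≈⟨ antidiagonal-*ˡ n _ _ ⟨
        antidiagonal n (λ i k → inv! j * (θ A (suc i) * power A j k))
          ≈⟨ antidiagonal-cong n (λ i k _ → solve 3 (λ x y z → x :* (y :* z) := y :* (x :* z)) refl _ _ _) ⟩
        antidiagonal n (λ i k → θ A (suc i) * (inv! j * power A j k)) ∎

-- Partial fractions and the logarithmic derivative of the rational function.

-- The coefficients r of (1 - w)(1 - xyw) / ((1 - xw)(1 - yw)) and the recursion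
-- given by the logarithmic derivative of this function.
module RationalSeries (R : CommutativeRing 0ℓ 0ℓ) where
  open CommutativeRing R
  open IntegerCoefficients R
  open Sums R
  open SetoidReasoning setoid

  geometric : Carrier → Seq
  geometric s i = s ^^ suc i

  -- `geometric s` is s/(1-sw), so its product G with r is determined by (1-sw) G = s r; the last
  -- hypothesis is this equation in degree m + 1.
  geometric-⋆ : ∀ s r G → r 0 ≈ 1# → G 0 ≈ s → (∀ m → G (suc m) ≈ s * (r (suc m) + G m)) → geometric s ⋆ r ≗ G
  geometric-⋆ s r G r0 G0 step zero = begin
    s * 1# * r 0   ≈⟨ *-cong (*-identityʳ s) r0 ⟩
    s * 1#         ≈⟨ *-identityʳ s ⟩
    s              ≈⟨ G0 ⟨
    G 0            ∎
  geometric-⋆ s r G r0 G0 step (suc m) = begin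
    s * 1# * r (suc m) + antidiagonal m (λ i j → s * s ^^ suc i * r j)
      ≈⟨ +-cong (*-congʳ (*-identityʳ s)) (⋆-*ˡ s (geometric s) r m) ⟩
    s * r (suc m) + s * (geometric s ⋆ r) m   ≈⟨ distribˡ _ _ _ ⟨
    s * (r (suc m) + (geometric s ⋆ r) m)     ≈⟨ *-congˡ (+-congˡ (geometric-⋆ s r G r0 G0 step m)) ⟩
    s * (r (suc m) + G m)                     ≈⟨ step m ⟨
    G (suc m)                                 ∎

  -- The ring solver knows no inverses. An identity that depends on δΔ = 1 is proved as a polynomial
  -- identity with an explicit multiple c of δΔ - 1, which is then dropped.
  modulo : ∀ {δ Δ} → δ * Δ ≈ 1# → ∀ P Q c → P ≈ Q + c * (δ * Δ - 1#) → P ≈ Q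
  modulo {δ} {Δ} δΔ P Q c P≈ = begin
    P                       ≈⟨ P≈ ⟩
    Q + c * (δ * Δ - 1#)    ≈⟨ +-congˡ (*-congˡ (trans (+-congʳ δΔ) (-‿inverseʳ 1#))) ⟩
    Q + c * 0#              ≈⟨ +-congˡ (zeroʳ c) ⟩
    Q + 0#                  ≈⟨ +-identityʳ Q ⟩
    Q                       ∎

  module _ (x y δ A : Carrier) (δΔ : δ * (x - y) ≈ 1#) (A≈ : A ≈ (x - 1#) * (1# - y) * δ)
           (r : Seq) (r0 : r 0 ≈ 1#) (r-suc : ∀ m → r (suc m) ≈ A * (x ^^ suc m - y ^^ suc m)) where

    private
      -- Partial fractions of x/(1-xw) times the rational function; the double pole at w = 1/x
      -- accounts for the term with the factor m + 1.
      G-x : Seq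
      G-x m = A * (num (suc m) * x ^^ suc m) + (1# - x * A * δ) * x ^^ suc m + x * A * δ * y ^^ suc m

    geometric-x : geometric x ⋆ r ≗ G-x
    geometric-x = geometric-⋆ x r G-x r0
      (modulo δΔ _ _ (- x * A) (solve 4 (λ x y δ A →
        A :* ((con (+ 1) :+ con (+ 0)) :* (x :* con (+ 1))) :+ (con (+ 1) :- x :* A :* δ) :* (x :* con (+ 1)) :+ x :* A :* δ :* (y :* con (+ 1))
          := x :+ :- x :* A :* (δ :* (x :- y) :- con (+ 1))) refl x y δ A))
      (λ m → trans
        (modulo δΔ _ (x * (A * (x ^^ suc m - y ^^ suc m) + G-x m)) (- x * A * y ^^ suc m) (solve 7 (λ x y δ A X Y n →
          A :* ((con (+ 1) :+ n) :* (x :* X)) :+ (con (+ 1) :- x :* A :* δ) :* (x :* X) :+ x :* A :* δ :* (y :* Y)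
            := x :* (A :* (X :- Y) :+ (A :* (n :* X) :+ (con (+ 1) :- x :* A :* δ) :* X :+ x :* A :* δ :* Y))
               :+ :- x :* A :* Y :* (δ :* (x :- y) :- con (+ 1))) refl x y δ A _ _ _))
        (*-congˡ (+-congʳ (sym (r-suc m)))))

    private
      -- The generating functions are (1-xyw)/((1-xw)(1-yw)) and xy(1-w)/((1-xw)(1-yw)): the
      -- geometric factor cancels a factor of the numerator, so only simple poles remain.
      G-1 G-xy : Seq
      G-1 m = δ * ((1# - y) * x ^^ suc m - (1# - x) * y ^^ suc m)
      G-xy m = δ * (y * (x - 1#) * x ^^ suc m - x * (y - 1#) * y ^^ suc m)

      r-suc′ : ∀ m → r (suc m) ≈ (x - 1#) * (1# - y) * δ * (x ^^ suc m - y ^^ suc m)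
      r-suc′ m = trans (r-suc m) (*-congʳ A≈)

    geometric-1 : geometric 1# ⋆ r ≗ G-1
    geometric-1 = geometric-⋆ 1# r G-1 r0
      (trans (solve 3 (λ x y δ → δ :* ((con (+ 1) :- y) :* (x :* con (+ 1)) :- (con (+ 1) :- x) :* (y :* con (+ 1)))
          := δ :* (x :- y)) refl x y δ) δΔ)
      (λ m → trans
        (solve 5 (λ x y δ X Y → δ :* ((con (+ 1) :- y) :* (x :* X) :- (con (+ 1) :- x) :* (y :* Y))
          := con (+ 1) :* ((x :- con (+ 1)) :* (con (+ 1) :- y) :* δ :* (X :- Y)
               :+ δ :* ((con (+ 1) :- y) :* X :- (con (+ 1) :- x) :* Y))) refl x y δ _ _)
        (*-congˡ (+-congʳ (sym (r-suc′ m)))))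

    geometric-xy : geometric (x * y) ⋆ r ≗ G-xy
    geometric-xy = geometric-⋆ (x * y) r G-xy r0
      (modulo δΔ _ _ (x * y) (solve 3 (λ x y δ →
        δ :* (y :* (x :- con (+ 1)) :* (x :* con (+ 1)) :- x :* (y :- con (+ 1)) :* (y :* con (+ 1)))
          := x :* y :+ x :* y :* (δ :* (x :- y) :- con (+ 1))) refl x y δ))
      (λ m → trans
        (solve 5 (λ x y δ X Y → δ :* (y :* (x :- con (+ 1)) :* (x :* X) :- x :* (y :- con (+ 1)) :* (y :* Y))
          := x :* y :* ((x :- con (+ 1)) :* (con (+ 1) :- y) :* δ :* (X :- Y)
               :+ δ :* (y :* (x :- con (+ 1)) :* X :- x :* (y :- con (+ 1)) :* Y))) refl x y δ _ _)
        (*-congˡ (+-congʳ (sym (r-suc′ m)))))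

  ^^-1 : ∀ n → 1# ^^ n ≈ 1#
  ^^-1 zero = refl
  ^^-1 (suc n) = trans (*-identityˡ _) (^^-1 n)

  ^^-* : ∀ x y n → (x * y) ^^ n ≈ x ^^ n * y ^^ n
  ^^-* x y zero = sym (*-identityˡ _)
  ^^-* x y (suc n) = trans (*-congˡ (^^-* x y n)) (solve 4 (λ x y X Y → x :* y :* (X :* Y)
      := x :* X :* (y :* Y)) refl _ _ _ _)

  κ : Carrier → Carrier → Seq
  κ x y i = (1# - x ^^ suc i) * (1# - y ^^ suc i)

  module _ (x y δ A : Carrier) (δΔ : δ * (x - y) ≈ 1#) (A≈ : A ≈ (x - 1#) * (1# - y) * δ)
           (r : Seq) (r0 : r 0 ≈ 1#) (r-suc : ∀ m → r (suc m) ≈ A * (x ^^ suc m - y ^^ suc m)) where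

    κ-⋆ : κ x y ⋆ r ≗ (λ m → (geometric 1# ⋆ r) m + (geometric (x * y) ⋆ r) m
                              + (- 1# * (geometric x ⋆ r) m + - 1# * (geometric y ⋆ r) m))
    κ-⋆ m = begin
      (κ x y ⋆ r) m
        ≈⟨ ⋆-cong {g = r} expand (λ _ → refl) m ⟩
      ((λ i → geometric 1# i + geometric (x * y) i + (- 1# * geometric x i + - 1# * geometric y i)) ⋆ r) m
        ≈⟨ ⋆-distribʳ r (λ i → geometric 1# i + geometric (x * y) i) (λ i → - 1# * geometric x i + - 1# * geometric y i) m ⟩
      ((λ i → geometric 1# i + geometric (x * y) i) ⋆ r) m + ((λ i → - 1# * geometric x i + - 1# * geometric y i) ⋆ r) m
        ≈⟨ +-cong (⋆-distribʳ r (geometric 1#) (geometric (x * y)) m)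
             (trans (⋆-distribʳ r (λ i → - 1# * geometric x i) (λ i → - 1# * geometric y i) m)
               (+-cong (⋆-*ˡ (- 1#) (geometric x) r m) (⋆-*ˡ (- 1#) (geometric y) r m))) ⟩
      (geometric 1# ⋆ r) m + (geometric (x * y) ⋆ r) m + (- 1# * (geometric x ⋆ r) m + - 1# * (geometric y ⋆ r) m) ∎
      where
      expand : κ x y ≗ (λ i → geometric 1# i + geometric (x * y) i + (- 1# * geometric x i + - 1# * geometric y i))
      expand i = begin
        (1# - x ^^ suc i) * (1# - y ^^ suc i)
          ≈⟨ solve 2 (λ X Y → (con (+ 1) :- X) :* (con (+ 1) :- Y)
              := con (+ 1) :+ X :* Y :+ (:- con (+ 1) :* X :+ :- con (+ 1) :* Y)) refl _ _ ⟩
        1# + x ^^ suc i * y ^^ suc i + (- 1# * x ^^ suc i + - 1# * y ^^ suc i)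
          ≈⟨ +-congʳ (+-cong (^^-1 (suc i)) (^^-* x y (suc i))) ⟨
        1# ^^ suc i + (x * y) ^^ suc i + (- 1# * x ^^ suc i + - 1# * y ^^ suc i) ∎

    -- Each factor 1 - sw of the rational function contributes, up to sign, the series sw/(1-sw) to
    -- its logarithmic derivative, and the four contributions add up to -w Σ κ_i w^i. The closed
    -- forms of the four convolutions verify this in each degree.
    r-recursion : ∀ m → num (suc m) * r (suc m) ≈ - (κ x y ⋆ r) m
    r-recursion m = begin
      num (suc m) * r (suc m)
        ≈⟨ *-congˡ (r-suc m) ⟩
      num (suc m) * (A * (x ^^ suc m - y ^^ suc m))
        -- The relations δ(x-y) = 1 and A = (x-1)(1-y)δ both enter as explicit multiples in one
        -- polynomial identity; `modulo` removes the first, the next step the second.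
        ≈⟨ modulo δΔ _ _ ((A + 1#) * x ^^ suc m - (A - 1#) * y ^^ suc m) (solve 7 (λ x y δ A X Y n →
             n :* (A :* (X :- Y))
               := (:- (δ :* ((con (+ 1) :- y) :* X :- (con (+ 1) :- x) :* Y)
                       :+ δ :* (y :* (x :- con (+ 1)) :* X :- x :* (y :- con (+ 1)) :* Y)
                       :+ (:- con (+ 1) :* (A :* (n :* X) :+ (con (+ 1) :- x :* A :* δ) :* X :+ x :* A :* δ :* Y)
                           :+ :- con (+ 1) :* (:- A :* (n :* Y) :+ (con (+ 1) :- y :* :- A :* :- δ) :* Y :+ y :* :- A :* :- δ :* X)))
                   :+ (X :- Y) :* (A :- (x :- con (+ 1)) :* (con (+ 1) :- y) :* δ))
                  :+ ((A :+ con (+ 1)) :* X :- (A :- con (+ 1)) :* Y) :* (δ :* (x :- y) :- con (+ 1)))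
             refl x y δ A _ _ _) ⟩
      _ + (x ^^ suc m - y ^^ suc m) * (A - (x - 1#) * (1# - y) * δ)
        ≈⟨ trans (+-congˡ (trans (*-congˡ (trans (+-congʳ A≈) (-‿inverseʳ _))) (zeroʳ _))) (+-identityʳ _) ⟩
      - (_ + _ + (- 1# * _ + - 1# * _))
        ≈⟨ -‿cong (+-cong (+-cong (geometric-1 x y δ A δΔ A≈ r r0 r-suc m) (geometric-xy x y δ A δΔ A≈ r r0 r-suc m))
             (+-cong (*-congˡ (geometric-x x y δ A δΔ A≈ r r0 r-suc m))
                     -- The factor for y is the one for x with x and y exchanged; δ and A then
                     -- change sign, and r stays the same.
                     (*-congˡ (geometric-x y x (- δ) (- A) δΔ′ A≈′ r r0 r-suc′ m)))) ⟨
      - ((geometric 1# ⋆ r) m + (geometric (x * y) ⋆ r) m + (- 1# * (geometric x ⋆ r) m + - 1# * (geometric y ⋆ r) m))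
        ≈⟨ -‿cong (κ-⋆ m) ⟨
      - (κ x y ⋆ r) m ∎
      where
      δΔ′ : - δ * (y - x) ≈ 1#
      δΔ′ = trans (solve 3 (λ x y δ → :- δ :* (y :- x) := δ :* (x :- y)) refl x y δ) δΔ

      A≈′ : - A ≈ (y - 1#) * (1# - x) * - δ
      A≈′ = trans (-‿cong A≈)
        (solve 3 (λ x y δ → :- ((x :- con (+ 1)) :* (con (+ 1) :- y) :* δ)
            := (y :- con (+ 1)) :* (con (+ 1) :- x) :* :- δ) refl x y δ)

      r-suc′ : ∀ m → r (suc m) ≈ - A * (y ^^ suc m - x ^^ suc m)
      r-suc′ m = trans (r-suc m) (solve 3 (λ A X Y → A :* (X :- Y) := :- A :* (Y :- X)) refl _ _ _)

-- The abstract properties of the operators.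

-- Indices are shifted by one: p k is p_{k+1}.  Q e is q^e, m⁻¹ k is 1/(1 - q^{-(k+1)}),
-- τ u k is p_{k+1}[[u]_t], α u k is p_{k+1}[M[u]_q], and E u is Ω[-z[u]_t X].
record OperatorFamily (R : CommutativeRing 0ℓ 0ℓ) : Set where
  open CommutativeRing R
  open Sums R

  field
    num-cancel : NumCancel
    Q : ℤ → Carrier
    Q-0 : Q (+ 0) ≈ 1#
    Q-+ : ∀ i j → Q (i ℤ.+ j) ≈ Q i * Q j
    m⁻¹ : Seq
    m⁻¹-inverse : ∀ k → m⁻¹ k * (1# - Q (ℤ.- + 1) ^^ suc k) ≈ 1#
    p : Seq

  τ : ℤ → Seq
  τ u k = m⁻¹ k * (1# - Q (ℤ.- u) ^^ suc k)

  α : ℤ → Seq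
  α u k = (1# - Q (ℤ.- + 1) ^^ suc k) * (1# - Q u ^^ suc k)

  -- The logarithmic derivative of Ω[-z[u]_t X], namely -Σ p_k[[u]_t] p_k z^k over k ≥ 1; `delay`
  -- supplies the zero constant term.
  h : ℤ → Seq
  h u = delay (λ k → - (τ u k * p k))

  field
    E : ℤ → Seq
    E-0 : ∀ u → E u 0 ≈ 1#
    θ-E : ∀ u → θ (E u) ≗ h u ⋆ E u
    D : ℤ → ℤ → Carrier → Carrier
    D-cong : ∀ u v {x y} → x ≈ y → D u v x ≈ D u v y
    D-+ : ∀ u v x y → D u v (x + y) ≈ D u v x + D u v y
    -- R stands for Λ, over which `D` is not linear. Linearity is therefore required just for the
    -- scalars that occur in the computation.
    D-τ : ∀ u v w k x → D u v (τ w k * x) ≈ τ w k * D u v x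
    D-α : ∀ u v w k x → D u v (α w k * x) ≈ α w k * D u v x
    D-1 : ∀ u v → D u v 1# ≈ coeff (E u) v
    D-p : ∀ u v k x → D u v (p k * x) ≈ p k * D u v x + α u k * D u (v ℤ.+ + suc k) x

-- The commutator formula for an abstract operator family.

module Commutators {R : CommutativeRing 0ℓ 0ℓ} (V : OperatorFamily R) where
  open CommutativeRing R
  open IntegerCoefficients R
  open Sums R
  open RationalSeries R using (κ; r-recursion; modulo)
  open Exponential R using (⋆-leftComm)
  open SetoidReasoning setoid
  open OperatorFamily V

  Q-^^ : ∀ u n → Q u ^^ n ≈ Q (u ℤ.* + n)
  Q-^^ u zero = trans (sym Q-0) (reflexive (≡.cong Q (≡.sym (ℤP.*-zeroʳ u))))
  Q-^^ u (suc n) = begin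
    Q u * Q u ^^ n          ≈⟨ *-congˡ (Q-^^ u n) ⟩
    Q u * Q (u ℤ.* + n)     ≈⟨ Q-+ u _ ⟨
    Q (u ℤ.+ u ℤ.* + n)     ≡⟨ ≡.cong Q (≡.sym (ℤP.*-suc u (+ n))) ⟩
    Q (u ℤ.* + suc n)       ∎

  Q-inverse : ∀ u → Q (ℤ.- u) * Q u ≈ 1#
  Q-inverse u = trans (sym (Q-+ (ℤ.- u) u)) (trans (reflexive (≡.cong Q (ℤP.+-inverseˡ u))) Q-0)

  private
    Q≡ : ∀ {i j} → i ≡ j → Q i ≈ Q j
    Q≡ e = reflexive (≡.cong Q e)

  D-0 : ∀ u v → D u v 0# ≈ 0#
  D-0 u v = RingProperties.x+x≈x⇒x≈0 ring _ (trans (sym (D-+ u v 0# 0#)) (D-cong u v (+-identityˡ 0#)))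

  D-neg : ∀ u v x → D u v (- x) ≈ - D u v x
  D-neg u v x = inverse-unique _ _ (trans (sym (D-+ u v (- x) x)) (trans (D-cong u v (-‿inverseˡ x)) (D-0 u v)))
    where open GroupProperties +-group renaming (inverseˡ-unique to inverse-unique)

  D-num : ∀ u v n x → D u v (num n * x) ≈ num n * D u v x
  D-num u v zero x = trans (D-cong u v (zeroˡ x)) (trans (D-0 u v) (sym (zeroˡ _)))
  D-num u v (suc n) x = begin
    D u v ((1# + num n) * x)          ≈⟨ D-cong u v (trans (distribʳ x 1# (num n)) (+-congʳ (*-identityˡ x))) ⟩
    D u v (x + num n * x)             ≈⟨ D-+ u v _ _ ⟩
    D u v x + D u v (num n * x)       ≈⟨ +-congˡ (D-num u v n x) ⟩
    D u v x + num n * D u v x         ≈⟨ solve 2 (λ m x → x :+ m :* x := (con (+ 1) :+ m) :* x) refl _ _ ⟩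
    (1# + num n) * D u v x            ∎

  D-antidiagonal : ∀ u v n F → D u v (antidiagonal n F) ≈ antidiagonal n (λ i j → D u v (F i j))
  D-antidiagonal u v zero F = refl
  D-antidiagonal u v (suc n) F = trans (D-+ u v _ _) (+-congˡ (D-antidiagonal u v n (λ i → F (suc i))))

  E-product : ∀ a c → scale (Q (ℤ.- a)) (E c) ⋆ E a ≗ E (a ℤ.+ c)
  E-product a c = log-derivative-unique num-cancel (h (a ℤ.+ c)) _ _ refl θ-product (θ-E (a ℤ.+ c)) constant
    where
    x = Q (ℤ.- a)
    Ec Ea : Seq
    Ec = scale x (E c)
    Ea = E a

    θ-scale : θ Ec ≗ scale x (h c) ⋆ Ec
    θ-scale n = begin
      num n * (x ^^ n * E c n)          ≈⟨ solve 3 (λ m x e → m :* (x :* e) := x :* (m :* e)) refl _ _ _ ⟩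
      x ^^ n * θ (E c) n                ≈⟨ *-congˡ (θ-E c n) ⟩
      x ^^ n * (h c ⋆ E c) n            ≈⟨ scale-⋆ x (h c) (E c) n ⟩
      (scale x (h c) ⋆ scale x (E c)) n ∎

    h-sum : (λ n → scale x (h c) n + h a n) ≗ h (a ℤ.+ c)
    h-sum zero = trans (+-identityʳ _) (zeroʳ _)
    h-sum (suc k) = begin
      X * - (m * (1# - Q (ℤ.- c) ^^ suc k) * p k) + - (m * (1# - X) * p k)
        ≈⟨ solve 4 (λ X m Y p → X :* :- (m :* (con (+ 1) :- Y) :* p) :+ :- (m :* (con (+ 1) :- X) :* p)
             := :- (m :* (con (+ 1) :- X :* Y) :* p)) refl X m _ (p k) ⟩
      - (m * (1# - X * Q (ℤ.- c) ^^ suc k) * p k)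
        ≈⟨ -‿cong (*-congʳ (*-congˡ (+-congˡ (-‿cong XY)))) ⟩
      h (a ℤ.+ c) (suc k) ∎
      where
      X = x ^^ suc k
      m = m⁻¹ k
      XY : X * Q (ℤ.- c) ^^ suc k ≈ Q (ℤ.- (a ℤ.+ c)) ^^ suc k
      XY = begin
        X * Q (ℤ.- c) ^^ suc k
          ≈⟨ *-cong (Q-^^ (ℤ.- a) (suc k)) (Q-^^ (ℤ.- c) (suc k)) ⟩
        Q (ℤ.- a ℤ.* + suc k) * Q (ℤ.- c ℤ.* + suc k)             ≈⟨ Q-+ _ _ ⟨
        Q (ℤ.- a ℤ.* + suc k ℤ.+ ℤ.- c ℤ.* + suc k)
          ≈⟨ Q≡ (ℤR.solve 3 (λ a c k → ℤR.:- a ℤR.:* k ℤR.:+ ℤR.:- c ℤR.:* k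
              ℤR.:= ℤR.:- (a ℤR.:+ c) ℤR.:* k) ≡.refl a c (+ suc k)) ⟩
        Q (ℤ.- (a ℤ.+ c) ℤ.* + suc k)                             ≈⟨ Q-^^ (ℤ.- (a ℤ.+ c)) (suc k) ⟨
        Q (ℤ.- (a ℤ.+ c)) ^^ suc k                                ∎
        where module ℤR = ℤS.+-*-Solver

    θ-product : θ (Ec ⋆ Ea) ≗ h (a ℤ.+ c) ⋆ (Ec ⋆ Ea)
    θ-product n = begin
      θ (Ec ⋆ Ea) n
        ≈⟨ θ-⋆ Ec Ea n ⟩
      (θ Ec ⋆ Ea) n + (Ec ⋆ θ Ea) n
        ≈⟨ +-cong (⋆-cong {g = Ea} θ-scale (λ _ → refl) n) (⋆-cong {f = Ec} (λ _ → refl) (θ-E a) n) ⟩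
      ((scale x (h c) ⋆ Ec) ⋆ Ea) n + (Ec ⋆ (h a ⋆ Ea)) n
        ≈⟨ +-cong (⋆-assoc (scale x (h c)) Ec Ea n) (⋆-leftComm Ec (h a) Ea n) ⟩
      (scale x (h c) ⋆ (Ec ⋆ Ea)) n + (h a ⋆ (Ec ⋆ Ea)) n
        ≈⟨ ⋆-distribʳ (Ec ⋆ Ea) (scale x (h c)) (h a) n ⟨
      ((λ n → scale x (h c) n + h a n) ⋆ (Ec ⋆ Ea)) n
        ≈⟨ ⋆-cong {g = Ec ⋆ Ea} h-sum (λ _ → refl) n ⟩
      (h (a ℤ.+ c) ⋆ (Ec ⋆ Ea)) n ∎

    constant : 1# * E c 0 * E a 0 ≈ E (a ℤ.+ c) 0
    constant = begin
      1# * E c 0 * E a 0   ≈⟨ *-cong (trans (*-identityˡ _) (E-0 c)) (E-0 a) ⟩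
      1# * 1#              ≈⟨ *-identityˡ 1# ⟩
      1#                   ≈⟨ E-0 (a ℤ.+ c) ⟨
      E (a ℤ.+ c) 0        ∎

  -- The action of one operator on the exponential of the other.

  -- ε = 1/(1 - q^{a+c}).  The exponentials of D c d and D a b interact through the rational
  -- function of the ratio of the two variables whose coefficients are r.
  module Interaction (a c : ℤ) (ε : Carrier) (ε-inverse : ε * (1# - Q (a ℤ.+ c)) ≈ 1#) where
    x = Q (ℤ.- a)
    y = Q c
    A = (1# - Q a) * (1# - Q c) * ε

    r : Seq
    r zero = 1#
    r (suc n) = A * (x ^^ suc n - y ^^ suc n)

    private
      Q-x : x * Q a ≈ 1#
      Q-x = Q-inverse a

      δΔ : Q a * ε * (x - y) ≈ 1#
      δΔ = begin
        Q a * ε * (x - y)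
          ≈⟨ solve 4 (λ q e x y → q :* e :* (x :- y) := e :* (x :* q :- q :* y)) refl _ _ _ _ ⟩
        ε * (x * Q a - Q a * y)                      ≈⟨ *-congˡ (+-cong Q-x (-‿cong (sym (Q-+ a c)))) ⟩
        ε * (1# - Q (a ℤ.+ c))                       ≈⟨ ε-inverse ⟩
        1#                                           ∎

      A≈ : A ≈ (x - 1#) * (1# - y) * (Q a * ε)
      A≈ = begin
        (1# - Q a) * (1# - y) * ε                    ≈⟨ *-congʳ (*-congʳ (+-congʳ Q-x)) ⟨
        (x * Q a - Q a) * (1# - y) * ε
          ≈⟨ solve 4 (λ q e x y → (x :* q :- q) :* (con (+ 1) :- y) :* e
              := (x :- con (+ 1)) :* (con (+ 1) :- y) :* (q :* e)) refl _ _ _ _ ⟩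
        (x - 1#) * (1# - y) * (Q a * ε)              ∎

      r-κ : ∀ m → num (suc m) * r (suc m) ≈ - (κ x y ⋆ r) m
      r-κ = r-recursion x y (Q a * ε) A δΔ A≈ r refl (λ _ → refl)

      τα : ∀ i → τ a i * α c i ≈ κ x y i
      τα i = modulo (m⁻¹-inverse i) _ _ (κ x y i) (solve 4 (λ m n X Y →
        m :* (con (+ 1) :- X) :* (n :* (con (+ 1) :- Y))
          := (con (+ 1) :- X) :* (con (+ 1) :- Y) :+ (con (+ 1) :- X) :* (con (+ 1) :- Y) :* (m :* n :- con (+ 1)))
        refl (m⁻¹ i) (1# - Q (ℤ.- + 1) ^^ suc i) _ _)

    shifted : ℤ → Seq
    shifted d i = r i * coeff (E c) (d ℤ.+ + i)

    -- The derivative equation expresses (b+1) times the coefficient of degree b + 1 of `E a`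
    -- through products of p_{i+1} with smaller coefficients, and `D-p` moves p_{i+1} out of `D c d`
    -- while raising d by i + 1. The induction on b therefore has to treat all d together.
    interaction : ∀ b d → D c d (E a b) ≈ (shifted d ⋆ E a) b
    interaction b = upTo b b ℕP.≤-refl
      where
      upTo : ∀ N b → b ℕ.≤ N → ∀ d → D c d (E a b) ≈ (shifted d ⋆ E a) b
      upTo N zero _ d = begin
        D c d (E a 0)                           ≈⟨ D-cong c d (E-0 a) ⟩
        D c d 1#                                ≈⟨ D-1 c d ⟩
        coeff (E c) d                           ≡⟨ ≡.cong (coeff (E c)) (≡.sym (ℤP.+-identityʳ d)) ⟩
        coeff (E c) (d ℤ.+ + 0)                 ≈⟨ solve 1 (λ x → x := con (+ 1) :* x :* con (+ 1)) refl _ ⟩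
        1# * coeff (E c) (d ℤ.+ + 0) * 1#       ≈⟨ *-congˡ (E-0 a) ⟨
        1# * coeff (E c) (d ℤ.+ + 0) * E a 0    ∎
      upTo (suc N) (suc b) (ℕ.s≤s b≤N) d = num-cancel b _ _ (begin
        num (suc b) * D c d (E a (suc b))
          ≈⟨ D-num c d (suc b) _ ⟨
        D c d (num (suc b) * E a (suc b))
          ≈⟨ D-cong c d (trans (θ-E a (suc b)) (trans (+-congʳ (zeroˡ _)) (+-identityˡ _))) ⟩
        D c d (antidiagonal b (λ i j → - (τ a i * p i) * E a j))
          ≈⟨ D-antidiagonal c d b _ ⟩
        antidiagonal b (λ i j → D c d (- (τ a i * p i) * E a j))
          ≈⟨ antidiagonal-cong b term ⟩
        antidiagonal b (λ i j → - (τ a i * p i) * (shifted d ⋆ E a) j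
                                + - 1# * (κ x y i * ((λ k → r k * H (i ℕ.+ k)) ⋆ E a) j))
          ≈⟨ antidiagonal-+ b _ _ ⟩
        antidiagonal b (λ i j → - (τ a i * p i) * (shifted d ⋆ E a) j)
          + antidiagonal b (λ i j → - 1# * (κ x y i * ((λ k → r k * H (i ℕ.+ k)) ⋆ E a) j))
          ≈⟨ +-cong (sym (trans (+-congʳ (zeroˡ _)) (+-identityˡ _))) (antidiagonal-*ˡ b (- 1#) _) ⟩
        (h a ⋆ (shifted d ⋆ E a)) (suc b)
          + - 1# * antidiagonal b (λ i j → κ x y i * ((λ k → r k * H (i ℕ.+ k)) ⋆ E a) j)
          -- The index d + (i + 1) + k depends on i and k only through i + k, so the sums over
          -- `κ x y` and `r` merge into one convolution.
          ≈⟨ +-congˡ (*-congˡ (⋆-assoc-weighted b (κ x y) r H (E a))) ⟩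
        (h a ⋆ (shifted d ⋆ E a)) (suc b) + - 1# * ((λ m → (κ x y ⋆ r) m * H m) ⋆ E a) b
          -- The recursion for r turns the second sum into θ acting on `shifted d`, while `h a` acts
          -- as θ on `E a`: the two terms of the Leibniz rule.
          ≈⟨ +-cong (sym (⋆-leftComm (shifted d) (h a) (E a) (suc b))) θ-shifted ⟩
        (shifted d ⋆ (h a ⋆ E a)) (suc b) + (θ (shifted d) ⋆ E a) (suc b)
          ≈⟨ +-comm _ _ ⟩
        (θ (shifted d) ⋆ E a) (suc b) + (shifted d ⋆ (h a ⋆ E a)) (suc b)
          ≈⟨ +-congˡ (⋆-cong {f = shifted d} (λ _ → refl) (θ-E a) (suc b)) ⟨
        (θ (shifted d) ⋆ E a) (suc b) + (shifted d ⋆ θ (E a)) (suc b)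
          ≈⟨ θ-⋆ (shifted d) (E a) (suc b) ⟨
        num (suc b) * (shifted d ⋆ E a) (suc b) ∎)
        where
        H : Seq
        H m = coeff (E c) (d ℤ.+ + suc m)

        term : ∀ i j → i ℕ.+ j ≡ b → D c d (- (τ a i * p i) * E a j) ≈
          - (τ a i * p i) * (shifted d ⋆ E a) j + - 1# * (κ x y i * ((λ k → r k * H (i ℕ.+ k)) ⋆ E a) j)
        term i j e = begin
          D c d (- (τ a i * p i) * E a j)
            ≈⟨ D-cong c d (solve 3 (λ t p e → :- (t :* p) :* e := :- (t :* (p :* e))) refl _ _ _) ⟩
          D c d (- (τ a i * (p i * E a j)))
            ≈⟨ trans (D-neg c d _) (-‿cong (D-τ c d a i _)) ⟩
          - (τ a i * D c d (p i * E a j))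
            ≈⟨ -‿cong (*-congˡ (D-p c d i _)) ⟩
          - (τ a i * (p i * D c d (E a j) + α c i * D c (d ℤ.+ + suc i) (E a j)))
            ≈⟨ -‿cong (*-congˡ (+-cong (*-congˡ (upTo N j j≤N d)) (*-congˡ (upTo N j j≤N (d ℤ.+ + suc i))))) ⟩
          - (τ a i * (p i * (shifted d ⋆ E a) j + α c i * (shifted (d ℤ.+ + suc i) ⋆ E a) j))
            ≈⟨ solve 5 (λ t p u s w → :- (t :* (p :* u :+ s :* w))
                := :- (t :* p) :* u :+ :- con (+ 1) :* (t :* s :* w)) refl _ _ _ _ _ ⟩
          - (τ a i * p i) * (shifted d ⋆ E a) j + - 1# * (τ a i * α c i * (shifted (d ℤ.+ + suc i) ⋆ E a) j)
            ≈⟨ +-congˡ (*-congˡ (*-cong (τα i) (⋆-cong {g = E a}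
                 (λ k → *-congˡ (reflexive (≡.cong (coeff (E c)) (ℤP.+-assoc d (+ suc i) (+ k)))))
                 (λ _ → refl) j))) ⟩
          - (τ a i * p i) * (shifted d ⋆ E a) j + - 1# * (κ x y i * ((λ k → r k * H (i ℕ.+ k)) ⋆ E a) j) ∎
          where j≤N = ℕP.≤-trans (ℕP.m+n≤o⇒n≤o i (ℕP.≤-reflexive e)) b≤N

        θ-shifted : - 1# * ((λ m → (κ x y ⋆ r) m * H m) ⋆ E a) b ≈ (θ (shifted d) ⋆ E a) (suc b)
        θ-shifted = begin
          - 1# * ((λ m → (κ x y ⋆ r) m * H m) ⋆ E a) b
            ≈⟨ ⋆-*ˡ (- 1#) (λ m → (κ x y ⋆ r) m * H m) (E a) b ⟨
          ((λ m → - 1# * ((κ x y ⋆ r) m * H m)) ⋆ E a) b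
            ≈⟨ ⋆-cong {g = E a} (λ m → begin
                 - 1# * ((κ x y ⋆ r) m * H m)
                   ≈⟨ solve 2 (λ k h → :- con (+ 1) :* (k :* h) := :- k :* h) refl _ _ ⟩
                 - (κ x y ⋆ r) m * H m            ≈⟨ *-congʳ (r-κ m) ⟨
                 num (suc m) * r (suc m) * H m    ≈⟨ *-assoc _ _ _ ⟩
                 θ (shifted d) (suc m)            ∎) (λ _ → refl) b ⟩
          ((λ m → θ (shifted d) (suc m)) ⋆ E a) b
            ≈⟨ +-identityˡ _ ⟨
          0# + ((λ m → θ (shifted d) (suc m)) ⋆ E a) b
            ≈⟨ +-congʳ (trans (*-congʳ (zeroˡ _)) (zeroˡ _)) ⟨
          (θ (shifted d) ⋆ E a) (suc b) ∎

    -- At i = 0 the difference of powers vanishes and `one` supplies r_0 = 1, so one expression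
    -- covers all i.
    r-Q : ∀ i → r i ≈ one i + A * (Q (ℤ.- a ℤ.* + i) - Q (c ℤ.* + i))
    r-Q i = trans (r-^^ i) (+-congˡ (*-congˡ (+-cong (Q-^^ (ℤ.- a) i) (-‿cong (Q-^^ c i)))))
      where
      r-^^ : ∀ i → r i ≈ one i + A * (x ^^ i - y ^^ i)
      r-^^ zero = solve 1 (λ A → con (+ 1) := con (+ 1) :+ A :* (con (+ 1) :- con (+ 1))) refl A
      r-^^ (suc i) = sym (+-identityˡ _)

    -- The terms are indexed by the degree k of `E c` instead of i = k - d, a coordinate that both
    -- orders of the operators share. The exponent e is -a for the powers of x and c for those of y.
    weighted : ℤ → ℤ → ℤ → ℕ → Carrier
    weighted e d k l = Q (e ℤ.* (k ℤ.- d)) * (coeff (E c) k * E a l)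

    weightedSum : ℤ → ℤ → Seq
    weightedSum e d n = antidiagonal n (λ k l → weighted e d (+ k) l)

    tail : ℤ → ℤ → ℕ → Carrier
    tail e d b = antidiagonal b (λ i j → weighted e d (d ℤ.+ + i) j)

    interaction-tail : ∀ b d → D c d (E a b) ≈ coeff (E c) d * E a b + A * (tail (ℤ.- a) d b - tail c d b)
    interaction-tail b d = begin
      D c d (E a b)
        ≈⟨ interaction b d ⟩
      antidiagonal b (λ i j → shifted d i * E a j)
        ≈⟨ antidiagonal-cong b (λ i j _ → term i j) ⟩
      antidiagonal b (λ i j → one i * (coeff (E c) (d ℤ.+ + i) * E a j)
                              + (A * weighted (ℤ.- a) d (d ℤ.+ + i) j + - A * weighted c d (d ℤ.+ + i) j))
        ≈⟨ trans (antidiagonal-+ b _ _) (+-cong (antidiagonal-one b _)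
             (trans (antidiagonal-+ b _ _) (+-cong (antidiagonal-*ˡ b A _) (antidiagonal-*ˡ b (- A) _)))) ⟩
      coeff (E c) (d ℤ.+ + 0) * E a b + (A * tail (ℤ.- a) d b + - A * tail c d b)
        ≈⟨ +-cong (*-congʳ (reflexive (≡.cong (coeff (E c)) (ℤP.+-identityʳ d))))
             (solve 3 (λ A s t → A :* s :+ :- A :* t := A :* (s :- t)) refl _ _ _) ⟩
      coeff (E c) d * E a b + A * (tail (ℤ.- a) d b - tail c d b) ∎
      where
      cancel : ∀ i → d ℤ.+ + i ℤ.- d ≡ + i
      cancel i = ℤR.solve 2 (λ d i → d ℤR.:+ i ℤR.:- d ℤR.:= i) ≡.refl d (+ i)
        where module ℤR = ℤS.+-*-Solver

      term : ∀ i j → shifted d i * E a j ≈ one i * (coeff (E c) (d ℤ.+ + i) * E a j)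
        + (A * weighted (ℤ.- a) d (d ℤ.+ + i) j + - A * weighted c d (d ℤ.+ + i) j)
      term i j = begin
        r i * C * E a j
          ≈⟨ *-congʳ (*-congʳ (r-Q i)) ⟩
        (one i + A * (Q (ℤ.- a ℤ.* + i) - Q (c ℤ.* + i))) * C * E a j
          ≈⟨ solve 6 (λ o A X Y C e → (o :+ A :* (X :- Y)) :* C :* e
              := o :* (C :* e) :+ (A :* (X :* (C :* e)) :+ :- A :* (Y :* (C :* e)))) refl _ _ _ _ _ _ ⟩
        one i * (C * E a j) + (A * (Q (ℤ.- a ℤ.* + i) * (C * E a j)) + - A * (Q (c ℤ.* + i) * (C * E a j)))
          ≡⟨ ≡.cong (λ k → one i * (C * E a j) + (A * (Q (ℤ.- a ℤ.* k) * (C * E a j)) + - A * (Q (c ℤ.* k) * (C * E a j))))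
               (≡.sym (cancel i)) ⟩
        one i * (C * E a j) + (A * weighted (ℤ.- a) d (d ℤ.+ + i) j + - A * weighted c d (d ℤ.+ + i) j) ∎
        where C = coeff (E c) (d ℤ.+ + i)

    weightedSum-a : ∀ d v → coeff (weightedSum (ℤ.- a) d) v ≈ Q (a ℤ.* d) * coeff (E (a ℤ.+ c)) v
    weightedSum-a d -[1+ n ] = sym (zeroʳ _)
    weightedSum-a d (+ n) = begin
      antidiagonal n (λ k l → weighted (ℤ.- a) d (+ k) l)
        ≈⟨ antidiagonal-cong n (λ k l _ → begin
             Q (ℤ.- a ℤ.* (+ k ℤ.- d)) * (E c k * E a l)
               ≈⟨ *-congʳ (trans (Q≡ (ℤR.solve 3 (λ a k d → ℤR.:- a ℤR.:* (k ℤR.:- d)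
                   ℤR.:= a ℤR.:* d ℤR.:+ ℤR.:- a ℤR.:* k) ≡.refl a (+ k) d)) (Q-+ _ _)) ⟩
             Q (a ℤ.* d) * Q (ℤ.- a ℤ.* + k) * (E c k * E a l)
               ≈⟨ *-congʳ (*-congˡ (Q-^^ (ℤ.- a) k)) ⟨
             Q (a ℤ.* d) * x ^^ k * (E c k * E a l)
               ≈⟨ solve 4 (λ q x e f → q :* x :* (e :* f) := q :* (x :* e :* f)) refl _ _ _ _ ⟩
             Q (a ℤ.* d) * (scale x (E c) k * E a l) ∎) ⟩
      antidiagonal n (λ k l → Q (a ℤ.* d) * (scale x (E c) k * E a l))
        ≈⟨ antidiagonal-*ˡ n _ _ ⟩
      Q (a ℤ.* d) * (scale x (E c) ⋆ E a) n
        ≈⟨ *-congˡ (E-product a c n) ⟩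
      Q (a ℤ.* d) * E (a ℤ.+ c) n ∎
      where module ℤR = ℤS.+-*-Solver

    weightedSum-c : ∀ b d v → b ℤ.+ d ≡ v → coeff (weightedSum c d) v ≈ Q (c ℤ.* b) * coeff (E (a ℤ.+ c)) v
    weightedSum-c b d -[1+ n ] _ = sym (zeroʳ _)
    weightedSum-c b d (+ n) b+d≡n = begin
      antidiagonal n (λ k l → weighted c d (+ k) l)
        ≈⟨ antidiagonal-cong n (λ k l k+l≡n → begin
             Q (c ℤ.* (+ k ℤ.- d)) * (E c k * E a l)
               ≈⟨ *-congʳ (trans (Q≡ (exponent k l k+l≡n)) (Q-+ _ _)) ⟩
             Q (c ℤ.* b) * Q (ℤ.- c ℤ.* + l) * (E c k * E a l)
               ≈⟨ *-congʳ (*-congˡ (Q-^^ (ℤ.- c) l)) ⟨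
             Q (c ℤ.* b) * Q (ℤ.- c) ^^ l * (E c k * E a l)
               ≈⟨ solve 4 (λ q x e f → q :* x :* (e :* f) := q :* (e :* (x :* f))) refl _ _ _ _ ⟩
             Q (c ℤ.* b) * (E c k * scale (Q (ℤ.- c)) (E a) l) ∎) ⟩
      antidiagonal n (λ k l → Q (c ℤ.* b) * (E c k * scale (Q (ℤ.- c)) (E a) l))
        ≈⟨ antidiagonal-*ˡ n _ _ ⟩
      Q (c ℤ.* b) * (E c ⋆ scale (Q (ℤ.- c)) (E a)) n
        ≈⟨ *-congˡ (trans (⋆-comm (E c) _ n) (E-product c a n)) ⟩
      Q (c ℤ.* b) * E (c ℤ.+ a) n
        ≡⟨ ≡.cong (λ u → Q (c ℤ.* b) * E u n) (ℤP.+-comm c a) ⟩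
      Q (c ℤ.* b) * E (a ℤ.+ c) n ∎
      where
      module ℤR = ℤS.+-*-Solver
      exponent : ∀ k l → k ℕ.+ l ≡ n → c ℤ.* (+ k ℤ.- d) ≡ c ℤ.* b ℤ.+ ℤ.- c ℤ.* + l
      exponent k l k+l≡n = ≡.trans
        (ℤR.solve 4 (λ c k d l → c ℤR.:* (k ℤR.:- d)
            ℤR.:= c ℤR.:* ((k ℤR.:+ l) ℤR.:- l ℤR.:- d)) ≡.refl c (+ k) d (+ l))
        (≡.trans (≡.cong (λ s → c ℤ.* (s ℤ.- + l ℤ.- d)) (≡.trans (≡.cong +_ k+l≡n) (≡.sym b+d≡n)))
          (ℤR.solve 4 (λ c b d l → c ℤR.:* (b ℤR.:+ d ℤR.:- l ℤR.:- d)
              ℤR.:= c ℤR.:* b ℤR.:+ ℤR.:- c ℤR.:* l) ≡.refl c b d (+ l)))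

  -- The commutator on 1, on monomials and on linear combinations.

  ε-swap : ∀ a c {ε} → ε * (1# - Q (a ℤ.+ c)) ≈ 1# → ε * (1# - Q (c ℤ.+ a)) ≈ 1#
  ε-swap a c ε-inverse = trans (*-congˡ (+-congˡ (-‿cong (Q≡ (ℤP.+-comm c a))))) ε-inverse

  -- For ε = 1/(1 - q^{a+c}) this is M times the constant of the theorem: M = -(1-q)^2/q absorbs the
  -- factor q and the powers of 1 - q, and -q^{bc}(1 - q^{da-bc}) is the difference of powers.
  structure : ℤ → ℤ → Carrier → ℤ → ℤ → Carrier
  structure a c ε b d = (1# - Q a) * (1# - Q c) * ε * (Q (a ℤ.* d) - Q (c ℤ.* b))

  commutator : ℤ → ℤ → ℤ → ℤ → Carrier → Carrier
  commutator a c b d x = D c d (D a b x) - D a b (D c d x)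

  -- For d ≥ 0 the two products cover the degrees k ≥ d and k ≤ d of `E c`, and `antidiagonal-split`
  -- joins them to full convolutions; the contributions of r_0 = 1 cancel. For d < 0 the second
  -- product is 0 because `D c d 1#` vanishes.
  commutator-1⁺ : ∀ a c ε → ε * (1# - Q (a ℤ.+ c)) ≈ 1# → ∀ m d →
    commutator a c (+ m) d 1# ≈ structure a c ε (+ m) d * coeff (E (a ℤ.+ c)) (+ m ℤ.+ d)
  commutator-1⁺ a c ε ε-inverse m (+ n) = begin
    D c (+ n) (D a (+ m) 1#) - D a (+ m) (D c (+ n) 1#)
      ≈⟨ +-cong (trans (D-cong c (+ n) (D-1 a (+ m))) (I.interaction-tail m (+ n)))
           (-‿cong (trans (D-cong a (+ m) (D-1 c (+ n))) (J.interaction-tail n (+ m)))) ⟩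
    E c n * E a m + A * (I.tail (ℤ.- a) (+ n) m - I.tail c (+ n) m)
      - (E a m * E c n + J.A * (J.tail (ℤ.- c) (+ m) n - J.tail a (+ m) n))
      -- Exchanging the operators replaces (x, y) by (1/y, 1/x), so the i-th weights become those of
      -- index -i. The difference of the two sums changes sign, which offsets the minus sign of the
      -- commutator.
      ≈⟨ +-congˡ (-‿cong (+-congˡ (*-congˡ (+-cong 
           (swap-tail (ℤ.- c) c (ℤP.neg-distribˡ-* c))
           (-‿cong (swap-tail a (ℤ.- a) (λ i →
             ≡.trans (≡.cong ℤ.-_ (≡.sym (ℤP.neg-distribˡ-* a i))) (ℤP.neg-involutive (a ℤ.* i))))))))) ⟩
    E c n * E a m + A * (I.tail (ℤ.- a) (+ n) m - I.tail c (+ n) m)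
      - (E a m * E c n + J.A * (head c - head (ℤ.- a)))
      ≈⟨ solve 9 (λ ec ea qa qc e ta tc hc ha →
           ec :* ea :+ (con (+ 1) :- qa) :* (con (+ 1) :- qc) :* e :* (ta :- tc)
             :- (ea :* ec :+ (con (+ 1) :- qc) :* (con (+ 1) :- qa) :* e :* (hc :- ha))
             := (con (+ 1) :- qa) :* (con (+ 1) :- qc) :* e :* ((ta :+ ha) :- (tc :+ hc))) refl _ _ _ _ _ _ _ _ _ ⟩
    A * ((I.tail (ℤ.- a) (+ n) m + head (ℤ.- a)) - (I.tail c (+ n) m + head c))
      ≈⟨ *-congˡ (+-cong (antidiagonal-split n m _) (-‿cong (antidiagonal-split n m _))) ⟩
    A * ((I.weightedSum (ℤ.- a) (+ n) (m ℕ.+ n) + I.weighted (ℤ.- a) (+ n) (+ n) m)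
         - (I.weightedSum c (+ n) (m ℕ.+ n) + I.weighted c (+ n) (+ n) m))
      -- At k = d both weights are 1, so the point counted twice contributes equally to the two sums
      -- and drops out of their difference.
      ≈⟨ *-congˡ (+-cong (+-cong (I.weightedSum-a (+ n) (+ (m ℕ.+ n))) (corner (ℤ.- a)))
           (-‿cong (+-cong (I.weightedSum-c (+ m) (+ n) (+ (m ℕ.+ n)) ≡.refl) (corner c)))) ⟩
    A * ((Q (a ℤ.* + n) * E (a ℤ.+ c) (m ℕ.+ n) + E c n * E a m) - (Q (c ℤ.* + m) * E (a ℤ.+ c) (m ℕ.+ n) + E c n * E a m))
      ≈⟨ solve 5 (λ A q s e x → A :* ((q :* e :+ x) :- (s :* e :+ x)) := A :* (q :- s) :* e) refl _ _ _ _ _ ⟩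
    structure a c ε (+ m) (+ n) * E (a ℤ.+ c) (m ℕ.+ n) ∎
    where
    module I = Interaction a c ε ε-inverse
    module J = Interaction c a ε (ε-swap a c ε-inverse)
    A = I.A

    head : ℤ → Carrier
    head e = antidiagonal n (λ i j → I.weighted e (+ n) (+ j) (m ℕ.+ i))

    swap-tail : ∀ e e′ → (∀ i → ℤ.- (e′ ℤ.* i) ≡ e ℤ.* i) → J.tail e (+ m) n ≈ head e′
    swap-tail e e′ neg = antidiagonal-cong n (λ i j i+j≡n → *-cong (Q≡ (exponent i j i+j≡n)) (*-comm _ _))
      where
      module ℤR = ℤS.+-*-Solver
      exponent : ∀ i j → i ℕ.+ j ≡ n → e ℤ.* (+ m ℤ.+ + i ℤ.- + m) ≡ e′ ℤ.* (+ j ℤ.- + n)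
      exponent i j ≡.refl =
        ≡.trans (≡.sym (neg (+ m ℤ.+ + i ℤ.- + m)))
          (ℤR.solve 4 (λ e m i j → ℤR.:- (e ℤR.:* (m ℤR.:+ i ℤR.:- m))
              ℤR.:= e ℤR.:* (j ℤR.:- (i ℤR.:+ j))) ≡.refl e′ (+ m) (+ i) (+ j))

    corner : ∀ e → I.weighted e (+ n) (+ n) m ≈ E c n * E a m
    corner e = trans (*-congʳ (trans (Q≡ (≡.trans (≡.cong (e ℤ.*_) (ℤP.+-inverseʳ (+ n))) (ℤP.*-zeroʳ e))) Q-0)) (*-identityˡ _)
  commutator-1⁺ a c ε ε-inverse m -[1+ n ] = begin
    D c d (D a (+ m) 1#) - D a (+ m) (D c d 1#)
      ≈⟨ +-cong (trans (D-cong c d (D-1 a (+ m))) (I.interaction-tail m d))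
           (-‿cong (trans (D-cong a (+ m) (D-1 c d)) (D-0 a (+ m)))) ⟩
    0# * E a m + I.A * (I.tail (ℤ.- a) d m - I.tail c d m) - 0#
      ≈⟨ solve 2 (λ e x → con (+ 0) :* e :+ x :- con (+ 0) := x) refl _ _ ⟩
    I.A * (I.tail (ℤ.- a) d m - I.tail c d m)
      -- With d negative, the sums from k = d on already contain every degree k ≥ 0.
      ≈⟨ *-congˡ (+-cong
           (antidiagonal-shift (I.weighted (ℤ.- a) d) (vanish (ℤ.- a)) m n)
           (-‿cong (antidiagonal-shift (I.weighted c d) (vanish c) m n))) ⟩
    I.A * (coeff (I.weightedSum (ℤ.- a) d) (+ m ℤ.+ d) - coeff (I.weightedSum c d) (+ m ℤ.+ d))
      ≈⟨ *-congˡ (+-cong (I.weightedSum-a d (+ m ℤ.+ d)) (-‿cong (I.weightedSum-c (+ m) d (+ m ℤ.+ d) ≡.refl))) ⟩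
    I.A * (Q (a ℤ.* d) * coeff (E (a ℤ.+ c)) (+ m ℤ.+ d) - Q (c ℤ.* + m) * coeff (E (a ℤ.+ c)) (+ m ℤ.+ d))
      ≈⟨ solve 4 (λ A q s e → A :* (q :* e :- s :* e) := A :* (q :- s) :* e) refl _ _ _ _ ⟩
    structure a c ε (+ m) d * coeff (E (a ℤ.+ c)) (+ m ℤ.+ d) ∎
    where
    d = -[1+ n ]
    module I = Interaction a c ε ε-inverse
    vanish : ∀ e k j → I.weighted e d -[1+ k ] j ≈ 0#
    vanish e k j = trans (*-congˡ (zeroˡ _)) (zeroʳ _)

  -- Antisymmetry under exchange of (a, b) with (c, d) reduces the case b < 0 ≤ d to
  -- `commutator-1⁺`. If b and d are both negative, both operators annihilate 1, and b + d is
  -- negative as well.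
  commutator-1 : ∀ a c ε → ε * (1# - Q (a ℤ.+ c)) ≈ 1# → ∀ b d →
    commutator a c b d 1# ≈ structure a c ε b d * coeff (E (a ℤ.+ c)) (b ℤ.+ d)
  commutator-1 a c ε ε-inverse (+ m) d = commutator-1⁺ a c ε ε-inverse m d
  commutator-1 a c ε ε-inverse -[1+ m ] (+ n) = begin
    commutator a c b d 1#
      ≈⟨ solve 2 (λ x y → x :- y := :- (y :- x)) refl _ _ ⟩
    - commutator c a d b 1#
      ≈⟨ -‿cong (commutator-1⁺ c a ε (ε-swap a c ε-inverse) n b) ⟩
    - (structure c a ε d b * coeff (E (c ℤ.+ a)) (d ℤ.+ b))
      ≡⟨ ≡.cong₂ (λ u v → - (structure c a ε d b * coeff (E u) v)) (ℤP.+-comm c a) (ℤP.+-comm d b) ⟩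
    - (structure c a ε d b * coeff (E (a ℤ.+ c)) (b ℤ.+ d))
      ≈⟨ solve 6 (λ x y e q s f → :- ((con (+ 1) :- y) :* (con (+ 1) :- x) :* e :* (s :- q) :* f)
                                  := (con (+ 1) :- x) :* (con (+ 1) :- y) :* e :* (q :- s) :* f) refl _ _ _ _ _ _ ⟩
    structure a c ε b d * coeff (E (a ℤ.+ c)) (b ℤ.+ d) ∎
    where
    b = -[1+ m ]
    d = + n
  commutator-1 a c ε ε-inverse -[1+ m ] -[1+ n ] = begin
    commutator a c b d 1#
      ≈⟨ +-cong (trans (D-cong c d (D-1 a b)) (D-0 c d)) (-‿cong (trans (D-cong a b (D-1 c d)) (D-0 a b))) ⟩
    0# - 0#
      ≈⟨ -‿inverseʳ 0# ⟩
    0#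
      ≈⟨ zeroʳ _ ⟨
    structure a c ε b d * 0# ∎
    where
    b = -[1+ m ]
    d = -[1+ n ]

  -- With X = q^{a(k+1)}, Y = q^{c(k+1)}, g = q^{ad} and s = q^{cb}, it rests on (1-Y)(gX-s) +
  -- (1-X)(g-sY) = (1-XY)(g-s). This is the condition for the right-hand side to obey the p_k-rule
  -- of the commutator.
  structure-p : ∀ a c ε b d k →
    α c k * structure a c ε b (d ℤ.+ + suc k) + α a k * structure a c ε (b ℤ.+ + suc k) d ≈ α (a ℤ.+ c) k * structure a c ε b d
  structure-p a c ε b d k = begin
    α c k * structure a c ε b (d ℤ.+ + suc k) + α a k * structure a c ε (b ℤ.+ + suc k) d
      ≈⟨ +-cong (*-congˡ (*-congˡ (+-congʳ (split a d)))) (*-congˡ (*-congˡ (+-congˡ (-‿cong (split c b))))) ⟩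
    α c k * (A * (Q (a ℤ.* d) * Q a ^^ suc k - Q (c ℤ.* b))) + α a k * (A * (Q (a ℤ.* d) - Q (c ℤ.* b) * Q c ^^ suc k))
      ≈⟨ solve 6 (λ m A X Y q s → m :* (con (+ 1) :- Y) :* (A :* (q :* X :- s)) :+ m :* (con (+ 1) :- X) :* (A :* (q :- s :* Y))
           := m :* (con (+ 1) :- X :* Y) :* (A :* (q :- s))) refl _ _ _ _ _ _ ⟩
    (1# - Q (ℤ.- + 1) ^^ suc k) * (1# - Q a ^^ suc k * Q c ^^ suc k) * structure a c ε b d
      ≈⟨ *-congʳ (*-congˡ (+-congˡ (-‿cong (trans (sym (RationalSeries.^^-* R (Q a) (Q c) (suc k))) (^^-cong (suc k) (sym (Q-+ a c))))))) ⟩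
    α (a ℤ.+ c) k * structure a c ε b d ∎
    where
    A = (1# - Q a) * (1# - Q c) * ε

    split : ∀ u v → Q (u ℤ.* (v ℤ.+ + suc k)) ≈ Q (u ℤ.* v) * Q u ^^ suc k
    split u v = trans (Q≡ (ℤP.*-distribˡ-+ u v (+ suc k))) (trans (Q-+ _ _) (*-congˡ (sym (Q-^^ u (suc k)))))

  monomial : List ℕ → Carrier
  monomial = foldr (λ k x → p k * x) 1#

  -- The induction hypothesis is used at (b, d), (b, d + k + 1) and (b + k + 1, d), so b and d stay
  -- quantified. The last two lead to the same operator with exponent b + d + k + 1, whose constants
  -- `structure-p` combines.
  commutator-monomial : ∀ a c ε → ε * (1# - Q (a ℤ.+ c)) ≈ 1# → ∀ μ b d →
    commutator a c b d (monomial μ) ≈ structure a c ε b d * D (a ℤ.+ c) (b ℤ.+ d) (monomial μ)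
  commutator-monomial a c ε ε-inverse [] b d =
    trans (commutator-1 a c ε ε-inverse b d) (*-congˡ (sym (D-1 (a ℤ.+ c) (b ℤ.+ d))))
  commutator-monomial a c ε ε-inverse (k ∷ μ) b d = begin
    commutator a c b d (p k * G)
      ≈⟨ +-cong (DD a c b d) (-‿cong (DD c a d b)) ⟩
    p k * D c d (D a b G) + α c k * D c (d ℤ.+ K) (D a b G) + α a k * D c d (D a (b ℤ.+ K) G)
      - (p k * D a b (D c d G) + α a k * D a (b ℤ.+ K) (D c d G) + α c k * D a b (D c (d ℤ.+ K) G))
      ≈⟨ solve 9 (λ p x y s u v t w z → p :* x :+ s :* u :+ t :* v :- (p :* y :+ t :* w :+ s :* z)
           := p :* (x :- y) :+ (s :* (u :- z) :+ t :* (v :- w))) refl _ _ _ _ _ _ _ _ _ ⟩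
    p k * commutator a c b d G + (α c k * commutator a c b (d ℤ.+ K) G + α a k * commutator a c (b ℤ.+ K) d G)
      ≈⟨ +-cong (*-congˡ (IH b d)) (+-cong
           (*-congˡ (trans (IH b (d ℤ.+ K)) (*-congˡ (reflexive (≡.cong (λ v → D u v G) (≡.sym (ℤP.+-assoc b d K)))))))
           (*-congˡ (trans (IH (b ℤ.+ K) d) (*-congˡ (reflexive (≡.cong (λ v → D u v G) shuffle)))))) ⟩
    p k * (structure a c ε b d * D u (b ℤ.+ d) G)
      + (α c k * (structure a c ε b (d ℤ.+ K) * D u (b ℤ.+ d ℤ.+ K) G) + α a k * (structure a c ε (b ℤ.+ K) d * D u (b ℤ.+ d ℤ.+ K) G))
      ≈⟨ solve 8 (λ p A x s B y t C → p :* (A :* x) :+ (s :* (B :* y) :+ t :* (C :* y))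
          := A :* (p :* x) :+ (s :* B :+ t :* C) :* y) refl _ _ _ _ _ _ _ _ ⟩
    structure a c ε b d * (p k * D u (b ℤ.+ d) G)
      + (α c k * structure a c ε b (d ℤ.+ K) + α a k * structure a c ε (b ℤ.+ K) d) * D u (b ℤ.+ d ℤ.+ K) G
      ≈⟨ +-congˡ (*-congʳ (structure-p a c ε b d k)) ⟩
    structure a c ε b d * (p k * D u (b ℤ.+ d) G) + α u k * structure a c ε b d * D u (b ℤ.+ d ℤ.+ K) G
      ≈⟨ solve 4 (λ A x s y → A :* x :+ s :* A :* y := A :* (x :+ s :* y)) refl _ _ _ _ ⟩
    structure a c ε b d * (p k * D u (b ℤ.+ d) G + α u k * D u (b ℤ.+ d ℤ.+ K) G)
      ≈⟨ *-congˡ (D-p u (b ℤ.+ d) k G) ⟨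
    structure a c ε b d * D u (b ℤ.+ d) (p k * G) ∎
    where
    u = a ℤ.+ c
    K = + suc k
    G = monomial μ
    IH = commutator-monomial a c ε ε-inverse μ

    shuffle : b ℤ.+ K ℤ.+ d ≡ b ℤ.+ d ℤ.+ K
    shuffle = ≡.trans (ℤP.+-assoc b K d) (≡.trans (≡.cong (λ s → b ℤ.+ s) (ℤP.+-comm K d)) (≡.sym (ℤP.+-assoc b d K)))

    DD : ∀ a c b d → D c d (D a b (p k * G)) ≈
      p k * D c d (D a b G) + α c k * D c (d ℤ.+ K) (D a b G) + α a k * D c d (D a (b ℤ.+ K) G)
    DD a c b d = begin
      D c d (D a b (p k * G))
        ≈⟨ D-cong c d (D-p a b k G) ⟩
      D c d (p k * D a b G + α a k * D a (b ℤ.+ K) G)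
        ≈⟨ D-+ c d _ _ ⟩
      D c d (p k * D a b G) + D c d (α a k * D a (b ℤ.+ K) G)
        ≈⟨ +-cong (D-p c d k _) (D-α c d a k _) ⟩
      p k * D c d (D a b G) + α c k * D c (d ℤ.+ K) (D a b G) + α a k * D c d (D a (b ℤ.+ K) G) ∎

  Formula : (a c : ℤ) (ε : Carrier) (b d : ℤ) → Carrier → Set
  Formula a c ε b d x = commutator a c b d x ≈ structure a c ε b d * D (a ℤ.+ c) (b ℤ.+ d) x

  formula-cong : ∀ a c ε b d {x y} → x ≈ y → Formula a c ε b d x → Formula a c ε b d y
  formula-cong a c ε b d x≈y fx = trans
    (sym (+-cong (D-cong c d (D-cong a b x≈y)) (-‿cong (D-cong a b (D-cong c d x≈y)))))
    (trans fx (*-congˡ (D-cong (a ℤ.+ c) (b ℤ.+ d) x≈y)))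

  formula-0 : ∀ a c ε b d → Formula a c ε b d 0#
  formula-0 a c ε b d = begin
    D c d (D a b 0#) - D a b (D c d 0#)  ≈⟨ +-cong (DD-0 a c b d) (-‿cong (DD-0 c a d b)) ⟩
    0# - 0#                              ≈⟨ -‿inverseʳ 0# ⟩
    0#                                   ≈⟨ trans (*-congˡ (D-0 (a ℤ.+ c) (b ℤ.+ d))) (zeroʳ _) ⟨
    structure a c ε b d * D (a ℤ.+ c) (b ℤ.+ d) 0# ∎
    where
    DD-0 : ∀ a c b d → D c d (D a b 0#) ≈ 0#
    DD-0 a c b d = trans (D-cong c d (D-0 a b)) (D-0 c d)

  formula-linear : ∀ a c ε b d s → (∀ u v x → D u v (s * x) ≈ s * D u v x) → ∀ x y →
    Formula a c ε b d x → Formula a c ε b d y → Formula a c ε b d (s * x + y)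
  formula-linear a c ε b d s D-s x y fx fy = begin
    D c d (D a b (s * x + y)) - D a b (D c d (s * x + y))
      ≈⟨ +-cong (DD-linear a c b d) (-‿cong (DD-linear c a d b)) ⟩
    (s * D c d (D a b x) + D c d (D a b y)) - (s * D a b (D c d x) + D a b (D c d y))
      ≈⟨ solve 5 (λ s p q r t → (s :* p :+ q) :- (s :* r :+ t) := s :* (p :- r) :+ (q :- t)) refl _ _ _ _ _ ⟩
    s * commutator a c b d x + commutator a c b d y
      ≈⟨ +-cong (*-congˡ fx) fy ⟩
    s * (structure a c ε b d * D u v x) + structure a c ε b d * D u v y
      ≈⟨ solve 4 (λ s S p q → s :* (S :* p) :+ S :* q := S :* (s :* p :+ q)) refl _ _ _ _ ⟩
    structure a c ε b d * (s * D u v x + D u v y)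
      ≈⟨ *-congˡ (D-linear u v) ⟨
    structure a c ε b d * D u v (s * x + y) ∎
    where
    u = a ℤ.+ c
    v = b ℤ.+ d

    D-linear : ∀ u v → D u v (s * x + y) ≈ s * D u v x + D u v y
    D-linear u v = trans (D-+ u v _ _) (+-congʳ (D-s u v x))

    DD-linear : ∀ a c b d → D c d (D a b (s * x + y)) ≈ s * D c d (D a b x) + D c d (D a b y)
    DD-linear a c b d = trans (D-cong c d (D-linear a b)) (trans (D-+ c d _ _) (+-congʳ (D-s c d _)))

-- Monoid algebras as lists of terms.

-- Formal A-linear combinations of elements of M are compared through their pairings with
-- all functions M → A.  This makes the ring laws of the monoid algebra formal, and it is finer
-- than the comparison of coefficients.
module FormalSums (A : CommutativeRing 0ℓ 0ℓ) (M : CommutativeMonoid 0ℓ 0ℓ) where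
  private
    module M = CommutativeMonoid M
  open CommutativeRing A
  open IntegerCoefficients A using (solve; _:+_; _:*_; _:-_; :-_; _:=_; con)
  open SetoidReasoning setoid

  FormalSum : Set
  FormalSum = List (Carrier × M.Carrier)

  Congruent : (M.Carrier → Carrier) → Set
  Congruent φ = ∀ {m n} → m M.≈ n → φ m ≈ φ n

  ⟨_,_⟩ : FormalSum → (M.Carrier → Carrier) → Carrier
  ⟨ [] , φ ⟩ = 0#
  ⟨ (c , m) ∷ F , φ ⟩ = c * φ m + ⟨ F , φ ⟩

  infix 4 _≋_
  record _≋_ (F G : FormalSum) : Set where
    constructor pairwise
    field pair : ∀ φ → Congruent φ → ⟨ F , φ ⟩ ≈ ⟨ G , φ ⟩
  open _≋_ public

  infixr 7 _⊛_
  _⊛_ : FormalSum → FormalSum → FormalSum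
  F ⊛ G = concatMap (λ t → map (λ s → (proj₁ t * proj₁ s , proj₂ t M.∙ proj₂ s)) G) F

  negate : FormalSum → FormalSum
  negate = map (λ t → (- proj₁ t , proj₂ t))

  pair-≈ : ∀ F {φ ψ : M.Carrier → Carrier} → (∀ m → φ m ≈ ψ m) → ⟨ F , φ ⟩ ≈ ⟨ F , ψ ⟩
  pair-≈ [] φ≈ψ = refl
  pair-≈ ((c , m) ∷ F) φ≈ψ = +-cong (*-congˡ (φ≈ψ m)) (pair-≈ F φ≈ψ)

  pair-++ : ∀ F G φ → ⟨ F ++ G , φ ⟩ ≈ ⟨ F , φ ⟩ + ⟨ G , φ ⟩
  pair-++ [] G φ = sym (+-identityˡ _)
  pair-++ ((c , m) ∷ F) G φ = trans (+-congˡ (pair-++ F G φ)) (sym (+-assoc _ _ _))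

  pair-translate : ∀ c m G φ →
    ⟨ map (λ s → (c * proj₁ s , m M.∙ proj₂ s)) G , φ ⟩ ≈ c * ⟨ G , (λ n → φ (m M.∙ n)) ⟩
  pair-translate c m [] φ = sym (zeroʳ c)
  pair-translate c m ((d , n) ∷ G) φ =
    trans (+-cong (*-assoc _ _ _) (pair-translate c m G φ)) (sym (distribˡ _ _ _))

  -- Pairing turns a product into an iterated sum. Each law of multiplication then reduces to a law
  -- of M under φ or to rearranging finite sums.
  pair-⊛ : ∀ F G φ → ⟨ F ⊛ G , φ ⟩ ≈ ⟨ F , (λ m → ⟨ G , (λ n → φ (m M.∙ n)) ⟩) ⟩
  pair-⊛ [] G φ = refl
  pair-⊛ ((c , m) ∷ F) G φ = trans (pair-++ (map _ G) (F ⊛ G) φ) (+-cong (pair-translate c m G φ) (pair-⊛ F G φ))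

  pair-scale : ∀ c G φ → ⟨ map (λ s → (c * proj₁ s , proj₂ s)) G , φ ⟩ ≈ c * ⟨ G , φ ⟩
  pair-scale c [] φ = sym (zeroʳ c)
  pair-scale c ((d , n) ∷ G) φ = trans (+-cong (*-assoc _ _ _) (pair-scale c G φ)) (sym (distribˡ _ _ _))

  pair-negate : ∀ F φ → ⟨ negate F , φ ⟩ ≈ - ⟨ F , φ ⟩
  pair-negate [] φ = solve 0 (con (+ 0) := :- con (+ 0)) refl
  pair-negate ((c , m) ∷ F) φ = trans (+-congˡ (pair-negate F φ))
    (solve 3 (λ c x y → :- c :* x :+ :- y := :- (c :* x :+ y)) refl _ _ _)

  pair-0 : ∀ F → ⟨ F , (λ _ → 0#) ⟩ ≈ 0#
  pair-0 [] = refl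
  pair-0 ((c , m) ∷ F) = trans (+-cong (zeroʳ c) (pair-0 F)) (+-identityˡ 0#)

  pair-+ : ∀ F φ ψ → ⟨ F , (λ m → φ m + ψ m) ⟩ ≈ ⟨ F , φ ⟩ + ⟨ F , ψ ⟩
  pair-+ [] φ ψ = sym (+-identityˡ 0#)
  pair-+ ((c , m) ∷ F) φ ψ = trans (+-congˡ (pair-+ F φ ψ))
    (solve 5 (λ c x y u v → c :* (x :+ y) :+ (u :+ v) := (c :* x :+ u) :+ (c :* y :+ v)) refl _ _ _ _ _)

  pair-* : ∀ F c φ → ⟨ F , (λ m → c * φ m) ⟩ ≈ c * ⟨ F , φ ⟩
  pair-* [] c φ = sym (zeroʳ c)
  pair-* ((d , m) ∷ F) c φ = trans (+-congˡ (pair-* F c φ))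
    (solve 4 (λ c d x u → d :* (c :* x) :+ c :* u := c :* (d :* x :+ u)) refl _ _ _ _)

  fubini : ∀ F G (Φ : M.Carrier → M.Carrier → Carrier) →
    ⟨ F , (λ m → ⟨ G , (λ n → Φ m n) ⟩) ⟩ ≈ ⟨ G , (λ n → ⟨ F , (λ m → Φ m n) ⟩) ⟩
  fubini [] G Φ = sym (pair-0 G)
  fubini ((c , m) ∷ F) G Φ = begin
    c * ⟨ G , Φ m ⟩ + ⟨ F , (λ m → ⟨ G , Φ m ⟩) ⟩
      ≈⟨ +-cong (sym (pair-* G c (Φ m))) (fubini F G Φ) ⟩
    ⟨ G , (λ n → c * Φ m n) ⟩ + ⟨ G , (λ n → ⟨ F , (λ m → Φ m n) ⟩) ⟩
      ≈⟨ pair-+ G _ _ ⟨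
    ⟨ G , (λ n → c * Φ m n + ⟨ F , (λ m → Φ m n) ⟩) ⟩ ∎

  ≋-refl : ∀ {F} → F ≋ F
  ≋-refl = pairwise (λ φ _ → refl)

  ≋-sym : ∀ {F G} → F ≋ G → G ≋ F
  ≋-sym p = pairwise (λ φ φ-cong → sym (pair p φ φ-cong))

  ≋-trans : ∀ {F G H} → F ≋ G → G ≋ H → F ≋ H
  ≋-trans p q = pairwise (λ φ φ-cong → trans (pair p φ φ-cong) (pair q φ φ-cong))

  ++-cong : ∀ {F F′ G G′} → F ≋ F′ → G ≋ G′ → F ++ G ≋ F′ ++ G′
  ++-cong {F} {F′} {G} {G′} p q = pairwise (λ φ φ-cong →
    trans (pair-++ F G φ) (trans (+-cong (pair p φ φ-cong) (pair q φ φ-cong)) (sym (pair-++ F′ G′ φ))))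

  ⊛-comm : ∀ F G → F ⊛ G ≋ G ⊛ F
  ⊛-comm F G = pairwise (λ φ φ-cong → begin
    ⟨ F ⊛ G , φ ⟩                                       ≈⟨ pair-⊛ F G φ ⟩
    ⟨ F , (λ m → ⟨ G , (λ n → φ (m M.∙ n)) ⟩) ⟩         ≈⟨ fubini F G (λ m n → φ (m M.∙ n)) ⟩
    ⟨ G , (λ n → ⟨ F , (λ m → φ (m M.∙ n)) ⟩) ⟩         ≈⟨ pair-≈ G (λ n → pair-≈ F (λ m → φ-cong (M.comm m n))) ⟩
    ⟨ G , (λ n → ⟨ F , (λ m → φ (n M.∙ m)) ⟩) ⟩         ≈⟨ pair-⊛ G F φ ⟨
    ⟨ G ⊛ F , φ ⟩                                       ∎)

  ⊛-congʳ : ∀ {F F′} G → F ≋ F′ → F ⊛ G ≋ F′ ⊛ G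
  ⊛-congʳ {F} {F′} G p = pairwise (λ φ φ-cong → begin
    ⟨ F ⊛ G , φ ⟩                                   ≈⟨ pair-⊛ F G φ ⟩
    ⟨ F , (λ m → ⟨ G , (λ n → φ (m M.∙ n)) ⟩) ⟩     ≈⟨ pair p _ (λ m≈m′ → pair-≈ G (λ n → φ-cong (M.∙-congʳ m≈m′))) ⟩
    ⟨ F′ , (λ m → ⟨ G , (λ n → φ (m M.∙ n)) ⟩) ⟩    ≈⟨ pair-⊛ F′ G φ ⟨
    ⟨ F′ ⊛ G , φ ⟩                                  ∎)

  ⊛-cong : ∀ {F F′ G G′} → F ≋ F′ → G ≋ G′ → F ⊛ G ≋ F′ ⊛ G′
  ⊛-cong {F} {F′} {G} {G′} p q =
    ≋-trans (⊛-congʳ G p) (≋-trans (⊛-comm F′ G) (≋-trans (⊛-congʳ F′ q) (⊛-comm G′ F′)))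

  ⊛-assoc : ∀ F G H → (F ⊛ G) ⊛ H ≋ F ⊛ (G ⊛ H)
  ⊛-assoc F G H = pairwise (λ φ φ-cong → begin
    ⟨ (F ⊛ G) ⊛ H , φ ⟩
      ≈⟨ trans (pair-⊛ (F ⊛ G) H φ) (pair-⊛ F G _) ⟩
    ⟨ F , (λ l → ⟨ G , (λ m → ⟨ H , (λ n → φ ((l M.∙ m) M.∙ n)) ⟩) ⟩) ⟩
      ≈⟨ pair-≈ F (λ l → pair-≈ G (λ m → pair-≈ H (λ n → φ-cong (M.assoc l m n)))) ⟩
    ⟨ F , (λ l → ⟨ G , (λ m → ⟨ H , (λ n → φ (l M.∙ (m M.∙ n))) ⟩) ⟩) ⟩
      ≈⟨ pair-≈ F (λ l → pair-⊛ G H (λ n → φ (l M.∙ n))) ⟨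
    ⟨ F , (λ l → ⟨ G ⊛ H , (λ n → φ (l M.∙ n)) ⟩) ⟩
      ≈⟨ pair-⊛ F (G ⊛ H) φ ⟨
    ⟨ F ⊛ (G ⊛ H) , φ ⟩ ∎)

  ⊛-identityˡ : ∀ F → ((1# , M.ε) ∷ []) ⊛ F ≋ F
  ⊛-identityˡ F = pairwise (λ φ φ-cong → begin
    ⟨ ((1# , M.ε) ∷ []) ⊛ F , φ ⟩              ≈⟨ pair-⊛ ((1# , M.ε) ∷ []) F φ ⟩
    1# * ⟨ F , (λ n → φ (M.ε M.∙ n)) ⟩ + 0#    ≈⟨ trans (+-identityʳ _) (*-identityˡ _) ⟩
    ⟨ F , (λ n → φ (M.ε M.∙ n)) ⟩              ≈⟨ pair-≈ F (λ n → φ-cong (M.identityˡ n)) ⟩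
    ⟨ F , φ ⟩                                  ∎)

  ⊛-distribʳ : ∀ H F G → (F ++ G) ⊛ H ≋ F ⊛ H ++ G ⊛ H
  ⊛-distribʳ H F G = pairwise (λ φ _ → begin
    ⟨ (F ++ G) ⊛ H , φ ⟩
      ≈⟨ trans (pair-⊛ (F ++ G) H φ) (pair-++ F G _) ⟩
    ⟨ F , (λ m → ⟨ H , (λ n → φ (m M.∙ n)) ⟩) ⟩ + ⟨ G , (λ m → ⟨ H , (λ n → φ (m M.∙ n)) ⟩) ⟩
      ≈⟨ +-cong (pair-⊛ F H φ) (pair-⊛ G H φ) ⟨
    ⟨ F ⊛ H , φ ⟩ + ⟨ G ⊛ H , φ ⟩
      ≈⟨ pair-++ (F ⊛ H) (G ⊛ H) φ ⟨
    ⟨ F ⊛ H ++ G ⊛ H , φ ⟩ ∎)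

  ++-comm : ∀ F G → F ++ G ≋ G ++ F
  ++-comm F G = pairwise (λ φ _ → trans (pair-++ F G φ) (trans (+-comm _ _) (sym (pair-++ G F φ))))

  negate-cong : ∀ {F G} → F ≋ G → negate F ≋ negate G
  negate-cong {F} {G} p = pairwise (λ φ φ-cong →
    trans (pair-negate F φ) (trans (-‿cong (pair p φ φ-cong)) (sym (pair-negate G φ))))

  negate-inverseˡ : ∀ F → negate F ++ F ≋ []
  negate-inverseˡ F = pairwise (λ φ _ →
    trans (pair-++ (negate F) F φ) (trans (+-congʳ (pair-negate F φ)) (-‿inverseˡ _)))

  formalSums-isCommutativeRing : IsCommutativeRing _≋_ _++_ _⊛_ negate [] ((1# , M.ε) ∷ [])
  formalSums-isCommutativeRing = record
    { isRing = record
      { +-isAbelianGroup = record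
        { isGroup = record
          { isMonoid = record
            { isSemigroup = record
              { isMagma = record
                { isEquivalence = record { refl = ≋-refl ; sym = ≋-sym ; trans = ≋-trans }
                ; ∙-cong = ++-cong }
              ; assoc = λ F G H → pairwise (λ φ _ → reflexive (≡.cong (λ L → ⟨ L , φ ⟩) (LP.++-assoc F G H))) }
            ; identity = (λ _ → ≋-refl) , (λ F → ++-comm F []) }
          ; inverse = negate-inverseˡ , (λ F → ≋-trans (++-comm F (negate F)) (negate-inverseˡ F))
          ; ⁻¹-cong = negate-cong }
        ; comm = ++-comm }
      ; *-cong = ⊛-cong
      ; *-assoc = ⊛-assoc
      ; *-identity = ⊛-identityˡ , (λ F → ≋-trans (⊛-comm F _) (⊛-identityˡ F))
      ; distrib = (λ F G H → ≋-trans (⊛-comm F (G ++ H))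
                      (≋-trans (⊛-distribʳ F G H) (++-cong (⊛-comm G F) (⊛-comm H F))))
                , ⊛-distribʳ }
    ; *-comm = ⊛-comm }

  formalSums-commutativeRing : CommutativeRing 0ℓ 0ℓ
  formalSums-commutativeRing = record { isCommutativeRing = formalSums-isCommutativeRing }

  pair-vanishes : ∀ F {φ} → All (λ t → φ (proj₂ t) ≈ 0#) F → ⟨ F , φ ⟩ ≈ 0#
  pair-vanishes [] [] = refl
  pair-vanishes ((c , m) ∷ F) (φm≈0 ∷ φ≈0) =
    trans (+-cong (trans (*-congˡ φm≈0) (zeroʳ c)) (pair-vanishes F φ≈0)) (+-identityˡ 0#)

-- Rings of fractions.

module Fractions (R : CommutativeRing 0ℓ 0ℓ) where
  open CommutativeRing R
  open IntegerCoefficients R using (solve; _:+_; _:*_; _:-_; :-_; _:=_; con)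

  -- Cancellation is what transitivity of cross-multiplication uses, and it passes to products at
  -- once, so fractions can be formed over any commutative ring.
  Cancellable : Carrier → Set
  Cancellable d = ∀ x y → d * x ≈ d * y → x ≈ y

  cancellable-1 : Cancellable 1#
  cancellable-1 x y e = trans (sym (*-identityˡ x)) (trans e (*-identityˡ y))

  cancellable-* : ∀ {d e} → Cancellable d → Cancellable e → Cancellable (d * e)
  cancellable-* d-cancel e-cancel x y p =
    e-cancel x y (d-cancel _ _ (trans (sym (*-assoc _ _ _)) (trans p (*-assoc _ _ _))))

  record Fraction : Set where
    constructor fraction
    field
      numerator denominator : Carrier
      cancellable : Cancellable denominator
  open Fraction

  infix 4 _≃_
  record _≃_ (x y : Fraction) : Set where
    constructor cross
    field uncross : numerator x * denominator y ≈ numerator y * denominator x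
  open _≃_

  _⊕_ _⊗_ : Fraction → Fraction → Fraction
  x ⊕ y = fraction (numerator x * denominator y + numerator y * denominator x) (denominator x * denominator y)
            (cancellable-* (cancellable x) (cancellable y))
  x ⊗ y = fraction (numerator x * numerator y) (denominator x * denominator y)
            (cancellable-* (cancellable x) (cancellable y))

  ⊖_ : Fraction → Fraction
  ⊖ x = fraction (- numerator x) (denominator x) (cancellable x)

  0F 1F : Fraction
  0F = fraction 0# 1# cancellable-1
  1F = fraction 1# 1# cancellable-1

  ≃-trans : ∀ {x y z} → x ≃ y → y ≃ z → x ≃ z
  ≃-trans {fraction a A _} {fraction b B B-cancel} {fraction c C _} (cross p) (cross q) =
    cross (B-cancel _ _ (trans
      (solve 3 (λ a B C → B :* (a :* C) := a :* B :* C) refl a B C) (trans (*-congʳ p) (trans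
      (solve 3 (λ A b C → b :* A :* C := b :* C :* A) refl A b C) (trans (*-congʳ q)
      (solve 3 (λ A B c → c :* B :* A := B :* (c :* A)) refl A B c))))))

  ⊕-cong : ∀ {x x′ y y′} → x ≃ x′ → y ≃ y′ → x ⊕ y ≃ x′ ⊕ y′
  ⊕-cong {fraction a A _} {fraction a′ A′ _} {fraction b B _} {fraction b′ B′ _} (cross p) (cross q) = cross (trans
    (solve 6 (λ a A A′ b B B′ → (a :* B :+ b :* A) :* (A′ :* B′)
        := a :* A′ :* (B :* B′) :+ b :* B′ :* (A :* A′)) refl a A A′ b B B′)
    (trans (+-cong (*-congʳ p) (*-congʳ q))
    (solve 6 (λ a′ A A′ b′ B B′ → a′ :* A :* (B :* B′) :+ b′ :* B :* (A :* A′)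
        := (a′ :* B′ :+ b′ :* A′) :* (A :* B)) refl a′ A A′ b′ B B′)))

  ⊗-cong : ∀ {x x′ y y′} → x ≃ x′ → y ≃ y′ → x ⊗ y ≃ x′ ⊗ y′
  ⊗-cong {fraction a A _} {fraction a′ A′ _} {fraction b B _} {fraction b′ B′ _} (cross p) (cross q) = cross (trans
    (solve 4 (λ a A′ b B′ → a :* b :* (A′ :* B′) := a :* A′ :* (b :* B′)) refl a A′ b B′)
    (trans (*-cong p q)
    (solve 4 (λ a′ A b′ B → a′ :* A :* (b′ :* B) := a′ :* b′ :* (A :* B)) refl a′ A b′ B)))

  ⊖-cong : ∀ {x y} → x ≃ y → ⊖ x ≃ ⊖ y
  ⊖-cong {fraction a A _} {fraction b B _} (cross p) = cross (trans
    (solve 2 (λ a B → :- a :* B := :- (a :* B)) refl a B) (trans (-‿cong p)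
    (solve 2 (λ b A → :- (b :* A) := :- b :* A) refl b A)))

  ⊕-comm : ∀ x y → x ⊕ y ≃ y ⊕ x
  ⊕-comm (fraction a A _) (fraction b B _) = cross
    (solve 4 (λ a A b B → (a :* B :+ b :* A) :* (B :* A) := (b :* A :+ a :* B) :* (A :* B)) refl a A b B)

  ⊗-comm : ∀ x y → x ⊗ y ≃ y ⊗ x
  ⊗-comm (fraction a A _) (fraction b B _) = cross
    (solve 4 (λ a A b B → (a :* b) :* (B :* A) := (b :* a) :* (A :* B)) refl a A b B)

  ⊕-identityˡ : ∀ x → 0F ⊕ x ≃ x
  ⊕-identityˡ (fraction a A _) = cross
    (solve 2 (λ a A → (con (+ 0) :* A :+ a :* con (+ 1)) :* A := a :* (con (+ 1) :* A)) refl a A)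

  ⊗-identityˡ : ∀ x → 1F ⊗ x ≃ x
  ⊗-identityˡ (fraction a A _) = cross
    (solve 2 (λ a A → con (+ 1) :* a :* A := a :* (con (+ 1) :* A)) refl a A)

  ⊖-inverseˡ : ∀ x → (⊖ x) ⊕ x ≃ 0F
  ⊖-inverseˡ (fraction a A _) = cross
    (solve 2 (λ a A → (:- a :* A :+ a :* A) :* con (+ 1) := con (+ 0) :* (A :* A)) refl a A)

  ⊗-distribʳ : ∀ z x y → (x ⊕ y) ⊗ z ≃ (x ⊗ z) ⊕ (y ⊗ z)
  ⊗-distribʳ (fraction c C _) (fraction a A _) (fraction b B _) = cross
    (solve 6 (λ a A b B c C → (a :* B :+ b :* A) :* c :* (A :* C :* (B :* C))
      := (a :* c :* (B :* C) :+ b :* c :* (A :* C)) :* (A :* B :* C)) refl a A b B c C)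

  fractions-isCommutativeRing : IsCommutativeRing _≃_ _⊕_ _⊗_ ⊖_ 0F 1F
  fractions-isCommutativeRing = record
    { isRing = record
      { +-isAbelianGroup = record
        { isGroup = record
          { isMonoid = record
            { isSemigroup = record
              { isMagma = record
                { isEquivalence = record { refl = cross refl ; sym = λ p → cross (sym (uncross p)) ; trans = ≃-trans }
                ; ∙-cong = ⊕-cong }
              ; assoc = λ { (fraction a A _) (fraction b B _) (fraction c C _) → cross
                  (solve 6 (λ a A b B c C → ((a :* B :+ b :* A) :* C :+ c :* (A :* B)) :* (A :* (B :* C))
                    := (a :* (B :* C) :+ (b :* C :+ c :* B) :* A) :* (A :* B :* C)) refl a A b B c C) } }
            ; identity = ⊕-identityˡ , (λ x → ≃-trans (⊕-comm x 0F) (⊕-identityˡ x)) }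
          ; inverse = ⊖-inverseˡ , (λ x → ≃-trans (⊕-comm x (⊖ x)) (⊖-inverseˡ x))
          ; ⁻¹-cong = ⊖-cong }
        ; comm = ⊕-comm }
      ; *-cong = ⊗-cong
      ; *-assoc = λ { (fraction a A _) (fraction b B _) (fraction c C _) → cross
          (solve 6 (λ a A b B c C → a :* b :* c :* (A :* (B :* C))
              := a :* (b :* c) :* (A :* B :* C)) refl a A b B c C) }
      ; *-identity = ⊗-identityˡ , (λ x → ≃-trans (⊗-comm x 1F) (⊗-identityˡ x))
      ; distrib = (λ z x y → ≃-trans (⊗-comm z (x ⊕ y)) (≃-trans (⊗-distribʳ z x y) (⊕-cong (⊗-comm x z) (⊗-comm y z))))
                , ⊗-distribʳ }
    ; *-comm = ⊗-comm }

-- Scalars, generators and linear maps of monoid algebras.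

module FormalSumMaps (A : CommutativeRing 0ℓ 0ℓ) (M : CommutativeMonoid 0ℓ 0ℓ) where
  private
    module M = CommutativeMonoid M
  open CommutativeRing A
  open FormalSums A M
  private
    module F = CommutativeRing formalSums-commutativeRing
    module SA = Sums A
    module SF = Sums formalSums-commutativeRing
  open SetoidReasoning setoid

  embed : Carrier → FormalSum
  embed c = (c , M.ε) ∷ []

  generator : M.Carrier → FormalSum
  generator m = (1# , m) ∷ []

  pair-embed : ∀ c F {φ} → Congruent φ → ⟨ embed c ⊛ F , φ ⟩ ≈ c * ⟨ F , φ ⟩
  pair-embed c F {φ} φ-cong = begin
    ⟨ embed c ⊛ F , φ ⟩                     ≈⟨ pair-⊛ (embed c) F φ ⟩
    c * ⟨ F , (λ n → φ (M.ε M.∙ n)) ⟩ + 0#  ≈⟨ +-identityʳ _ ⟩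
    c * ⟨ F , (λ n → φ (M.ε M.∙ n)) ⟩       ≈⟨ *-congˡ (pair-≈ F (λ n → φ-cong (M.identityˡ n))) ⟩
    c * ⟨ F , φ ⟩                           ∎

  pair-generator : ∀ m F φ → ⟨ generator m ⊛ F , φ ⟩ ≈ ⟨ F , (λ n → φ (m M.∙ n)) ⟩
  pair-generator m F φ = trans (pair-⊛ (generator m) F φ) (trans (+-identityʳ _) (*-identityˡ _))

  generator-∙ : ∀ m n → generator m ⊛ generator n ≋ generator (m M.∙ n)
  generator-∙ m n = pairwise (λ φ _ → +-congʳ (*-congʳ (*-identityˡ 1#)))

  ∷-embed : ∀ c m F → (c , m) ∷ F ≋ embed c ⊛ generator m ++ F
  ∷-embed c m F = pairwise (λ φ φ-cong → +-congʳ (*-cong (sym (*-identityʳ c)) (φ-cong (M.sym (M.identityˡ m)))))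

  scale : Carrier → FormalSum → FormalSum
  scale c = map (λ t → (c * proj₁ t , proj₂ t))

  scale-embed : ∀ c F → scale c F ≋ embed c ⊛ F
  scale-embed c F = pairwise (λ φ φ-cong → trans (pair-scale c F φ) (sym (pair-embed c F φ-cong)))

  embed-cong : ∀ {c d} → c ≈ d → embed c ≋ embed d
  embed-cong c≈d = pairwise (λ φ _ → +-congʳ (*-congʳ c≈d))

  embed-+ : ∀ c d → embed (c + d) ≋ embed c ++ embed d
  embed-+ c d = pairwise (λ φ _ → trans (+-congʳ (distribʳ _ _ _)) (+-assoc _ _ _))

  embed-* : ∀ c d → embed (c * d) ≋ embed c ⊛ embed d
  embed-* c d = scale-embed c (embed d)

  embed-0 : embed 0# ≋ []
  embed-0 = pairwise (λ φ _ → trans (+-identityʳ _) (zeroˡ _))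

  embed-^^ : ∀ x n → embed (x SA.^^ n) ≋ embed x SF.^^ n
  embed-^^ x zero = ≋-refl
  embed-^^ x (suc n) = ≋-trans (embed-* x (x SA.^^ n)) (F.*-congˡ {embed x} (embed-^^ x n))

  embed-1-^^ : ∀ x n → embed (1# - x SA.^^ n) ≋ embed 1# ++ negate (embed x SF.^^ n)
  embed-1-^^ x n = ≋-trans (embed-+ 1# (- (x SA.^^ n))) (++-cong (≋-refl {embed 1#}) (negate-cong (embed-^^ x n)))

  negate-scale : ∀ F → scale (- 1#) F ≋ negate F
  negate-scale F = pairwise (λ φ _ → trans (pair-scale (- 1#) F φ) (trans (-1*x≈-x _) (sym (pair-negate F φ))))
    where open RingProperties ring using (-1*x≈-x)

  -- T is the linear extension of f.
  record Extends (T : FormalSum → FormalSum) (f : M.Carrier → FormalSum) : Set where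
    field
      f-cong : ∀ {m n} → m M.≈ n → f m ≋ f n
      pair-T : ∀ F {φ} → Congruent φ → ⟨ T F , φ ⟩ ≈ ⟨ F , (λ m → ⟨ f m , φ ⟩) ⟩

    slice : ∀ {φ} → Congruent φ → Congruent (λ m → ⟨ f m , φ ⟩)
    slice φ-cong m≈n = pair (f-cong m≈n) _ φ-cong

    T-cong : ∀ {F G} → F ≋ G → T F ≋ T G
    T-cong {F} {G} F≋G = pairwise (λ φ φ-cong →
      trans (pair-T F φ-cong) (trans (pair F≋G _ (slice φ-cong)) (sym (pair-T G φ-cong))))

    T-+ : ∀ F G → T (F ++ G) ≋ T F ++ T G
    T-+ F G = pairwise (λ φ φ-cong → begin
      ⟨ T (F ++ G) , φ ⟩                                              ≈⟨ pair-T (F ++ G) φ-cong ⟩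
      ⟨ F ++ G , (λ m → ⟨ f m , φ ⟩) ⟩                                ≈⟨ pair-++ F G _ ⟩
      ⟨ F , (λ m → ⟨ f m , φ ⟩) ⟩ + ⟨ G , (λ m → ⟨ f m , φ ⟩) ⟩       ≈⟨ +-cong (pair-T F φ-cong) (pair-T G φ-cong) ⟨
      ⟨ T F , φ ⟩ + ⟨ T G , φ ⟩                                       ≈⟨ pair-++ (T F) (T G) φ ⟨
      ⟨ T F ++ T G , φ ⟩                                              ∎)

    T-embed : ∀ c F → T (embed c ⊛ F) ≋ embed c ⊛ T F
    T-embed c F = pairwise (λ φ φ-cong → begin
      ⟨ T (embed c ⊛ F) , φ ⟩                     ≈⟨ pair-T (embed c ⊛ F) φ-cong ⟩
      ⟨ embed c ⊛ F , (λ m → ⟨ f m , φ ⟩) ⟩       ≈⟨ pair-embed c F (slice φ-cong) ⟩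
      c * ⟨ F , (λ m → ⟨ f m , φ ⟩) ⟩             ≈⟨ *-congˡ (pair-T F φ-cong) ⟨
      c * ⟨ T F , φ ⟩                             ≈⟨ pair-embed c (T F) φ-cong ⟨
      ⟨ embed c ⊛ T F , φ ⟩                       ∎)

    T-generator : ∀ m → T (generator m) ≋ f m
    T-generator m = pairwise (λ φ φ-cong → trans (pair-T (generator m) φ-cong) (trans (+-identityʳ _) (*-identityˡ _)))

  -- Both sides are linear in F, so the rule need only hold on monomials. In the application m is
  -- p_{k+1}, and T and T′ are `D` with exponents v and v + k + 1.
  extends-twisted : ∀ {T T′ f f′} → Extends T f → Extends T′ f′ → ∀ m β →
    (∀ n → f (m M.∙ n) ≋ generator m ⊛ f n ++ embed β ⊛ f′ n) →
    ∀ F → T (generator m ⊛ F) ≋ generator m ⊛ T F ++ embed β ⊛ T′ F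
  extends-twisted {T} {T′} {f} {f′} ext ext′ m β twist F = pairwise (λ φ φ-cong → begin
    ⟨ T (generator m ⊛ F) , φ ⟩
      ≈⟨ X.pair-T (generator m ⊛ F) φ-cong ⟩
    ⟨ generator m ⊛ F , (λ n → ⟨ f n , φ ⟩) ⟩
      ≈⟨ pair-generator m F _ ⟩
    ⟨ F , (λ n → ⟨ f (m M.∙ n) , φ ⟩) ⟩
      ≈⟨ pair-≈ F (λ n → begin
           ⟨ f (m M.∙ n) , φ ⟩
             ≈⟨ pair (twist n) φ φ-cong ⟩
           ⟨ generator m ⊛ f n ++ embed β ⊛ f′ n , φ ⟩
             ≈⟨ pair-++ (generator m ⊛ f n) (embed β ⊛ f′ n) φ ⟩
           ⟨ generator m ⊛ f n , φ ⟩ + ⟨ embed β ⊛ f′ n , φ ⟩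
             ≈⟨ +-cong (pair-generator m (f n) φ) (pair-embed β (f′ n) φ-cong) ⟩
           ⟨ f n , (λ k → φ (m M.∙ k)) ⟩ + β * ⟨ f′ n , φ ⟩ ∎) ⟩
    ⟨ F , (λ n → ⟨ f n , (λ k → φ (m M.∙ k)) ⟩ + β * ⟨ f′ n , φ ⟩) ⟩
      ≈⟨ trans (pair-+ F _ _) (+-congˡ (pair-* F β _)) ⟩
    ⟨ F , (λ n → ⟨ f n , (λ k → φ (m M.∙ k)) ⟩) ⟩ + β * ⟨ F , (λ n → ⟨ f′ n , φ ⟩) ⟩
      ≈⟨ +-cong (X.pair-T F (λ k≈l → φ-cong (M.∙-congˡ k≈l))) (*-congˡ (Y.pair-T F φ-cong)) ⟨
    ⟨ T F , (λ k → φ (m M.∙ k)) ⟩ + β * ⟨ T′ F , φ ⟩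
      ≈⟨ +-cong (pair-generator m (T F) φ) (pair-embed β (T′ F) φ-cong) ⟨
    ⟨ generator m ⊛ T F , φ ⟩ + ⟨ embed β ⊛ T′ F , φ ⟩
      ≈⟨ pair-++ (generator m ⊛ T F) (embed β ⊛ T′ F) φ ⟨
    ⟨ generator m ⊛ T F ++ embed β ⊛ T′ F , φ ⟩ ∎)
    where
    module X = Extends ext
    module Y = Extends ext′

  -- The coefficient of z^v in P · Σ E(w) z^w, for P a polynomial in 1/z.
  extract : (ℤ → FormalSum) → ℤ → List (ℕ × FormalSum) → FormalSum
  extract E v = concatMap (λ t → proj₂ t ⊛ E (v ℤ.+ + proj₁ t))

  extract-shift : ∀ E v n G P →
    extract E v (map (λ s → (n ℕ.+ proj₁ s , G ⊛ proj₂ s)) P) ≋ G ⊛ extract E (v ℤ.+ + n) P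
  extract-shift E v n G [] = ≋-sym (F.zeroʳ G)
  extract-shift E v n G ((j , H) ∷ P) = ≋-trans
    (++-cong
      (≋-trans (⊛-assoc G H (E (v ℤ.+ + (n ℕ.+ j))))
        (F.reflexive (≡.cong (λ w → G ⊛ H ⊛ E w) (≡.sym (ℤP.+-assoc v (+ n) (+ j))))))
      (extract-shift E v n G P))
    (≋-sym (F.distribˡ G (H ⊛ E (v ℤ.+ + n ℤ.+ + j)) (extract E (v ℤ.+ + n) P)))

  extract-scale : ∀ E v c P → extract E v (map (λ s → (proj₁ s , scale c (proj₂ s))) P) ≋ embed c ⊛ extract E v P
  extract-scale E v c [] = ≋-sym (F.zeroʳ (embed c))
  extract-scale E v c ((j , H) ∷ P) = ≋-trans
    (++-cong (≋-trans (⊛-congʳ (E (v ℤ.+ + j)) (scale-embed c H)) (⊛-assoc (embed c) H (E (v ℤ.+ + j)))) (extract-scale E v c P))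
    (≋-sym (F.distribˡ (embed c) (H ⊛ E (v ℤ.+ + j)) (extract E v P)))

-- Ring identities involving inverses, and the exchange of twisted multiplications.

module RingIdentities (R : CommutativeRing 0ℓ 0ℓ) where
  open CommutativeRing R
  open IntegerCoefficients R using (solve; _:+_; _:*_; _:-_; :-_; _:=_; con)
  open SetoidReasoning setoid

  cancel-reciprocal : ∀ x y z w → w * y ≈ 1# → x * y * (z * w) ≈ x * z
  cancel-reciprocal x y z w wy≈1 = begin
    x * y * (z * w)     ≈⟨ solve 4 (λ x y z w → x :* y :* (z :* w) := x :* z :* (w :* y)) refl x y z w ⟩
    x * z * (w * y)     ≈⟨ *-congˡ wy≈1 ⟩
    x * z * 1#          ≈⟨ *-identityʳ _ ⟩
    x * z               ∎

  inverse-unique : ∀ x y z → x * y ≈ 1# → x * z ≈ 1# → y ≈ z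
  inverse-unique x y z xy≈1 xz≈1 = begin
    y              ≈⟨ *-identityʳ y ⟨
    y * 1#         ≈⟨ *-congˡ xz≈1 ⟨
    y * (x * z)    ≈⟨ solve 3 (λ x y z → y :* (x :* z) := x :* y :* z) refl x y z ⟩
    x * y * z      ≈⟨ *-congʳ xy≈1 ⟩
    1# * z         ≈⟨ *-identityˡ z ⟩
    z              ∎

  cancel-unit : ∀ i d x y → i * d ≈ 1# → d * x ≈ d * y → x ≈ y
  cancel-unit i d x y id≈1 dx≈dy = begin
    x              ≈⟨ *-identityˡ x ⟨
    1# * x         ≈⟨ *-congʳ id≈1 ⟨
    i * d * x      ≈⟨ *-assoc i d x ⟩
    i * (d * x)    ≈⟨ *-congˡ dx≈dy ⟩
    i * (d * y)    ≈⟨ *-assoc i d y ⟨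
    i * d * y      ≈⟨ *-congʳ id≈1 ⟩
    1# * y         ≈⟨ *-identityˡ y ⟩
    y              ∎

  cancel-neg : ∀ i d s p → i * d ≈ 1# → d * (- s * i * p) ≈ - (s * p)
  cancel-neg i d s p id≈1 = begin
    d * (- s * i * p)     ≈⟨ solve 4 (λ i d s p → d :* (:- s :* i :* p) := i :* d :* :- (s :* p)) refl i d s p ⟩
    i * d * - (s * p)     ≈⟨ *-congʳ id≈1 ⟩
    1# * - (s * p)        ≈⟨ *-identityˡ _ ⟩
    - (s * p)             ∎

  -- Used to exchange adjacent factors p_x and p_y of a monomial: A, B, C and D are the images of
  -- the remaining monomial with v unshifted, shifted for y, shifted for x, and shifted for both.
  twist-swap : ∀ p s q t A B C D → p * (q * A + t * B) + s * (q * C + t * D) ≈ q * (p * A + s * C) + t * (p * B + s * D)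
  twist-swap = solve 8 (λ p s q t A B C D →
    p :* (q :* A :+ t :* B) :+ s :* (q :* C :+ t :* D) := q :* (p :* A :+ s :* C) :+ t :* (p :* B :+ s :* D)) refl

  -- Comparison of the two normalisations of the structure constants: r = w = 1/(1-q), m = 1/M,
  -- x = 1/[u]_q, q̄ = 1/q, A = 1-q^a, C = 1-q^c, N = q^{bc} and L = q^{da-bc}.
  structure-normalisation : ∀ q q̄ r w m x A C N L →
    q̄ * q ≈ 1# → r * (1# - q) ≈ 1# → (1# - q) * w ≈ 1# → (1# - q̄) * (1# - q) * m ≈ 1# →
    m * (A * C * (x * r) * (N * L - N)) ≈ q * N * (A * r) * (C * r) * x * (1# - L) * w
  structure-normalisation q q̄ r w m x A C N L q̄q≈1 r≈ w≈ m≈ = begin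
    m * (A * C * (x * r) * (N * L - N))
      -- M = -(1-q)^2/q, so 1/M = -q/(1-q)^2; it is written with r and w, the two names of 1/(1-q),
      -- to match the right-hand side.
      ≈⟨ *-congʳ (inverse-unique _ m _ m≈ m′) ⟩
    (- q * r * w) * (A * C * (x * r) * (N * L - N))
      ≈⟨ solve 8 (λ q r w x A C N L → (:- q :* r :* w) :* (A :* C :* (x :* r) :* (N :* L :- N))
           := q :* N :* (A :* r) :* (C :* r) :* x :* (con (+ 1) :- L) :* w) refl q r w x A C N L ⟩
    q * N * (A * r) * (C * r) * x * (1# - L) * w ∎
    where
    m′ : (1# - q̄) * (1# - q) * (- q * r * w) ≈ 1#
    m′ = begin
      (1# - q̄) * (1# - q) * (- q * r * w)
        ≈⟨ solve 4 (λ q q̄ r w → (con (+ 1) :- q̄) :* (con (+ 1) :- q) :* (:- q :* r :* w)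
             := r :* (q̄ :* q :- q) :* ((con (+ 1) :- q) :* w)) refl q q̄ r w ⟩
      r * (q̄ * q - q) * ((1# - q) * w)   ≈⟨ *-cong (*-congˡ (+-congʳ q̄q≈1)) w≈ ⟩
      r * (1# - q) * 1#                  ≈⟨ trans (*-identityʳ _) r≈ ⟩
      1#                                 ∎

open import Defs

-- Laurent polynomials form an integral domain.

module Laurents where
  open FormalSums ℚP.+-*-commutativeRing ℤP.+-0-commutativeMonoid public
  open ≡.≡-Reasoning

  laurentRing : CommutativeRing 0ℓ 0ℓ
  laurentRing = formalSums-commutativeRing

  δ : ℤ → ℤ → ℚ
  δ n e with e ℤ.≟ n
  ... | yes _ = 1ℚ
  ... | no  _ = 0ℚ

  δ-diagonal : ∀ n → δ n n ≡ 1ℚ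
  δ-diagonal n with n ℤ.≟ n
  ... | yes _ = ≡.refl
  ... | no n≢n = contradiction ≡.refl n≢n

  δ-off : ∀ {n e} → n ℤ.< e → δ n e ≡ 0ℚ
  δ-off {n} {e} n<e with e ℤ.≟ n
  ... | yes e≡n = contradiction (≡.sym e≡n) (ℤP.<⇒≢ n<e)
  ... | no _ = ≡.refl

  coeffL-pair : ∀ p n → coeffL p n ≡ ⟨ p , δ n ⟩
  coeffL-pair [] n = ≡.refl
  coeffL-pair ((c , e) ∷ p) n with e ℤ.≟ n
  ... | yes _ = ≡.cong₂ ℚ._+_ (≡.sym (ℚP.*-identityʳ c)) (coeffL-pair p n)
  ... | no  _ = ≡.trans (coeffL-pair p n) (≡.sym (≡.trans (≡.cong (ℚ._+ ⟨ p , δ n ⟩) (ℚP.*-zeroʳ c)) (ℚP.+-identityˡ _)))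

  ≋⇒≈L : ∀ {p r} → p ≋ r → p ≈L r
  ≋⇒≈L {p} {r} p≋r n =
    ≡.trans (coeffL-pair p n) (≡.trans (pair p≋r (δ n) (≡.cong (δ n))) (≡.sym (coeffL-pair r n)))

  -- Isolating the lowest exponent is normalisation enough for the domain property; the remaining
  -- terms may repeat exponents or have zero coefficients.
  data LowestTerm (n : ℕ) (p : Laurent) : Set where
    vanishing : p ≋ [] → LowestTerm n p
    lowest : ∀ c e p′ → c ≢ 0ℚ → All (λ t → e ℤ.< proj₂ t) p′ → length p′ ℕ.< n → p ≋ (c , e) ∷ p′ → LowestTerm n p

  ∷-cong : ∀ t {p r} → p ≋ r → t ∷ p ≋ t ∷ r
  ∷-cong t = ++-cong {F = t ∷ []} ≋-refl

  ∷-zero : ∀ {c} e p → c ≡ 0ℚ → (c , e) ∷ p ≋ p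
  ∷-zero e p ≡.refl = pairwise (λ φ _ → ≡.trans (≡.cong (ℚ._+ ⟨ p , φ ⟩) (ℚP.*-zeroˡ (φ e))) (ℚP.+-identityˡ _))

  ∷-merge : ∀ c c′ e p → (c , e) ∷ (c′ , e) ∷ p ≋ (c ℚ.+ c′ , e) ∷ p
  ∷-merge c c′ e p = pairwise (λ φ _ →
    ≡.trans (≡.sym (ℚP.+-assoc (c ℚ.* φ e) _ _)) (≡.cong (ℚ._+ ⟨ p , φ ⟩) (≡.sym (ℚP.*-distribʳ-+ (φ e) c c′))))

  ∷-swap : ∀ s t p → s ∷ t ∷ p ≋ t ∷ s ∷ p
  ∷-swap s t p = ++-cong (++-comm (s ∷ []) (t ∷ [])) (≋-refl {p})

  -- The bound on the length allows the recursion to restart on q′ after the lowest terms cancel.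
  lowestTerm : ∀ n p → length p ℕ.≤ n → LowestTerm n p
  lowestTerm n [] _ = vanishing ≋-refl
  lowestTerm (suc n) ((c , e) ∷ q) (ℕ.s≤s q≤n) with c ℚ.≟ 0ℚ | lowestTerm n q q≤n
  ... | yes c≡0 | vanishing q≋0 = vanishing (≋-trans (∷-zero e q c≡0) q≋0)
  ... | yes c≡0 | lowest c′ e′ q′ c′≢0 e′< q′<n q≋ =
    lowest c′ e′ q′ c′≢0 e′< (ℕP.m<n⇒m<1+n q′<n) (≋-trans (∷-zero e q c≡0) q≋)
  ... | no c≢0 | vanishing q≋0 = lowest c e [] c≢0 [] (ℕ.s≤s ℕ.z≤n) (∷-cong (c , e) q≋0)
  ... | no c≢0 | lowest c′ e′ q′ c′≢0 e′< q′<n q≋ with ℤP.<-cmp e e′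
  ...   | tri< e<e′ _ _ = lowest c e ((c′ , e′) ∷ q′) c≢0 (e<e′ ∷ All.map (ℤP.<-trans e<e′) e′<) (ℕ.s≤s q′<n) (∷-cong (c , e) q≋)
  ...   | tri> _ _ e′<e = lowest c′ e′ ((c , e) ∷ q′) c′≢0 (e′<e ∷ e′<) (ℕ.s≤s q′<n)
                            (≋-trans (∷-cong (c , e) q≋) (∷-swap (c , e) (c′ , e′) q′))
  ...   | tri≈ _ ≡.refl _ with c ℚ.+ c′ ℚ.≟ 0ℚ
  ...     | no sum≢0 = lowest (c ℚ.+ c′) e q′ sum≢0 e′< (ℕP.m<n⇒m<1+n q′<n) (≋-trans (∷-cong (c , e) q≋) (∷-merge c c′ e q′))
  ...     | yes sum≡0 with lowestTerm n q′ (ℕP.<⇒≤ q′<n)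
  ...       | vanishing q′≋0 = vanishing (≋-trans cancelled q′≋0)
    where cancelled = ≋-trans (∷-cong (c , e) q≋) (≋-trans (∷-merge c c′ e q′) (∷-zero e q′ sum≡0))
  ...       | lowest c″ e″ q″ c″≢0 e″< q″<n q′≋ = lowest c″ e″ q″ c″≢0 e″< (ℕP.m<n⇒m<1+n q″<n) (≋-trans cancelled q′≋)
    where cancelled = ≋-trans (∷-cong (c , e) q≋) (≋-trans (∷-merge c c′ e q′) (∷-zero e q′ sum≡0))

  ℚ-domain : ∀ c c′ → c ≢ 0ℚ → c ℚ.* c′ ≡ 0ℚ → c′ ≡ 0ℚ
  ℚ-domain c c′ c≢0 cc′≡0 = begin
    c′                          ≡⟨ ℚP.*-identityˡ c′ ⟨
    1ℚ ℚ.* c′                   ≡⟨ ≡.cong (ℚ._* c′) (≡.sym (ℚP.*-inverseˡ c)) ⟩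
    (ℚ.1/ c) ℚ.* c ℚ.* c′       ≡⟨ ℚP.*-assoc (ℚ.1/ c) c c′ ⟩
    (ℚ.1/ c) ℚ.* (c ℚ.* c′)     ≡⟨ ≡.cong ((ℚ.1/ c) ℚ.*_) cc′≡0 ⟩
    (ℚ.1/ c) ℚ.* 0ℚ             ≡⟨ ℚP.*-zeroʳ (ℚ.1/ c) ⟩
    0ℚ                          ∎
    where instance _ = ℚ.≢-nonZero c≢0

  -- Any pair of terms other than the two lowest has total exponent above e + e′, so no other
  -- product reaches this exponent.
  lowest-product : ∀ c e p c′ e′ r → All (λ t → e ℤ.< proj₂ t) p → All (λ t → e′ ℤ.< proj₂ t) r →
    ⟨ ((c , e) ∷ p) ⊛ ((c′ , e′) ∷ r) , δ (e ℤ.+ e′) ⟩ ≡ c ℚ.* c′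
  lowest-product c e p c′ e′ r e< e′< = begin
    ⟨ ((c , e) ∷ p) ⊛ ((c′ , e′) ∷ r) , δ (e ℤ.+ e′) ⟩
      ≡⟨ pair-⊛ ((c , e) ∷ p) ((c′ , e′) ∷ r) (δ (e ℤ.+ e′)) ⟩
    c ℚ.* slice e ℚ.+ ⟨ p , slice ⟩
      ≡⟨ ≡.cong₂ (λ x y → c ℚ.* x ℚ.+ y) slice-e (pair-vanishes p (All.map (λ {t} → slice-above {t}) e<)) ⟩
    c ℚ.* c′ ℚ.+ 0ℚ
      ≡⟨ ℚP.+-identityʳ _ ⟩
    c ℚ.* c′ ∎
    where
    slice : ℤ → ℚ
    slice m = ⟨ (c′ , e′) ∷ r , (λ n → δ (e ℤ.+ e′) (m ℤ.+ n)) ⟩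

    slice-e : slice e ≡ c′
    slice-e = ≡.trans (≡.cong₂ (λ x y → c′ ℚ.* x ℚ.+ y) (δ-diagonal (e ℤ.+ e′))
        (pair-vanishes r (All.map (λ e′<n → δ-off (ℤP.+-monoʳ-< e e′<n)) e′<)))
      (≡.trans (ℚP.+-identityʳ _) (ℚP.*-identityʳ c′))

    slice-above : ∀ {t : ℚ × ℤ} → e ℤ.< proj₂ t → slice (proj₂ t) ≡ 0ℚ
    slice-above e<m = pair-vanishes ((c′ , e′) ∷ r)
      (δ-off (ℤP.+-monoˡ-< e′ e<m) ∷ All.map (λ e′<n → δ-off (ℤP.+-mono-< e<m e′<n)) e′<)

  -- `NonZeroL` speaks of coefficients while the conclusion is `≋`; lowest terms link the two. If d
  -- and x both have one, the product of their nonzero rational coefficients would be a nonzero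
  -- coefficient of the product.
  laurent-domain : ∀ d → NonZeroL d → ∀ x → d ⊛ x ≋ [] → x ≋ []
  laurent-domain d d-nz x dx≋0 with lowestTerm _ d ℕP.≤-refl | lowestTerm _ x ℕP.≤-refl
  ... | _ | vanishing x≋0 = x≋0
  ... | vanishing d≋0 | lowest _ _ _ _ _ _ _ = contradiction (≋⇒≈L d≋0) d-nz
  ... | lowest c e d′ c≢0 e< _ d≋ | lowest c′ e′ x′ c′≢0 e′< _ x≋ = contradiction (ℚ-domain c c′ c≢0 cc′≡0) c′≢0
    where
    cc′≡0 : c ℚ.* c′ ≡ 0ℚ
    cc′≡0 = ≡.trans (≡.sym (lowest-product c e d′ c′ e′ x′ e< e′<))
      (pair (≋-trans (≋-sym (⊛-cong d≋ x≋)) dx≋0) (δ (e ℤ.+ e′)) (≡.cong (δ (e ℤ.+ e′))))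

-- The field of scalars as a ring of fractions.

module LaurentFractions where
  open Laurents using (laurentRing; laurent-domain; ≋⇒≈L; _≋_)
  private
    module L = CommutativeRing laurentRing
  open Fractions laurentRing
  open RingProperties L.ring using (x[y-z]≈xy-xz; x∙y⁻¹≈ε⇒x≈y; x≈y⇒x∙y⁻¹≈ε)

  nonZero-cancellable : ∀ d → NonZeroL d → Cancellable d
  nonZero-cancellable d d-nz x y dx≈dy = x∙y⁻¹≈ε⇒x≈y x y (laurent-domain d d-nz (x L.- y)
    (L.trans (x[y-z]≈xy-xz d x y) (x≈y⇒x∙y⁻¹≈ε dx≈dy)))

  prodDen-cancellable : ∀ A → Cancellable (prodDen A)
  prodDen-cancellable [] = cancellable-1
  prodDen-cancellable ((d , d-nz) ∷ A) = cancellable-* {d} {prodDen A} (nonZero-cancellable d d-nz) (prodDen-cancellable A)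

  prodDen-++ : ∀ A B → prodDen (A ++ B) ≋ prodDen A *L prodDen B
  prodDen-++ [] B = L.sym (L.*-identityˡ (prodDen B))
  prodDen-++ ((d , _) ∷ A) B = L.trans (L.*-congˡ {d} (prodDen-++ A B)) (L.sym (L.*-assoc d (prodDen A) (prodDen B)))

  toFraction : K → Fraction
  toFraction x = fraction (num x) (prodDen (den x)) (prodDen-cancellable (den x))

  infix 4 _≃K_
  -- The cross-multiplication of `≈K`, with `≋` in place of the comparison of coefficients.
  record _≃K_ (x y : K) : Set where
    constructor equalFractions
    field toFraction-≃ : toFraction x ≃ toFraction y

  ≃K⇒≈K : ∀ {x y} → x ≃K y → x ≈K y
  ≃K⇒≈K (equalFractions (cross p)) = ≋⇒≈L p

  scalarRawRing : RawRing 0ℓ 0ℓ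
  scalarRawRing = record { Carrier = K ; _≈_ = _≃K_ ; _+_ = _+K_ ; _*_ = _*K_ ; -_ = -K_ ; 0# = 0K ; 1# = 1K }

  fractionRing : CommutativeRing 0ℓ 0ℓ
  fractionRing = record { isCommutativeRing = fractions-isCommutativeRing }

  private
    ≃-refl-den : ∀ n {A B} A-cancel B-cancel → B ≋ A → fraction n A A-cancel ≃ fraction n B B-cancel
    ≃-refl-den n _ _ B≋A = cross (L.*-congˡ {n} B≋A)

  -- Scalars concatenate lists of denominators while fractions multiply denominators. `prodDen-++`
  -- matches the two, so the ring laws of K are pulled back from fractions.
  toFraction-monomorphism : IsRingMonomorphism scalarRawRing (CommutativeRing.rawRing fractionRing) toFraction
  toFraction-monomorphism = record
    { isRingHomomorphism = record
      { isSemiringHomomorphism = record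
        { isNearSemiringHomomorphism = record
          { +-isMonoidHomomorphism = record
            { isMagmaHomomorphism = record
              { isRelHomomorphism = record { cong = _≃K_.toFraction-≃ }
              ; homo = λ x y → ≃-refl-den (num (x +K y)) _ _ (L.sym (prodDen-++ (den x) (den y))) }
            ; ε-homo = cross L.refl }
          ; *-homo = λ x y → ≃-refl-den (num (x *K y)) _ _ (L.sym (prodDen-++ (den x) (den y))) }
        ; 1#-homo = cross L.refl }
      ; -‿homo = λ x → cross L.refl }
    ; injective = equalFractions }

  scalarRing : CommutativeRing 0ℓ 0ℓ
  scalarRing = record { isCommutativeRing =
    RingMonomorphism.isCommutativeRing toFraction-monomorphism fractions-isCommutativeRing }

open LaurentFractions using (_≃K_; equalFractions; ≃K⇒≈K; scalarRing)

-- Natural numbers and their inverses in the rationals.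

natℚ : ℕ → ℚ
natℚ n = + n ℚ./ 1

natℚ-suc : ∀ n → natℚ (suc n) ≡ 1ℚ ℚ.+ natℚ n
natℚ-suc n = ℚP.toℚᵘ-injective (begin
  ℚ.toℚᵘ (natℚ (suc n))                   ≈⟨ ℚP.toℚᵘ-fromℚᵘ (ℚᵘ.mkℚᵘ (+ suc n) 0) ⟩
  ℚᵘ.mkℚᵘ (+ suc n) 0
    ≈⟨ ℚᵘ.*≡* (ℤR.solve 1 (λ n → (ℤR.con (+ 1) ℤR.:+ n) ℤR.:* ℤR.con (+ 1) ℤR.:=
                                               (ℤR.con (+ 1) ℤR.:* ℤR.con (+ 1) ℤR.:+ n ℤR.:* ℤR.con (+ 1)) ℤR.:* ℤR.con (+ 1)) ≡.refl (+ n)) ⟩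
  ℚᵘ.1ℚᵘ ℚᵘ.+ ℚᵘ.mkℚᵘ (+ n) 0              ≈⟨ ℚᵘP.+-cong ℚᵘP.≃-refl (ℚP.toℚᵘ-fromℚᵘ (ℚᵘ.mkℚᵘ (+ n) 0)) ⟨
  ℚ.toℚᵘ 1ℚ ℚᵘ.+ ℚ.toℚᵘ (natℚ n)           ≈⟨ ℚP.toℚᵘ-homo-+ 1ℚ (natℚ n) ⟨
  ℚ.toℚᵘ (1ℚ ℚ.+ natℚ n)                   ∎)
  where
  module ℤR = ℤS.+-*-Solver
  open SetoidReasoning ℚᵘP.≃-setoid

natℚ-inverse : ∀ n → natℚ (suc n) ℚ.* (+ 1 ℚ./ suc n) ≡ 1ℚ
natℚ-inverse n = ℚP.toℚᵘ-injective (begin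
  ℚ.toℚᵘ (natℚ (suc n) ℚ.* (+ 1 ℚ./ suc n))          ≈⟨ ℚP.toℚᵘ-homo-* (natℚ (suc n)) (+ 1 ℚ./ suc n) ⟩
  ℚ.toℚᵘ (natℚ (suc n)) ℚᵘ.* ℚ.toℚᵘ (+ 1 ℚ./ suc n)
    ≈⟨ ℚᵘP.*-cong (ℚP.toℚᵘ-fromℚᵘ (ℚᵘ.mkℚᵘ (+ suc n) 0)) (ℚP.toℚᵘ-fromℚᵘ (ℚᵘ.mkℚᵘ (+ 1) n)) ⟩
  ℚᵘ.mkℚᵘ (+ suc n) 0 ℚᵘ.* ℚᵘ.mkℚᵘ (+ 1) n            ≈⟨ ℚᵘP.*-inverseʳ (ℚᵘ.mkℚᵘ (+ suc n) 0) ⟩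
  ℚᵘ.1ℚᵘ                                             ∎)
  where open SetoidReasoning ℚᵘP.≃-setoid

-- Plethysm on scalars and the constants of the theorem.

module ScalarIdentities where
  open Laurents using (laurentRing; _≋_)
  private
    module L = CommutativeRing laurentRing
  open CommutativeRing scalarRing
  open RingIdentities scalarRing
  open Sums scalarRing using (_^^_)
  open SetoidReasoning setoid

  cross : ∀ {x y} → num x *L prodDen (den y) ≋ num y *L prodDen (den x) → x ≃K y
  cross p = equalFractions (Fractions.cross p)

  ι-cong : ∀ {p r} → p ≋ r → ι p ≃K ι r
  ι-cong {p} {r} p≋r = cross (L.*-congʳ {1L} {p} {r} p≋r)

  ι-+ : ∀ p r → ι (p +L r) ≃K ι p +K ι r
  ι-+ p r = ι-cong (L.sym (L.+-cong (L.*-identityʳ p) (L.*-identityʳ r)))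

  ιℚ-+ : ∀ x y → ιℚ (x ℚ.+ y) ≃K ιℚ x +K ιℚ y
  ιℚ-+ x y = trans (ι-cong (L.sym (Laurents.∷-merge x y (+ 0) []))) (ι-+ ((x , + 0) ∷ []) ((y , + 0) ∷ []))

  recip : ∀ d → NonZeroL d → K
  recip d d-nz = 1L ⁄ ((d , d-nz) ∷ [])

  recip-inverse : ∀ d d-nz → recip d d-nz *K ι d ≃K 1K
  recip-inverse d d-nz = cross (L.trans (L.*-identityʳ (1L *L d)) (L.*-congˡ {1L} (L.sym (L.*-identityʳ d))))

  fraction-recip : ∀ p d d-nz → p ⁄ ((d , d-nz) ∷ []) ≃K ι p *K recip d d-nz
  fraction-recip p d d-nz = cross (L.*-congʳ {d *L 1L} {p} {p *L 1L} (L.sym (L.*-identityʳ p)))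

  swap : ∀ x y z → x *K y *K z ≃K z *K y *K x
  swap x y z = trans (*-comm (x *K y) z) (trans (*-congˡ {z} (*-comm x y)) (sym (*-assoc z y x)))

  invK-inverse : ∀ x x-nz → x *K invK x x-nz ≃K 1K
  invK-inverse (a ⁄ A) a-nz = cross (L.trans (L.*-identityʳ (a *L prodDen A)) (L.trans (L.*-comm a (prodDen A))
    (L.trans (L.*-congˡ {prodDen A} (L.sym (L.*-identityʳ a)))
    (L.trans (L.sym (LaurentFractions.prodDen-++ A ((a , a-nz) ∷ []))) (L.sym (L.*-identityˡ (prodDen (A ++ (a , a-nz) ∷ []))))))))

  qK-+ : ∀ i j → qK (i ℤ.+ j) ≃K qK i *K qK j
  qK-+ i j = refl

  ι-oneMinusQ : ∀ m → ι (oneMinusQ m) ≃K 1K +K (-K qK m)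
  ι-oneMinusQ m = ι-+ 1L (-L qL m)

  ι-σL-oneMinusQ : ∀ k m → ι (σL (suc k) (oneMinusQ m)) ≃K 1K +K (-K (qK m ^^ suc k))
  ι-σL-oneMinusQ k m = begin
    ι (σL (suc k) (oneMinusQ m))
      ≡⟨ ≡.cong (λ e → ι ((1ℚ , e) ∷ (ℚ.- 1ℚ , + suc k ℤ.* m) ∷ [])) (ℤP.*-zeroʳ (+ suc k)) ⟩
    ι (oneMinusQ (+ suc k ℤ.* m))          ≈⟨ ι-oneMinusQ (+ suc k ℤ.* m) ⟩
    1K +K (-K qK (+ suc k ℤ.* m))          ≈⟨ +-congˡ {1K} (-‿cong (qK-^^ (suc k))) ⟩
    1K +K (-K (qK m ^^ suc k))             ∎
    where
    qK-^^ : ∀ n → qK (+ n ℤ.* m) ≃K qK m ^^ n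
    qK-^^ zero = refl
    qK-^^ (suc n) = begin
      qK (+ suc n ℤ.* m)           ≡⟨ ≡.cong qK (ℤP.suc-* (+ n) m) ⟩
      qK (m ℤ.+ + n ℤ.* m)         ≈⟨ qK-+ m (+ n ℤ.* m) ⟩
      qK m *K qK (+ n ℤ.* m)       ≈⟨ *-congˡ {qK m} (qK-^^ n) ⟩
      qK m *K qK m ^^ n            ∎

  -- This is an equality of lists: σ acts term by term, and both products list their terms in the
  -- same order.
  σL-* : ∀ k p r → σL k (p *L r) ≡ σL k p *L σL k r
  σL-* k [] r = ≡.refl
  σL-* k ((c , e) ∷ p) r = ≡.trans (LP.map-++ _ (map (λ s → (c ℚ.* proj₁ s , e ℤ.+ proj₂ s)) r) (p *L r))
    (≡.cong₂ _++_ (term r) (σL-* k p r))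
    where
    term : ∀ r → σL k (map (λ s → (c ℚ.* proj₁ s , e ℤ.+ proj₂ s)) r)
               ≡ map (λ s → (c ℚ.* proj₁ s , + k ℤ.* e ℤ.+ proj₂ s)) (σL k r)
    term [] = ≡.refl
    term ((d , f) ∷ r) = ≡.cong₂ _∷_ (≡.cong (_ ,_) (ℤP.*-distribˡ-+ (+ k) e f)) (term r)

  σK-* : ∀ k x y → σK k (x *K y) ≡ σK k x *K σK k y
  σK-* k (a ⁄ A) (b ⁄ B) = ≡.cong₂ _⁄_ (σL-* (suc k) a b) (LP.map-++ _ A B)

  private
    σ-denominator : ∀ m → ¬ m ≡ + 0 → ∀ k → NonZeroL (σL (suc k) (oneMinusQ m))
    σ-denominator m m≢0 k = σL-nz k (oneMinusQ m) (oneMinusQ-nz m m≢0)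

  m⁻¹K : ℕ → K
  m⁻¹K k = recip (σL (suc k) (oneMinusQ (ℤ.- + 1))) (σ-denominator (ℤ.- + 1) (λ ()) k)

  m⁻¹K-inverse : ∀ k → m⁻¹K k *K (1K +K (-K (qK (ℤ.- + 1) ^^ suc k))) ≃K 1K
  m⁻¹K-inverse k = trans (*-congˡ {m⁻¹K k} (sym (ι-σL-oneMinusQ k (ℤ.- + 1))))
    (recip-inverse (σL (suc k) (oneMinusQ (ℤ.- + 1))) (σ-denominator (ℤ.- + 1) (λ ()) k))

  σK-bracketT : ∀ k u → σK k (bracketT u) ≃K m⁻¹K k *K (1K +K (-K (qK (ℤ.- u) ^^ suc k)))
  σK-bracketT k u = begin
    σK k (bracketT u)
      ≈⟨ fraction-recip (σL (suc k) (oneMinusQ (ℤ.- u))) _ (σ-denominator (ℤ.- + 1) (λ ()) k) ⟩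
    ι (σL (suc k) (oneMinusQ (ℤ.- u))) *K m⁻¹K k      ≈⟨ *-comm (ι (σL (suc k) (oneMinusQ (ℤ.- u)))) (m⁻¹K k) ⟩
    m⁻¹K k *K ι (σL (suc k) (oneMinusQ (ℤ.- u)))      ≈⟨ *-congˡ {m⁻¹K k} (ι-σL-oneMinusQ k (ℤ.- u)) ⟩
    m⁻¹K k *K (1K +K (-K (qK (ℤ.- u) ^^ suc k)))      ∎

  σK-Mk-bracketQ : ∀ k u → σK k (Mk *K bracketQ u) ≃K
    (1K +K (-K (qK (ℤ.- + 1) ^^ suc k))) *K (1K +K (-K (qK u ^^ suc k)))
  σK-Mk-bracketQ k u = begin
    σK k (Mk *K bracketQ u)
      ≡⟨ ≡.trans (σK-* k Mk (bracketQ u)) (≡.cong (_*K σK k (bracketQ u)) (σK-* k (ι (oneMinusQ (ℤ.- + 1))) (ι (oneMinusQ (+ 1))))) ⟩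
    ι n₋ *K ι n₁ *K σK k (bracketQ u)
      ≈⟨ *-congˡ {ι n₋ *K ι n₁} {σK k (bracketQ u)} {ι nᵤ *K recip n₁ n₁-nz} (fraction-recip nᵤ n₁ n₁-nz) ⟩
    ι n₋ *K ι n₁ *K (ι nᵤ *K recip n₁ n₁-nz)
      ≈⟨ cancel-reciprocal (ι n₋) (ι n₁) (ι nᵤ) (recip n₁ n₁-nz) (recip-inverse n₁ n₁-nz) ⟩
    ι n₋ *K ι nᵤ
      ≈⟨ *-cong {ι n₋} {_} {ι nᵤ} (ι-σL-oneMinusQ k (ℤ.- + 1)) (ι-σL-oneMinusQ k u) ⟩
    (1K +K (-K (qK (ℤ.- + 1) ^^ suc k))) *K (1K +K (-K (qK u ^^ suc k))) ∎
    where
    n₋ n₁ nᵤ : Laurent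
    n₋ = σL (suc k) (oneMinusQ (ℤ.- + 1))
    n₁ = σL (suc k) (oneMinusQ (+ 1))
    nᵤ = σL (suc k) (oneMinusQ u)
    n₁-nz : NonZeroL n₁
    n₁-nz = σ-denominator (+ 1) (λ ()) k

  module _ (a b c d : ℤ) (hu : ¬ (a ℤ.+ c ≡ + 0)) where
    private
      o₁-nz : NonZeroL (oneMinusQ (+ 1))
      o₁-nz = oneMinusQ-nz (+ 1) (λ ())
      r x q : K
      r = recip (oneMinusQ (+ 1)) o₁-nz
      x = invK (bracketQ (a ℤ.+ c)) (bracketQ-nz (a ℤ.+ c) hu)
      q = qK (+ 1)

      bracketQ-recip : ∀ u → bracketQ u ≃K (1K +K (-K qK u)) *K r
      bracketQ-recip u = trans (fraction-recip (oneMinusQ u) (oneMinusQ (+ 1)) o₁-nz)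
        (*-congʳ {r} {ι (oneMinusQ u)} (ι-oneMinusQ u))

    -- Built as 1/[a+c]_q times 1/(1-q), so that the inverse of [a+c]_q in the theorem occurs in it
    -- literally.
    ε : K
    ε = x *K r

    ε-inverse : ε *K (1K +K (-K qK (a ℤ.+ c))) ≃K 1K
    ε-inverse = trans (swap x r (1K +K (-K qK (a ℤ.+ c))))
      (trans (*-congʳ {x} {(1K +K (-K qK (a ℤ.+ c))) *K r} {bracketQ (a ℤ.+ c)} (sym (bracketQ-recip (a ℤ.+ c))))
        (invK-inverse (bracketQ (a ℤ.+ c)) (bracketQ-nz (a ℤ.+ c) hu)))

    scalar-identity :
      invK Mk Mk-nz *K ((1K +K (-K qK a)) *K (1K +K (-K qK c)) *K ε *K (qK (a ℤ.* d) +K (-K qK (c ℤ.* b))))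
        ≃K
      (qK (+ 1 ℤ.+ b ℤ.* c) *K bracketQ a *K bracketQ c *K x)
        *K ι (oneMinusQ (d ℤ.* a ℤ.- b ℤ.* c)) *K invK (ι (oneMinusQ (+ 1))) (oneMinusQ-nz (+ 1) (λ ()))
    scalar-identity = trans lhs (trans
      (structure-normalisation q (qK (ℤ.- + 1)) r w m x A C N L refl r≈ w≈ m≈)
      (sym rhs))
      where
      w m A C N L : K
      w = invK (ι (oneMinusQ (+ 1))) (oneMinusQ-nz (+ 1) (λ ()))
      m = invK Mk Mk-nz
      A = 1K +K (-K qK a)
      C = 1K +K (-K qK c)
      N = qK (b ℤ.* c)
      L = qK (d ℤ.* a ℤ.- b ℤ.* c)

      r≈ : r *K (1K +K (-K q)) ≃K 1K
      r≈ = trans (*-congˡ {r} (sym (ι-oneMinusQ (+ 1)))) (recip-inverse (oneMinusQ (+ 1)) o₁-nz)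

      w≈ : (1K +K (-K q)) *K w ≃K 1K
      w≈ = trans (*-congʳ {w} (sym (ι-oneMinusQ (+ 1)))) (invK-inverse (ι (oneMinusQ (+ 1))) (oneMinusQ-nz (+ 1) (λ ())))

      m≈ : (1K +K (-K qK (ℤ.- + 1))) *K (1K +K (-K q)) *K m ≃K 1K
      m≈ = trans (*-congʳ {m} (sym (*-cong (ι-oneMinusQ (ℤ.- + 1)) (ι-oneMinusQ (+ 1))))) (invK-inverse Mk Mk-nz)

      NL : qK (a ℤ.* d) ≃K N *K L
      NL = trans (reflexive (≡.cong qK (ℤR.solve 4 (λ a b c d → a ℤR.:* d
          ℤR.:= b ℤR.:* c ℤR.:+ (d ℤR.:* a ℤR.:- b ℤR.:* c)) ≡.refl a b c d)))
        (qK-+ (b ℤ.* c) (d ℤ.* a ℤ.- b ℤ.* c))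
        where module ℤR = ℤS.+-*-Solver

      lhs : m *K (A *K C *K ε *K (qK (a ℤ.* d) +K (-K qK (c ℤ.* b)))) ≃K m *K (A *K C *K ε *K (N *K L +K (-K N)))
      lhs = *-congˡ {m} (*-congˡ {A *K C *K ε} (+-cong NL (-‿cong (reflexive (≡.cong qK (ℤP.*-comm c b))))))

      rhs : (qK (+ 1 ℤ.+ b ℤ.* c) *K bracketQ a *K bracketQ c *K x) *K ι (oneMinusQ (d ℤ.* a ℤ.- b ℤ.* c)) *K w
              ≃K q *K N *K (A *K r) *K (C *K r) *K x *K (1K +K (-K L)) *K w
      rhs = *-congʳ {w} (*-cong
        (*-congʳ {x} (*-cong (*-cong (qK-+ (+ 1) (b ℤ.* c)) (bracketQ-recip a)) (bracketQ-recip c)))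
        (ι-oneMinusQ (d ℤ.* a ℤ.- b ℤ.* c)))

-- Symmetric functions as the monoid algebra of power-sum monomials.

module PowerSums where
  open FormalSums scalarRing (PermP.++-commutativeMonoid {A = ℕ}) public
  open FormalSumMaps scalarRing (PermP.++-commutativeMonoid {A = ℕ}) public

  Λ-ring : CommutativeRing 0ℓ 0ℓ
  Λ-ring = formalSums-commutativeRing

  private
    module 𝕂 = CommutativeRing scalarRing

  insert-≤ : ∀ {x y} l → x ℕ.≤ y → insert x (y ∷ l) ≡ x ∷ y ∷ l
  insert-≤ {x} {y} l x≤y with x ℕ.≤? y
  ... | yes _ = ≡.refl
  ... | no x≰y = contradiction x≤y x≰y

  insert-> : ∀ {x y} l → y ℕ.< x → insert x (y ∷ l) ≡ y ∷ insert x l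
  insert-> {x} {y} l y<x with x ℕ.≤? y
  ... | yes x≤y = contradiction y<x (ℕP.≤⇒≯ x≤y)
  ... | no _ = ≡.refl

  insert-insert-< : ∀ {x y} l → x ℕ.< y → insert x (insert y l) ≡ insert y (insert x l)
  insert-insert-< [] x<y = ≡.trans (insert-≤ [] (ℕP.<⇒≤ x<y)) (≡.sym (insert-> [] x<y))
  insert-insert-< {x} {y} (z ∷ l) x<y with ℕP.≤-<-connex y z | ℕP.≤-<-connex x z
  ... | inj₁ y≤z | _
    rewrite insert-≤ l y≤z | insert-≤ l (ℕP.≤-trans (ℕP.<⇒≤ x<y) y≤z) | insert-≤ (z ∷ l) (ℕP.<⇒≤ x<y)
          | insert-> (z ∷ l) x<y | insert-≤ l y≤z = ≡.refl
  ... | inj₂ z<y | inj₁ x≤z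
    rewrite insert-> l z<y | insert-≤ l x≤z | insert-≤ (insert y l) x≤z
          | insert-> (z ∷ l) x<y | insert-> l z<y = ≡.refl
  ... | inj₂ z<y | inj₂ z<x
    rewrite insert-> l z<y | insert-> l z<x | insert-> (insert y l) z<x | insert-> (insert x l) z<y =
    ≡.cong (z ∷_) (insert-insert-< l x<y)

  insert-insert : ∀ x y l → insert x (insert y l) ≡ insert y (insert x l)
  insert-insert x y l with ℕP.<-cmp x y
  ... | tri< x<y _ _ = insert-insert-< l x<y
  ... | tri≈ _ ≡.refl _ = ≡.refl
  ... | tri> _ _ y<x = ≡.sym (insert-insert-< l y<x)

  -- Two insertions commute, hence sorting forgets the order. `coeffΛ` sorts before it compares, so
  -- it is a pairing with a function that respects reordering.
  sort-↭ : ∀ {μ ν} → μ ↭ ν → sort μ ≡ sort ν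
  sort-↭ Perm.refl = ≡.refl
  sort-↭ (Perm.prep x p) = ≡.cong (insert x) (sort-↭ p)
  sort-↭ (Perm.swap {xs} {ys} x y p) = ≡.trans (insert-insert x y (sort xs)) (≡.cong (λ l → insert y (insert x l)) (sort-↭ p))
  sort-↭ (Perm.trans p q) = ≡.trans (sort-↭ p) (sort-↭ q)

  indicator : List ℕ → List ℕ → K
  indicator lam l with LP.≡-dec ℕ._≟_ l lam
  ... | yes _ = 1K
  ... | no  _ = 0K

  δ : List ℕ → List ℕ → K
  δ lam μ = indicator lam (sort μ)

  δ-cong : ∀ lam → Congruent (δ lam)
  δ-cong lam μ↭ν = 𝕂.reflexive (≡.cong (indicator lam) (sort-↭ μ↭ν))

  coeffΛ-pair : ∀ F lam → coeffΛ F lam ≃K ⟨ F , δ lam ⟩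
  coeffΛ-pair [] lam = 𝕂.refl
  coeffΛ-pair ((c , μ) ∷ F) lam with LP.≡-dec ℕ._≟_ (sort μ) lam
  ... | yes _ = 𝕂.+-cong (𝕂.sym (𝕂.*-identityʳ c)) (coeffΛ-pair F lam)
  ... | no  _ = 𝕂.trans (coeffΛ-pair F lam) (𝕂.sym (𝕂.trans (𝕂.+-congʳ {⟨ F , δ lam ⟩} (𝕂.zeroʳ c)) (𝕂.+-identityˡ ⟨ F , δ lam ⟩)))

  ≋⇒≈Λ : ∀ {F G} → F ≋ G → F ≈Λ G
  ≋⇒≈Λ {F} {G} F≋G lam = ≃K⇒≈K
    (𝕂.trans (coeffΛ-pair F lam) (𝕂.trans (pair F≋G (δ lam) (δ-cong lam)) (𝕂.sym (coeffΛ-pair G lam))))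

-- The series Ω and its derivative equation.

module ExponentialSeries where
  open PowerSums
  private
    module 𝕂 = CommutativeRing scalarRing
    module Λ = CommutativeRing Λ-ring
  open IntegerCoefficients Λ-ring using () renaming (num to numΛ)
  open Sums Λ-ring
  open Exponential Λ-ring
  open RingIdentities Λ-ring using (cancel-unit; cancel-neg)
  open SetoidReasoning Λ.setoid

  num-embed : ∀ n → numΛ n ≋ embed (ιℚ (natℚ n))
  num-embed zero = ≋-sym (≋-trans (embed-cong (ScalarIdentities.ι-cong (Laurents.∷-zero (+ 0) [] ≡.refl))) embed-0)
  num-embed (suc n) = begin
    1Λ ++ numΛ n                                ≈⟨ ++-cong {1Λ} ≋-refl (num-embed n) ⟩
    embed 1K ++ embed (ιℚ (natℚ n))            ≈⟨ embed-+ 1K (ιℚ (natℚ n)) ⟨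
    embed (1K +K ιℚ (natℚ n))                  ≈⟨ embed-cong (ScalarIdentities.ιℚ-+ 1ℚ (natℚ n)) ⟨
    embed (ιℚ (1ℚ ℚ.+ natℚ n))                 ≡⟨ ≡.cong (λ x → embed (ιℚ x)) (≡.sym (natℚ-suc n)) ⟩
    embed (ιℚ (natℚ (suc n)))                  ∎

  embed-ιℚ-* : ∀ x y → embed (ιℚ (x ℚ.* y)) ≋ embed (ιℚ x) ⊛ embed (ιℚ y)
  embed-ιℚ-* x y = embed-* (ιℚ x) (ιℚ y)

  num-inverse : ∀ n → embed (ιℚ (+ 1 ℚ./ suc n)) ⊛ numΛ (suc n) ≋ 1Λ
  num-inverse n = begin
    embed (ιℚ (+ 1 ℚ./ suc n)) ⊛ numΛ (suc n)
      ≈⟨ Λ.*-congˡ {embed (ιℚ (+ 1 ℚ./ suc n))} (num-embed (suc n)) ⟩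
    embed (ιℚ (+ 1 ℚ./ suc n)) ⊛ embed (ιℚ (natℚ (suc n)))    ≈⟨ embed-ιℚ-* (+ 1 ℚ./ suc n) (natℚ (suc n)) ⟨
    embed (ιℚ ((+ 1 ℚ./ suc n) ℚ.* natℚ (suc n)))             ≡⟨ ≡.cong (λ x → embed (ιℚ x)) 
           (≡.trans (ℚP.*-comm (+ 1 ℚ./ suc n) (natℚ (suc n))) (natℚ-inverse n)) ⟩
    1Λ                                                        ∎

  num-cancel : NumCancel
  num-cancel n x y = cancel-unit (embed (ιℚ (+ 1 ℚ./ suc n))) (numΛ (suc n)) x y (num-inverse n)

  inv! : Seq
  inv! j = embed (ιℚ (invFact j))

  inv!-suc : ∀ j → numΛ (suc j) ⊛ inv! (suc j) ≋ inv! j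
  inv!-suc j = begin
    numΛ (suc j) ⊛ inv! (suc j)                              ≈⟨ Λ.*-congʳ {inv! (suc j)} (num-embed (suc j)) ⟩
    embed (ιℚ (natℚ (suc j))) ⊛ inv! (suc j)                ≈⟨ embed-ιℚ-* (natℚ (suc j)) (invFact (suc j)) ⟨
    embed (ιℚ (natℚ (suc j) ℚ.* invFact (suc j)))           ≡⟨ ≡.cong (λ x → embed (ιℚ x)) rational ⟩
    inv! j                                                  ∎
    where
    rational : natℚ (suc j) ℚ.* (invFact j ℚ.* (+ 1 ℚ./ suc j)) ≡ invFact j
    rational = ≡.trans (≡.cong (natℚ (suc j) ℚ.*_) (ℚP.*-comm (invFact j) _))
      (≡.trans (≡.sym (ℚP.*-assoc (natℚ (suc j)) (+ 1 ℚ./ suc j) (invFact j)))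
      (≡.trans (≡.cong (ℚ._* invFact j) (natℚ-inverse j)) (ℚP.*-identityˡ (invFact j))))

  -- The function g is arbitrary because unfolding `applyUpTo` composes it with `suc`.
  foldr-upTo : ∀ n (g : ℕ → ℕ) (f : ℕ → Λ) → foldr (λ i acc → f i +Λ acc) [] (applyUpTo g n) ≡ sum n (λ i → f (g i))
  foldr-upTo zero g f = ≡.refl
  foldr-upTo (suc n) g f = ≡.cong (f (g 0) ++_) (foldr-upTo n (λ i → g (suc i)) f)

  sumTo-sum : ∀ r f → sumTo r f ≡ sum (suc r) f
  sumTo-sum r f = foldr-upTo (suc r) (λ i → i) f

  mulS-⋆ : ∀ A B → mulS A B ≗ A ⋆ B
  mulS-⋆ A B r = ≋-trans (Λ.reflexive (sumTo-sum r (λ i → A i *Λ B (r ℕ.∸ i)))) (sum-∸ r (λ i j → A i *Λ B j))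

  powS-power : ∀ A j → powS A j ≗ power A j
  powS-power A zero zero = ≋-refl
  powS-power A zero (suc n) = ≋-refl
  powS-power A (suc j) n = ≋-trans (mulS-⋆ A (powS A j) n) (⋆-cong {A} (λ _ → ≋-refl) (powS-power A j) n)

  module _ (A : Series) (A-0 : A 0 ≋ []) where
    expS-exponential : expS A ≗ exponential A A-0 inv! inv!-suc
    expS-exponential r = ≋-trans (Λ.reflexive (sumTo-sum r (λ j → ιℚ (invFact j) ·Λ powS A j r)))
      (sum-cong (suc r) {λ j → ιℚ (invFact j) ·Λ powS A j r} {λ j → inv! j *Λ power A j r} (λ j _ →
        ≋-trans (scale-embed (ιℚ (invFact j)) (powS A j r)) (Λ.*-congˡ {inv! j} (powS-power A j r))))

    θ-expS : θ (expS A) ≗ θ A ⋆ expS A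
    θ-expS n = begin
      θ (expS A) n                                        ≈⟨ θ-cong {expS A} expS-exponential n ⟩
      θ (exponential A A-0 inv! inv!-suc) n               ≈⟨ θ-exponential A A-0 inv! inv!-suc n ⟩
      (θ A ⋆ exponential A A-0 inv! inv!-suc) n
        ≈⟨ ⋆-cong {θ A} (λ _ → ≋-refl) (λ k → ≋-sym (expS-exponential k)) n ⟩
      (θ A ⋆ expS A) n                                    ∎

    expS-0 : expS A 0 ≋ 1Λ
    expS-0 = ≋-trans (expS-exponential 0) (Λ.trans (Λ.+-identityʳ (1Λ *Λ 1Λ)) (Λ.*-identityˡ 1Λ))

  -- The derivation multiplies degree k + 1 by k + 1, which cancels the denominator of
  -- p_{k+1}/(k+1).
  θ-logΩ : ∀ C → θ (logΩnegzCX C) ≗ delay (λ k → negate (embed (σK k C) ⊛ pΛ k))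
  θ-logΩ C zero = Λ.zeroˡ []
  θ-logΩ C (suc k) = begin
    numΛ (suc k) ⊛ (((-K σK k C) *K ιℚ i) ·Λ pΛ k)
      ≈⟨ Λ.*-congˡ {numΛ (suc k)} (scale-embed ((-K σK k C) *K ιℚ i) (pΛ k)) ⟩
    numΛ (suc k) ⊛ (embed ((-K σK k C) *K ιℚ i) ⊛ pΛ k)
      ≈⟨ Λ.*-congˡ {numΛ (suc k)} (⊛-congʳ (pΛ k) (embed-* (-K σK k C) (ιℚ i))) ⟩
    numΛ (suc k) ⊛ ((negate (embed (σK k C)) ⊛ embed (ιℚ i)) ⊛ pΛ k)
      ≈⟨ cancel-neg (embed (ιℚ i)) (numΛ (suc k)) (embed (σK k C)) (pΛ k) (num-inverse k) ⟩
    negate (embed (σK k C) ⊛ pΛ k) ∎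
    where i = + 1 ℚ./ suc k

-- The operators `D` as an operator family, and the commutator relation.

module PlethysticOperators where
  open PowerSums
  open ExponentialSeries using (num-cancel; θ-expS; expS-0; θ-logΩ)
  open ScalarIdentities
  private
    module 𝕂 = CommutativeRing scalarRing
    module Λ = CommutativeRing Λ-ring
  open Sums scalarRing using () renaming (_^^_ to _^K_)
  open Sums Λ-ring
  open SetoidReasoning Λ.setoid

  E : ℤ → Series
  E u = ΩnegzCX (bracketT u)

  C : ℤ → K
  C u = Mk *K bracketQ u

  shiftedMonomial : K → List ℕ → ZInv
  shiftedMonomial C = foldr (λ k acc → mulZ (pShift C k) acc) ((0 , 1Λ) ∷ [])

  image : ℤ → ℤ → List ℕ → Λ
  image u v μ = extract (coeffZ (E u)) v (shiftedMonomial (C u) μ)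

  image-∷ : ∀ u v k μ → image u v (k ∷ μ) ≋ pΛ k ⊛ image u v μ ++ embed (σK k (C u)) ⊛ image u (v ℤ.+ + suc k) μ
  image-∷ u v k μ = begin
    extract (coeffZ (E u)) v (map p-part P ++ (map z-part P ++ []))
      ≡⟨ ≡.cong (λ L → extract (coeffZ (E u)) v (map p-part P ++ L)) (LP.++-identityʳ (map z-part P)) ⟩
    extract (coeffZ (E u)) v (map p-part P ++ map z-part P)
      ≡⟨ LP.concatMap-++ _ (map p-part P) (map z-part P) ⟩
    extract (coeffZ (E u)) v (map p-part P) ++ extract (coeffZ (E u)) v (map z-part P)
      ≈⟨ ++-cong (extract-shift (coeffZ (E u)) v 0 (pΛ k) P) (extract-shift (coeffZ (E u)) v (suc k) (σK k (C u) ·Λ 1Λ) P) ⟩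
    pΛ k ⊛ extract (coeffZ (E u)) (v ℤ.+ + 0) P ++ (σK k (C u) ·Λ 1Λ) ⊛ image u (v ℤ.+ + suc k) μ
      ≈⟨ ++-cong (Λ.reflexive (≡.cong (λ w → pΛ k ⊛ extract (coeffZ (E u)) w P) (ℤP.+-identityʳ v)))
           (⊛-congʳ (image u (v ℤ.+ + suc k) μ) (embed-cong (𝕂.*-identityʳ (σK k (C u))))) ⟩
    pΛ k ⊛ image u v μ ++ embed (σK k (C u)) ⊛ image u (v ℤ.+ + suc k) μ ∎
    where
    P = shiftedMonomial (C u) μ
    p-part z-part : ℕ × Λ → ℕ × Λ
    p-part s = (proj₁ s , pΛ k *Λ proj₂ s)
    z-part s = (suc k ℕ.+ proj₁ s , (σK k (C u) ·Λ 1Λ) *Λ proj₂ s)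

  image-∷∷ : ∀ u v x y μ → image u v (x ∷ y ∷ μ) ≋
    pΛ x ⊛ (pΛ y ⊛ image u v μ ++ embed (σK y (C u)) ⊛ image u (v ℤ.+ + suc y) μ)
      ++ embed (σK x (C u)) ⊛ (pΛ y ⊛ image u (v ℤ.+ + suc x) μ ++ embed (σK y (C u)) ⊛ image u (v ℤ.+ + suc x ℤ.+ + suc y) μ)
  image-∷∷ u v x y μ = ≋-trans (image-∷ u v x (y ∷ μ))
    (++-cong (Λ.*-congˡ {pΛ x} (image-∷ u v y μ)) (Λ.*-congˡ {embed (σK x (C u))} (image-∷ u (v ℤ.+ + suc x) y μ)))

  image-∷-cong : ∀ u k μ ν → (∀ v → image u v μ ≋ image u v ν) → ∀ v → image u v (k ∷ μ) ≋ image u v (k ∷ ν)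
  image-∷-cong u k μ ν μ≋ν v = ≋-trans (image-∷ u v k μ) (≋-trans
    (++-cong (Λ.*-congˡ {pΛ k} (μ≋ν v)) (Λ.*-congˡ {embed (σK k (C u))} (μ≋ν (v ℤ.+ + suc k))))
    (≋-sym (image-∷ u v k ν)))

  -- `Extends` needs a function of monomials up to reordering, while `shiftedMonomial` is built
  -- along a list. By `image-∷` each factor acts by a twisted multiplication, and two of these
  -- commute because their shifts of v add.
  image-↭ : ∀ u v {μ ν} → μ ↭ ν → image u v μ ≋ image u v ν
  image-↭ u v Perm.refl = ≋-refl
  image-↭ u v (Perm.prep {xs} {ys} k p) = image-∷-cong u k xs ys (λ w → image-↭ u w p) v
  image-↭ u v (Perm.swap {xs} {ys} x y p) = begin
    image u v (x ∷ y ∷ xs)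
      ≈⟨ image-∷∷ u v x y xs ⟩
    pΛ x ⊛ (pΛ y ⊛ image u v xs ++ t ⊛ image u (v ℤ.+ + suc y) xs)
      ++ s ⊛ (pΛ y ⊛ image u (v ℤ.+ + suc x) xs ++ t ⊛ image u (v ℤ.+ + suc x ℤ.+ + suc y) xs)
      ≈⟨ RingIdentities.twist-swap Λ-ring (pΛ x) s (pΛ y) t (image u v xs) (image u (v ℤ.+ + suc y) xs)
           (image u (v ℤ.+ + suc x) xs) (image u (v ℤ.+ + suc x ℤ.+ + suc y) xs) ⟩
    pΛ y ⊛ (pΛ x ⊛ image u v xs ++ s ⊛ image u (v ℤ.+ + suc x) xs)
      ++ t ⊛ (pΛ x ⊛ image u (v ℤ.+ + suc y) xs ++ s ⊛ image u (v ℤ.+ + suc x ℤ.+ + suc y) xs)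
      ≡⟨ ≡.cong (λ w → pΛ y ⊛ (pΛ x ⊛ image u v xs ++ s ⊛ image u (v ℤ.+ + suc x) xs)
                        ++ t ⊛ (pΛ x ⊛ image u (v ℤ.+ + suc y) xs ++ s ⊛ image u w xs)) shuffle ⟩
    pΛ y ⊛ (pΛ x ⊛ image u v xs ++ s ⊛ image u (v ℤ.+ + suc x) xs)
      ++ t ⊛ (pΛ x ⊛ image u (v ℤ.+ + suc y) xs ++ s ⊛ image u (v ℤ.+ + suc y ℤ.+ + suc x) xs)
      ≈⟨ image-∷∷ u v y x xs ⟨
    image u v (y ∷ x ∷ xs)
      ≈⟨ image-∷-cong u y (x ∷ xs) (x ∷ ys) (image-∷-cong u x xs ys (λ w → image-↭ u w p)) v ⟩
    image u v (y ∷ x ∷ ys) ∎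
    where
    s = embed (σK x (C u))
    t = embed (σK y (C u))
    shuffle : v ℤ.+ + suc x ℤ.+ + suc y ≡ v ℤ.+ + suc y ℤ.+ + suc x
    shuffle = ≡.trans (ℤP.+-assoc v (+ suc x) (+ suc y))
      (≡.trans (≡.cong (λ w → v ℤ.+ w) (ℤP.+-comm (+ suc x) (+ suc y))) (≡.sym (ℤP.+-assoc v (+ suc y) (+ suc x))))
  image-↭ u v (Perm.trans p q) = ≋-trans (image-↭ u v p) (image-↭ u v q)

  D-∷ : ∀ u v c μ F → D u v ((c , μ) ∷ F) ≋ embed c ⊛ image u v μ ++ D u v F
  D-∷ u v c μ F = ≋-trans
    (Λ.reflexive (LP.concatMap-++ _ (map (λ s → (proj₁ s , c ·Λ proj₂ s)) (shiftedMonomial (C u) μ)) (plethShift (C u) F)))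
    (++-cong (extract-scale (coeffZ (E u)) v c (shiftedMonomial (C u) μ)) (≋-refl {D u v F}))

  D-extends : ∀ u v → Extends (D u v) (image u v)
  D-extends u v = record { f-cong = image-↭ u v ; pair-T = pair-D }
    where
    pair-D : ∀ F {φ} → Congruent φ → ⟨ D u v F , φ ⟩ ≃K ⟨ F , (λ μ → ⟨ image u v μ , φ ⟩) ⟩
    pair-D [] _ = 𝕂.refl
    pair-D ((c , μ) ∷ F) {φ} φ-cong = 𝕂.trans (pair (D-∷ u v c μ F) φ φ-cong)
      (𝕂.trans (pair-++ (embed c ⊛ image u v μ) (D u v F) φ)
        (𝕂.+-cong (pair-embed c (image u v μ) φ-cong) (pair-D F φ-cong)))

  τ-embed : ∀ u k → embed (σK k (bracketT u)) ≋ embed (m⁻¹K k) ⊛ (1Λ ++ negate (embed (qK (ℤ.- u)) ^^ suc k))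
  τ-embed u k = ≋-trans (embed-cong (σK-bracketT k u)) (≋-trans (embed-* (m⁻¹K k) (1K +K (-K (qK (ℤ.- u) ^K suc k))))
    (Λ.*-congˡ {embed (m⁻¹K k)} (embed-1-^^ (qK (ℤ.- u)) (suc k))))

  α-embed : ∀ u k → embed (σK k (C u)) ≋
    (1Λ ++ negate (embed (qK (ℤ.- + 1)) ^^ suc k)) ⊛ (1Λ ++ negate (embed (qK u) ^^ suc k))
  α-embed u k = ≋-trans (embed-cong (σK-Mk-bracketQ k u))
    (≋-trans (embed-* (1K +K (-K (qK (ℤ.- + 1) ^K suc k))) (1K +K (-K (qK u ^K suc k))))
      (⊛-cong (embed-1-^^ (qK (ℤ.- + 1)) (suc k)) (embed-1-^^ (qK u) (suc k))))

  m⁻¹-inverse : ∀ k → embed (m⁻¹K k) ⊛ (1Λ ++ negate (embed (qK (ℤ.- + 1)) ^^ suc k)) ≋ 1Λ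
  m⁻¹-inverse k = ≋-trans (Λ.*-congˡ {embed (m⁻¹K k)} (≋-sym (embed-1-^^ (qK (ℤ.- + 1)) (suc k))))
    (≋-trans (≋-sym (embed-* (m⁻¹K k) (1K +K (-K (qK (ℤ.- + 1) ^K suc k))))) (embed-cong (m⁻¹K-inverse k)))

  θ-E : ∀ u → θ (E u) ≗ delay (λ k → negate ((embed (m⁻¹K k) ⊛ (1Λ ++ negate (embed (qK (ℤ.- u)) ^^ suc k))) ⊛ pΛ k)) ⋆ E u
  θ-E u n = ≋-trans (θ-expS (logΩnegzCX (bracketT u)) ≋-refl n)
    (⋆-cong {g = E u} log-derivative (λ _ → ≋-refl) n)
    where
    log-derivative : θ (logΩnegzCX (bracketT u)) ≗ delay (λ k → negate ((embed (m⁻¹K k) ⊛ (1Λ ++ negate (embed (qK (ℤ.- u)) ^^ suc k))) ⊛ pΛ k))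
    log-derivative zero = θ-logΩ (bracketT u) zero
    log-derivative (suc k) = ≋-trans (θ-logΩ (bracketT u) (suc k)) (negate-cong (⊛-congʳ (pΛ k) (τ-embed u k)))

  -- The fields `D-τ` and `D-α` name their scalars by ring expressions in Λ. Linearity is available
  -- for embedded coefficients, so s is first replaced by an equal `embed c`.
  scalar-commutes : ∀ u v {c s} x → embed c ≋ s → D u v (s ⊛ x) ≋ s ⊛ D u v x
  scalar-commutes u v {c} {s} x c≋s = ≋-trans (T-cong (⊛-congʳ x (≋-sym c≋s)))
    (≋-trans (T-embed c x) (⊛-congʳ (D u v x) c≋s))
    where open Extends (D-extends u v)

  D-1 : ∀ u v → D u v 1Λ ≋ coeff (E u) v
  D-1 u v = begin
    D u v 1Λ                          ≈⟨ Extends.T-generator (D-extends u v) [] ⟩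
    1Λ ⊛ coeffZ (E u) (v ℤ.+ + 0) ++ []
      ≈⟨ Λ.trans (Λ.+-identityʳ (1Λ ⊛ coeffZ (E u) (v ℤ.+ + 0))) (Λ.*-identityˡ (coeffZ (E u) (v ℤ.+ + 0))) ⟩
    coeffZ (E u) (v ℤ.+ + 0)          ≡⟨ ≡.cong (coeffZ (E u)) (ℤP.+-identityʳ v) ⟩
    coeffZ (E u) v                    ≡⟨ coeffZ-coeff v ⟩
    coeff (E u) v                     ∎
    where
    coeffZ-coeff : ∀ v → coeffZ (E u) v ≡ coeff (E u) v
    coeffZ-coeff (+ n) = ≡.refl
    coeffZ-coeff -[1+ n ] = ≡.refl

  D-p : ∀ u v k x → D u v (pΛ k ⊛ x) ≋ pΛ k ⊛ D u v x
    ++ ((1Λ ++ negate (embed (qK (ℤ.- + 1)) ^^ suc k)) ⊛ (1Λ ++ negate (embed (qK u) ^^ suc k))) ⊛ D u (v ℤ.+ + suc k) x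
  D-p u v k x = ≋-trans
    (extends-twisted (D-extends u v) (D-extends u (v ℤ.+ + suc k)) (k ∷ []) (σK k (C u)) (image-∷ u v k) x)
    (++-cong (≋-refl {pΛ k ⊛ D u v x}) (⊛-congʳ (D u (v ℤ.+ + suc k) x) (α-embed u k)))

  operators : OperatorFamily Λ-ring
  operators = record
    { num-cancel = num-cancel
    ; Q = λ e → embed (qK e)
    ; Q-0 = ≋-refl
    ; Q-+ = λ i j → embed-* (qK i) (qK j)
    ; m⁻¹ = λ k → embed (m⁻¹K k)
    ; m⁻¹-inverse = m⁻¹-inverse
    ; p = pΛ
    ; E = E
    ; E-0 = λ u → expS-0 (logΩnegzCX (bracketT u)) ≋-refl
    ; θ-E = θ-E
    ; D = D
    ; D-cong = λ u v → Extends.T-cong (D-extends u v)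
    ; D-+ = λ u v → Extends.T-+ (D-extends u v)
    ; D-τ = λ u v w k x → scalar-commutes u v x (τ-embed w k)
    ; D-α = λ u v w k x → scalar-commutes u v x (α-embed w k)
    ; D-1 = D-1
    ; D-p = D-p
    }

  open Commutators operators using (monomial; Formula; formula-cong; formula-0; formula-linear; commutator-monomial; structure)

  monomial-generator : ∀ μ → monomial μ ≋ generator μ
  monomial-generator [] = ≋-refl
  monomial-generator (k ∷ μ) = ≋-trans (Λ.*-congˡ {pΛ k} (monomial-generator μ)) (generator-∙ (k ∷ []) μ)

  formula : ∀ a c ε b d → embed ε ⊛ (1Λ ++ negate (embed (qK (a ℤ.+ c)))) ≋ 1Λ → ∀ F → Formula a c (embed ε) b d F
  formula a c ε b d ε-inv [] = formula-0 a c (embed ε) b d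
  formula a c ε b d ε-inv ((k , μ) ∷ F) = formula-cong a c (embed ε) b d (≋-sym (∷-embed k μ F))
    (formula-linear a c (embed ε) b d (embed k) (λ u v → Extends.T-embed (D-extends u v) k) (generator μ) F
      (formula-cong a c (embed ε) b d (monomial-generator μ) (commutator-monomial a c (embed ε) ε-inv μ b d))
      (formula a c ε b d ε-inv F))

  embed-1- : ∀ x → embed (1K +K (-K x)) ≋ 1Λ ++ negate (embed x)
  embed-1- x = embed-+ 1K (-K x)

  module _ (a b c d : ℤ) (hu : ¬ (a ℤ.+ c ≡ + 0)) where
    private
      ε₀ : K
      ε₀ = ε a b c d hu
      A B S : K
      A = 1K +K (-K qK a)
      B = 1K +K (-K qK c)
      S = A *K B *K ε₀ *K (qK (a ℤ.* d) +K (-K qK (c ℤ.* b)))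

      ε-inv : embed ε₀ ⊛ (1Λ ++ negate (embed (qK (a ℤ.+ c)))) ≋ 1Λ
      ε-inv = ≋-trans (Λ.*-congˡ {embed ε₀} (≋-sym (embed-1- (qK (a ℤ.+ c)))))
        (≋-trans (≋-sym (embed-* ε₀ (1K +K (-K qK (a ℤ.+ c))))) (embed-cong (ε-inverse a b c d hu)))

    structure-embed : structure a c (embed ε₀) b d ≋ embed S
    structure-embed = ≋-sym (≋-trans (embed-* (A *K B *K ε₀) (qK (a ℤ.* d) +K (-K qK (c ℤ.* b))))
      (⊛-cong
        (≋-trans (embed-* (A *K B) ε₀) (⊛-congʳ (embed ε₀) (≋-trans (embed-* A B) (⊛-cong (embed-1- (qK a)) (embed-1- (qK c))))))
        (embed-+ (qK (a ℤ.* d)) (-K qK (c ℤ.* b)))))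

    commutator-relation : ∀ F →
      invK Mk Mk-nz ·Λ (D c d (D a b F) -Λ D a b (D c d F))
        ≋
      ((qK (+ 1 ℤ.+ b ℤ.* c) *K bracketQ a *K bracketQ c *K invK (bracketQ (a ℤ.+ c)) (bracketQ-nz (a ℤ.+ c) hu))
        *K ι (oneMinusQ (d ℤ.* a ℤ.- b ℤ.* c)) *K invK (ι (oneMinusQ (+ 1))) (oneMinusQ-nz (+ 1) (λ ())))
        ·Λ D (a ℤ.+ c) (b ℤ.+ d) F
    commutator-relation F = begin
      m ·Λ (X +Λ (-K 1K) ·Λ Y)         ≈⟨ scale-embed m (X +Λ (-K 1K) ·Λ Y) ⟩
      embed m ⊛ (X ++ (-K 1K) ·Λ Y)    ≈⟨ Λ.*-congˡ {embed m} (++-cong (≋-refl {X}) (negate-scale Y)) ⟩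
      embed m ⊛ (X ++ negate Y)        ≈⟨ Λ.*-congˡ {embed m} (formula a c ε₀ b d ε-inv F) ⟩
      embed m ⊛ (structure a c (embed ε₀) b d ⊛ G)
                                       ≈⟨ Λ.*-congˡ {embed m} (⊛-congʳ G structure-embed) ⟩
      embed m ⊛ (embed S ⊛ G)          ≈⟨ ⊛-assoc (embed m) (embed S) G ⟨
      (embed m ⊛ embed S) ⊛ G          ≈⟨ ⊛-congʳ G (embed-* m S) ⟨
      embed (m *K S) ⊛ G               ≈⟨ ⊛-congʳ G (embed-cong (scalar-identity a b c d hu)) ⟩
      embed R ⊛ G                      ≈⟨ scale-embed R G ⟨
      R ·Λ G                           ∎
      where
      m R : K
      m = invK Mk Mk-nz
      R = (qK (+ 1 ℤ.+ b ℤ.* c) *K bracketQ a *K bracketQ c *K invK (bracketQ (a ℤ.+ c)) (bracketQ-nz (a ℤ.+ c) hu))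
        *K ι (oneMinusQ (d ℤ.* a ℤ.- b ℤ.* c)) *K invK (ι (oneMinusQ (+ 1))) (oneMinusQ-nz (+ 1) (λ ()))
      X Y G : Λ
      X = D c d (D a b F)
      Y = D a b (D c d F)
      G = D (a ℤ.+ c) (b ℤ.+ d) F

open import Data.Integer using (_+_; _*_; _-_)

theorem1p1 : (a b c d : ℤ) → ¬ (a ≡ + 0) → ¬ (c ≡ + 0) → (hu : ¬ (a + c ≡ + 0)) → (F : Λ) →
    invK Mk Mk-nz ·Λ (D c d (D a b F) -Λ D a b (D c d F))
    ≈Λ
    ((qK (+ 1 + b * c) *K bracketQ a *K bracketQ c *K invK (bracketQ (a + c)) (bracketQ-nz (a + c) hu))
    *K ι (oneMinusQ (d * a - b * c)) *K invK (ι (oneMinusQ (+ 1))) (oneMinusQ-nz (+ 1) (λ ())))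
    ·Λ D (a + c) (b + d) F
theorem1p1 a b c d _ _ hu F = PowerSums.≋⇒≈Λ (PlethysticOperators.commutator-relation a b c d hu F)
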